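{- Let $F$ be a finite field of order $q=3^n$, where $n$ is odd and $n>1$, and let $d=3^r+2$, where $r$ is a nonnegative integer with $4r\equiv 1 \pmod{n}$. For $a\in F$ put \[ W_{F,d}(a)=\sum_{x\in F}\psi(x^d-ax), \] where $\psi\colon F\to\mathbb{C}$ is the canonical additive character $\psi(x)=\exp(2\pi i\,\mathrm{Tr}(x)/3)$ and $\mathrm{Tr}\colon F\to\mathbb{F}_3$ is the absolute trace. Then, as $a$ runs through $F^\times=F\setminus\{0\}$, the sum $W_{F,d}(a)$ takes exactly three values: \[ W_{F,d}(a)=\begin{cases} 0 & \text{for exactly } q-q/3-1 \text{ values of } a\in F^\times,\\ +\sqrt{3q} & \text{for exactly } (q+\sqrt{3q})/6 \text{ values of } a\in F^\times,\\ -\sqrt{3q} & \text{for exactly } (q-\sqrt{3q})/6 \text{ values of } a\in F^\times. \end{cases} \]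
   Context: The canonical additive character of a finite field $F$ of characteristic $p$ is $\psi(x)=\exp(2\pi i\,\mathrm{Tr}(x)/p)$, where $\mathrm{Tr}\colon F\to\mathbb{F}_p$ is the absolute trace and $\mathrm{Tr}(x)$ is viewed as an integer in $\{0,\dots,p-1\}$. -}

module Defs where

open import Level using (0ℓ)
open import Data.Nat as ℕ using (ℕ; zero; suc)
open import Data.Integer as ℤ using (ℤ)
open import Data.Product using (_×_; _,_)
open import Data.List using (List; []; _∷_; length; filter; foldr; map)
open import Data.List.Membership.Propositional using (_∈_)
open import Data.List.Relation.Unary.Unique.Propositional using (Unique)
open import Relation.Binary.PropositionalEquality using (_≡_)
open import Relation.Binary.Definitions using (DecidableEquality)
open import Relation.Nullary using (¬_; yes; no)
open import Algebra.Structures using (IsCommutativeRing)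

record FiniteField : Set₁ where
  infixl 6 _+_
  infixl 7 _*_
  field
    Carrier   : Set
    _+_ _*_   : Carrier → Carrier → Carrier
    -_        : Carrier → Carrier
    0# 1#     : Carrier
    isCommutativeRing : IsCommutativeRing _≡_ _+_ _*_ -_ 0# 1#
    0≢1       : ¬ (0# ≡ 1#)
    _⁻¹       : Carrier → Carrier
    inverse   : ∀ x → ¬ (x ≡ 0#) → x * (x ⁻¹) ≡ 1#
    _≟_       : DecidableEquality Carrier
    elements  : List Carrier
    complete  : ∀ x → x ∈ elements
    unique    : Unique elements

  order : ℕ
  order = length elements

  pow : Carrier → ℕ → Carrier
  pow x zero    = 1#
  pow x (suc k) = x * pow x k

  -- absolute trace for a field of order 3^n:  Tr(x) = Σ_{i<n} x^(3^i)
  trace : ℕ → Carrier → Carrier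
  trace zero    x = 0#
  trace (suc i) x = pow x (3 ℕ.^ i) + trace i x

  -- the value of Tr(x) ∈ F_3 = {0, 1, 1+1} viewed as an integer in {0,1,2}
  trℕ : ℕ → Carrier → ℕ
  trℕ n x with trace n x ≟ 0#
  ... | yes _ = 0
  ... | no _ with trace n x ≟ 1#
  ...   | yes _ = 1
  ...   | no _  = 2

-- The ring ℤ[ω] ⊂ ℂ, ω = exp(2πi/3), elements a + bω encoded as (a , b).
ℤω : Set
ℤω = ℤ × ℤ

_+ω_ : ℤω → ℤω → ℤω
(a , b) +ω (c , d) = (a ℤ.+ c , b ℤ.+ d)

0ω : ℤω
0ω = (ℤ.+ 0 , ℤ.+ 0)

embℤ : ℤ → ℤω
embℤ m = (m , ℤ.+ 0)

-- ω^j for j ∈ {0,1,2}  (ω² = -1 - ω)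
ωpow : ℕ → ℤω
ωpow 0 = (ℤ.+ 1 , ℤ.+ 0)
ωpow 1 = (ℤ.+ 0 , ℤ.+ 1)
ωpow _ = (ℤ.-[1+ 0 ] , ℤ.-[1+ 0 ])

_≟ω_ : DecidableEquality ℤω
(a , b) ≟ω (c , d) with a ℤ.≟ c | b ℤ.≟ d
... | yes _≡_.refl | yes _≡_.refl = yes _≡_.refl
... | no p | _ = no λ { _≡_.refl → p _≡_.refl }
... | yes _ | no q = no λ { _≡_.refl → q _≡_.refl }

module _ (F : FiniteField) where
  open FiniteField F

  ψ : ℕ → Carrier → ℤω
  ψ n x = ωpow (trℕ n x)

  W : ℕ → ℕ → Carrier → ℤω
  W n d a = foldr _+ω_ 0ω (map (λ x → ψ n (pow x d + (- (a * x)))) elements)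

  nonzero : List Carrier
  nonzero = filter (λ x → Relation.Nullary.¬? (x ≟ 0#)) elements

  countW : ℕ → ℕ → ℤω → ℕ
  countW n d v = length (filter (λ a → W n d a ≟ω v) nonzero)

{-# OPTIONS --safe #-}
-- Let λ = 1 − ω, L = 3^r and n = 2m + 1. The fourth power moment Σ W⁴ = 3q Σ W² follows by
-- counting the zeros of A^L B C + A B^L C + A B C^L: off the coordinate planes this is A^(L−1)
-- + B^(L−1) + C^(L−1) = 0, which a power permutation of F turns into the quadric A² + B² + C²
-- = 0. All W(a) are rational integers, so if each is divisible by s = 3^(m+1) = √(3q), then
-- every term of Σ W² (W² − s²) = 0 is nonnegative and W(a) ∈ {0, s, −s}; the moments ΣW = q
-- and ΣW² = q² give the frequencies.
--
-- For the divisibility, expand W(a) in Gauss sums φ(i) = Σ ψ(y) τ(y)^i of the Teichmüller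
-- character τ. Jacobi sums relate φ(i) to φ(i+1) and show that λ^(2n − w) divides φ(i), where
-- w is the sum of the ternary digits of i. It remains to see that w(d i) ≤ w(i) + n. Since 4r
-- ≡ 1 (mod n), reading the digits in steps of r puts the carries of L i + 2 i on the cycles of
-- a finite graph, and a potential shows that no cycle has positive weight. This gives λ^n ∣
-- W(a), which suffices as n is odd and W(a) ∈ ℤ.
--
-- In place of Witt vectors, the Gauss sums live in the monoid ring ℤ[ω][F], localised at the
-- elements that do not vanish in F, modulo the intersection of the powers of λ.
module Submission where

open import Defs
open import Algebra.Bundles using (CommutativeRing)
open import Data.Fin using (Fin; opposite; toℕ)
open import Data.Fin.Patterns using (0F; 1F; 2F)
import Data.Fin.Properties as Finₚ
open import Data.Integer as ℤ using (-[1+_]; ℤ)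
import Data.Integer.Properties as ℤₚ
open import Data.List using (List; []; _++_; _∷_; cartesianProductWith; foldr; length; map)
open import Data.List.Membership.Propositional using (_∈_)
open import Data.List.Properties using (length-map)
open import Data.List.Relation.Binary.Permutation.Propositional using (_↭_)
open import Data.List.Relation.Unary.All as All using (all?)
open import Data.List.Relation.Unary.All.Properties using (¬All⇒Any¬)
open import Data.List.Relation.Unary.Any using (here; there)
open import Data.Nat as ℕ using (NonZero; suc; s≤s; zero; z≤n; ℕ)
import Data.Nat.Properties as ℕₚ
import Data.Nat.Tactic.RingSolver as ℕ-Solver
open import Data.Product using (_,_; _×_; proj₁; proj₂; ∃-syntax)
open import Data.Sum using (_⊎_; inj₁; inj₂)
open import Level using (0ℓ)
open import Relation.Binary.PropositionalEquality as ≡ using (_≡_; _≢_; cong; cong₂; subst; module ≡-Reasoning)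
open import Relation.Nullary using (Dec; contradiction; no; yes; ¬_)

-- Two steps depend on how r sits modulo n. Since 4r ≡ 1, four steps of length r lead from one digit
-- position to the next. A state made of one digit and four carries therefore determines, with the
-- next digit read, the state after it. This bounds the graph to 3^5 vertices, whatever n is.
-- Secondly, x^((L-1)/2) permutes F only if (L-1)/2 is odd, that is, if r is odd. An even r is
-- replaced by r + n, which is odd, satisfies the same congruence and defines the same function x^d.
-- The Gauss sum argument uses laws of the Witt vectors that fail in the bare monoid ring: there [0]
-- is not 0, and the power sums of Teichmüller elements do not vanish. After localisation, however,
-- each of these elements is divisible by every power of λ, and passing to the quotient by the
-- intersection of these powers restores the laws. What has to be shown is that nothing is lost for
-- scalars: a constant of ℤ[ω] that is divisible by λ^k in the new ring is so in ℤ[ω].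

-- Finite sums, integer multiples and quotients in commutative rings.

module RingSums where
  open import Algebra.Solver.Ring.AlmostCommutativeRing using (fromCommutativeRing; _-Raw-AlmostCommutative⟶_)
  import Algebra.Properties.Ring as RingProperties
  import Algebra.Properties.Semiring.Mult.TCOptimised as Multiples
  import Algebra.Solver.Ring as RingSolver
  open import Data.Integer using (+_)
  open import Data.List.Relation.Binary.Permutation.Propositional using (refl; prep; swap; trans)
  open import Data.List.Relation.Unary.All using ([]; _∷_)
  open import Data.Maybe using (Maybe; just; nothing)
  open import Level using (_⊔_) renaming (suc to lsuc)

  module Kit {c ℓ} (R : CommutativeRing c ℓ) where
    open CommutativeRing R public hiding (refl; trans; zero)
    open CommutativeRing R using () renaming (refl to ≈-refl; trans to ≈-trans) public
    open RingProperties ring public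
    open import Relation.Binary.Reasoning.Setoid setoid
    private module × = Multiples semiring

    infix 30 _ᴺ
    -- With this form of multiples `1 ᴺ` and `3 ᴺ` reduce to `1#` and `(1# + 1#) + 1#`, which the
    -- computations in characteristic three rely on.
    _ᴺ : ℕ → Carrier
    n ᴺ = n ×.× 1#

    ᴺ-+ : ∀ m n → (m ℕ.+ n) ᴺ ≈ m ᴺ + n ᴺ
    ᴺ-+ = ×.×-homo-+ 1#

    ᴺ-* : ∀ m n → (m ℕ.* n) ᴺ ≈ m ᴺ * n ᴺ
    ᴺ-* = ×.×1-homo-*

    ᴺ-suc : ∀ n → suc n ᴺ ≈ 1# + n ᴺ
    ᴺ-suc = ᴺ-+ 1

    ⟦_⟧ℤ : ℤ → Carrier
    ⟦ + n ⟧ℤ = n ᴺ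
    ⟦ -[1+ n ] ⟧ℤ = - (suc n ᴺ)

    ⟦⟧-neg : ∀ i → ⟦ ℤ.- i ⟧ℤ ≈ - ⟦ i ⟧ℤ
    ⟦⟧-neg (+ zero) = sym -0#≈0#
    ⟦⟧-neg (+ suc n) = ≈-refl
    ⟦⟧-neg -[1+ n ] = sym (-‿involutive _)

    ⟦⟧-⊖ : ∀ m n → ⟦ m ℤ.⊖ n ⟧ℤ ≈ m ᴺ - n ᴺ
    ⟦⟧-⊖ zero zero = sym (≈-trans (+-identityˡ _) -0#≈0#)
    ⟦⟧-⊖ zero (suc n) = sym (+-identityˡ _)
    ⟦⟧-⊖ (suc m) zero = sym (≈-trans (+-congˡ -0#≈0#) (+-identityʳ _))
    ⟦⟧-⊖ (suc m) (suc n) = begin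
      ⟦ suc m ℤ.⊖ suc n ⟧ℤ ≡⟨ ≡.cong ⟦_⟧ℤ (ℤₚ.[1+m]⊖[1+n]≡m⊖n m n) ⟩
      ⟦ m ℤ.⊖ n ⟧ℤ ≈⟨ ⟦⟧-⊖ m n ⟩
      m ᴺ - n ᴺ ≈⟨ +-congˡ (sym (+-identityˡ _)) ⟩
      m ᴺ + (0# - n ᴺ) ≈⟨ +-congˡ (+-congʳ (sym (-‿inverseʳ 1#))) ⟩
      m ᴺ + (1# - 1# - n ᴺ) ≈⟨ +-congˡ (+-assoc _ _ _) ⟩
      m ᴺ + (1# + (- 1# - n ᴺ)) ≈⟨ sym (+-assoc _ _ _) ⟩
      m ᴺ + 1# + (- 1# - n ᴺ) ≈⟨ +-cong (+-comm _ _) (-‿+-comm 1# (n ᴺ)) ⟩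
      1# + m ᴺ - (1# + n ᴺ) ≈⟨ +-cong (sym (ᴺ-suc m)) (-‿cong (sym (ᴺ-suc n))) ⟩
      suc m ᴺ - suc n ᴺ ∎

    ⟦⟧-+ : ∀ i j → ⟦ i ℤ.+ j ⟧ℤ ≈ ⟦ i ⟧ℤ + ⟦ j ⟧ℤ
    ⟦⟧-+ (+ m) (+ n) = ᴺ-+ m n
    ⟦⟧-+ (+ m) -[1+ n ] = ⟦⟧-⊖ m (suc n)
    ⟦⟧-+ -[1+ m ] (+ n) = ≈-trans (⟦⟧-⊖ n (suc m)) (+-comm _ _)
    ⟦⟧-+ -[1+ m ] -[1+ n ] = begin
      - (suc (suc (m ℕ.+ n)) ᴺ) ≡⟨ ≡.cong (λ k → - (suc k ᴺ)) (≡.sym (ℕₚ.+-suc m n)) ⟩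
      - ((suc m ℕ.+ suc n) ᴺ) ≈⟨ -‿cong (ᴺ-+ (suc m) (suc n)) ⟩
      - (suc m ᴺ + suc n ᴺ) ≈⟨ sym (-‿+-comm _ _) ⟩
      - (suc m ᴺ) - suc n ᴺ ∎

    private
      ⟦⟧-*ᴺ : ∀ m j → ⟦ + m ℤ.* j ⟧ℤ ≈ m ᴺ * ⟦ j ⟧ℤ
      ⟦⟧-*ᴺ m (+ n) = ≈-trans (reflexive (≡.cong ⟦_⟧ℤ (≡.sym (ℤₚ.pos-* m n)))) (ᴺ-* m n)
      ⟦⟧-*ᴺ m -[1+ n ] = begin
        ⟦ + m ℤ.* ℤ.- (+ suc n) ⟧ℤ ≡⟨ ≡.cong ⟦_⟧ℤ (≡.sym (ℤₚ.neg-distribʳ-* (+ m) (+ suc n))) ⟩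
        ⟦ ℤ.- (+ m ℤ.* + suc n) ⟧ℤ ≈⟨ ⟦⟧-neg (+ m ℤ.* + suc n) ⟩
        - ⟦ + m ℤ.* + suc n ⟧ℤ ≈⟨ -‿cong (⟦⟧-*ᴺ m (+ suc n)) ⟩
        - (m ᴺ * suc n ᴺ) ≈⟨ -‿distribʳ-* _ _ ⟩
        m ᴺ * - (suc n ᴺ) ∎

    ⟦⟧-* : ∀ i j → ⟦ i ℤ.* j ⟧ℤ ≈ ⟦ i ⟧ℤ * ⟦ j ⟧ℤ
    ⟦⟧-* (+ m) j = ⟦⟧-*ᴺ m j
    ⟦⟧-* -[1+ m ] j = begin
      ⟦ ℤ.- (+ suc m) ℤ.* j ⟧ℤ ≡⟨ ≡.cong ⟦_⟧ℤ (≡.sym (ℤₚ.neg-distribˡ-* (+ suc m) j)) ⟩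
      ⟦ ℤ.- (+ suc m ℤ.* j) ⟧ℤ ≈⟨ ⟦⟧-neg (+ suc m ℤ.* j) ⟩
      - ⟦ + suc m ℤ.* j ⟧ℤ ≈⟨ -‿cong (⟦⟧-*ᴺ (suc m) j) ⟩
      - (suc m ᴺ * ⟦ j ⟧ℤ) ≈⟨ -‿distribˡ-* _ _ ⟩
      - (suc m ᴺ) * ⟦ j ⟧ℤ ∎

    private
      -- With ℤ as coefficient ring, `con (+ 3)` evaluates to `3 ᴺ`; in characteristic three an
      -- identity can then be proved up to an explicit multiple of 3.
      integers : ℤ.+-*-rawRing -Raw-AlmostCommutative⟶ fromCommutativeRing R
      integers = record
        { ⟦_⟧ = ⟦_⟧ℤ ; +-homo = ⟦⟧-+ ; *-homo = ⟦⟧-* ; -‿homo = ⟦⟧-neg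
        ; 0-homo = ≈-refl ; 1-homo = ≈-refl }

      sameInteger : ∀ i j → Maybe (⟦ i ⟧ℤ ≈ ⟦ j ⟧ℤ)
      sameInteger i j with i ℤ.≟ j
      ... | yes i≡j = just (reflexive (≡.cong ⟦_⟧ℤ i≡j))
      ... | no _ = nothing

    open RingSolver ℤ.+-*-rawRing (fromCommutativeRing R) integers sameInteger public
      using (Polynomial; solve; _:=_; _:+_; _:*_; _:-_; :-_; con)

    Σ : ∀ {a} {A : Set a} → List A → (A → Carrier) → Carrier
    Σ xs f = foldr _+_ 0# (map f xs)

    module _ {a} {A : Set a} where

      Σ-cong : ∀ (xs : List A) {f g} → (∀ x → f x ≈ g x) → Σ xs f ≈ Σ xs g
      Σ-cong [] eq = ≈-refl
      Σ-cong (x ∷ xs) eq = +-cong (eq x) (Σ-cong xs eq)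

      Σ-cong-∈ : ∀ (xs : List A) {f g} → (∀ {x} → x ∈ xs → f x ≈ g x) → Σ xs f ≈ Σ xs g
      Σ-cong-∈ [] eq = ≈-refl
      Σ-cong-∈ (x ∷ xs) eq = +-cong (eq (here ≡.refl)) (Σ-cong-∈ xs (λ x∈ → eq (there x∈)))

      Σ-zero : ∀ (xs : List A) {f} → (∀ {x} → x ∈ xs → f x ≈ 0#) → Σ xs f ≈ 0#
      Σ-zero [] eq = ≈-refl
      Σ-zero (x ∷ xs) eq = ≈-trans (+-cong (eq (here ≡.refl)) (Σ-zero xs (λ x∈ → eq (there x∈)))) (+-identityˡ _)

      Σ-+ : ∀ (xs : List A) f g → Σ xs (λ x → f x + g x) ≈ Σ xs f + Σ xs g
      Σ-+ [] f g = sym (+-identityˡ _)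
      Σ-+ (x ∷ xs) f g = ≈-trans (+-congˡ (Σ-+ xs f g))
        (solve 4 (λ a b s t → (a :+ b) :+ (s :+ t) := (a :+ s) :+ (b :+ t)) ≈-refl _ _ _ _)

      Σ-*ˡ : ∀ (xs : List A) k f → Σ xs (λ x → k * f x) ≈ k * Σ xs f
      Σ-*ˡ [] k f = sym (zeroʳ k)
      Σ-*ˡ (x ∷ xs) k f = ≈-trans (+-congˡ (Σ-*ˡ xs k f)) (sym (distribˡ _ _ _))

      Σ-*ʳ : ∀ (xs : List A) k f → Σ xs (λ x → f x * k) ≈ Σ xs f * k
      Σ-*ʳ xs k f = ≈-trans (Σ-cong xs (λ x → *-comm _ _)) (≈-trans (Σ-*ˡ xs k f) (*-comm _ _))

      Σ-neg : ∀ (xs : List A) f → Σ xs (λ x → - f x) ≈ - Σ xs f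
      Σ-neg [] f = sym -0#≈0#
      Σ-neg (x ∷ xs) f = ≈-trans (+-congˡ (Σ-neg xs f)) (-‿+-comm _ _)

      Σ-- : ∀ (xs : List A) f g → Σ xs (λ x → f x - g x) ≈ Σ xs f - Σ xs g
      Σ-- xs f g = ≈-trans (Σ-+ xs f _) (+-congˡ (Σ-neg xs g))

      Σ-const : ∀ (xs : List A) k → Σ xs (λ _ → k) ≈ length xs ᴺ * k
      Σ-const [] k = sym (zeroˡ k)
      Σ-const (x ∷ xs) k = begin
        k + Σ xs (λ _ → k) ≈⟨ +-cong (sym (*-identityˡ k)) (Σ-const xs k) ⟩
        1# * k + length xs ᴺ * k ≈⟨ sym (distribʳ _ _ _) ⟩
        (1# + length xs ᴺ) * k ≈⟨ *-congʳ (sym (ᴺ-suc (length xs))) ⟩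
        suc (length xs) ᴺ * k ∎

      Σ-↭ : ∀ {xs ys : List A} f → xs ↭ ys → Σ xs f ≈ Σ ys f
      Σ-↭ f refl = ≈-refl
      Σ-↭ f (prep x p) = +-congˡ (Σ-↭ f p)
      Σ-↭ f (swap x y p) = ≈-trans (+-congˡ (+-congˡ (Σ-↭ f p)))
        (solve 3 (λ a b s → a :+ (b :+ s) := b :+ (a :+ s)) ≈-refl _ _ _)
      Σ-↭ f (trans p q) = ≈-trans (Σ-↭ f p) (Σ-↭ f q)

    module _ {a b} {A : Set a} {B : Set b} where

      Σ-map : ∀ (h : A → B) xs f → Σ (map h xs) f ≈ Σ xs (λ x → f (h x))
      Σ-map h [] f = ≈-refl
      Σ-map h (x ∷ xs) f = +-congˡ (Σ-map h xs f)

      Σ-swap : ∀ (xs : List A) (ys : List B) (f : A → B → Carrier) →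
        Σ xs (λ x → Σ ys (λ y → f x y)) ≈ Σ ys (λ y → Σ xs (λ x → f x y))
      Σ-swap [] ys f = sym (Σ-zero ys {λ _ → 0#} (λ _ → ≈-refl))
      Σ-swap (x ∷ xs) ys f = ≈-trans (+-congˡ (Σ-swap xs ys f)) (sym (Σ-+ ys (f x) (λ y → Σ xs (λ x → f x y))))

      Σ-*-Σ : ∀ (xs : List A) (ys : List B) f g →
        Σ xs f * Σ ys g ≈ Σ xs (λ x → Σ ys (λ y → f x * g y))
      Σ-*-Σ xs ys f g = ≈-trans (sym (Σ-*ʳ xs _ f)) (Σ-cong xs (λ x → sym (Σ-*ˡ ys (f x) g)))

    Σ-++ : ∀ {a} {A : Set a} (xs ys : List A) (f : A → Carrier) → Σ (xs ++ ys) f ≈ Σ xs f + Σ ys f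
    Σ-++ [] ys f = sym (+-identityˡ _)
    Σ-++ (x ∷ xs) ys f = ≈-trans (+-congˡ (Σ-++ xs ys f)) (sym (+-assoc _ _ _))

    Σ-cartesian : ∀ {a b c} {A : Set a} {B : Set b} {C : Set c} (h : A → B → C) xs ys (f : C → Carrier) →
      Σ (cartesianProductWith h xs ys) f ≈ Σ xs (λ x → Σ ys (λ y → f (h x y)))
    Σ-cartesian h [] ys f = ≈-refl
    Σ-cartesian h (x ∷ xs) ys f = ≈-trans (Σ-++ (map (h x) ys) _ f)
      (+-cong (Σ-map (h x) ys f) (Σ-cartesian h xs ys f))

  record Ideal {c ℓ} (B : CommutativeRing c ℓ) : Set (c ⊔ lsuc ℓ) where
    open CommutativeRing B using (Carrier; _≈_; _+_; _*_; 0#)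
    field
      I : Carrier → Set ℓ
      I-resp : ∀ {x y} → x ≈ y → I x → I y
      I-0 : I 0#
      I-+ : ∀ {x y} → I x → I y → I (x + y)
      I-* : ∀ x {y} → I y → I (x * y)

  module Quotient {c ℓ} (B : CommutativeRing c ℓ) (ideal : Ideal B) where
    open CommutativeRing B hiding (refl; trans)
    open Ideal ideal
    private module B = Kit B

    infix 4 _∼_
    record _∼_ (x y : Carrier) : Set ℓ where
      constructor difference
      field difference∈I : I (x - y)
    open _∼_ public

    ≈⇒∼ : ∀ {x y} → x ≈ y → x ∼ y
    ≈⇒∼ eq = difference (I-resp (sym (B.≈-trans (+-congʳ eq) (-‿inverseʳ _))) I-0)

    I⇒∼0 : ∀ {x} → I x → x ∼ 0#
    I⇒∼0 p = difference (I-resp (sym (B.≈-trans (+-congˡ B.-0#≈0#) (+-identityʳ _))) p)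

    private
      ∼-sym : ∀ {x y} → x ∼ y → y ∼ x
      ∼-sym {x} {y} (difference p) = difference (I-resp
        (B.solve 2 (λ x y → B.con (ℤ.- + 1) B.:* (x B.:- y) B.:= y B.:- x) B.≈-refl x y) (I-* (- 1#) p))

      ∼-trans : ∀ {x y z} → x ∼ y → y ∼ z → x ∼ z
      ∼-trans {x} {y} {z} (difference p) (difference r) = difference (I-resp
        (B.solve 3 (λ x y z → (x B.:- y) B.:+ (y B.:- z) B.:= x B.:- z) B.≈-refl x y z) (I-+ p r))

      ∼-+ : ∀ {x y u v} → x ∼ y → u ∼ v → x + u ∼ y + v
      ∼-+ {x} {y} {u} {v} (difference p) (difference r) = difference (I-resp
        (B.solve 4 (λ x y u v → (x B.:- y) B.:+ (u B.:- v) B.:= (x B.:+ u) B.:- (y B.:+ v)) B.≈-refl x y u v) (I-+ p r))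

      ∼-* : ∀ {x y u v} → x ∼ y → u ∼ v → x * u ∼ y * v
      ∼-* {x} {y} {u} {v} (difference p) (difference r) = difference (I-resp
        (B.solve 4 (λ x y u v → u B.:* (x B.:- y) B.:+ y B.:* (u B.:- v) B.:= x B.:* u B.:- y B.:* v) B.≈-refl x y u v)
        (I-+ (I-* u p) (I-* y r)))

      ∼-neg : ∀ {x y} → x ∼ y → - x ∼ - y
      ∼-neg {x} {y} (difference p) = difference (I-resp
        (B.solve 2 (λ x y → B.con (ℤ.- + 1) B.:* (x B.:- y) B.:= (B.:- x) B.:- (B.:- y)) B.≈-refl x y) (I-* (- 1#) p))

    quotient : CommutativeRing c ℓ
    quotient = record
      { Carrier = Carrier ; _≈_ = _∼_ ; _+_ = _+_ ; _*_ = _*_ ; -_ = -_ ; 0# = 0# ; 1# = 1#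
      ; isCommutativeRing = record
        { isRing = record
          { +-isAbelianGroup = record
            { isGroup = record
              { isMonoid = record
                { isSemigroup = record
                  { isMagma = record
                    { isEquivalence = record { refl = ≈⇒∼ B.≈-refl ; sym = ∼-sym ; trans = ∼-trans }
                    ; ∙-cong = ∼-+ }
                  ; assoc = λ x y z → ≈⇒∼ (+-assoc x y z) }
                ; identity = (λ x → ≈⇒∼ (+-identityˡ x)) , (λ x → ≈⇒∼ (+-identityʳ x)) }
              ; inverse = (λ x → ≈⇒∼ (-‿inverseˡ x)) , (λ x → ≈⇒∼ (-‿inverseʳ x))
              ; ⁻¹-cong = ∼-neg }
            ; comm = λ x y → ≈⇒∼ (+-comm x y) }
          ; *-cong = ∼-*
          ; *-assoc = λ x y z → ≈⇒∼ (*-assoc x y z)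
          ; *-identity = (λ x → ≈⇒∼ (*-identityˡ x)) , (λ x → ≈⇒∼ (*-identityʳ x))
          ; distrib = (λ x y z → ≈⇒∼ (distribˡ x y z)) , (λ x y z → ≈⇒∼ (distribʳ x y z)) }
        ; *-comm = λ x y → ≈⇒∼ (*-comm x y) } }

-- Finite fields: permutations of the elements, powers and roots.

module FiniteFields where
  open RingSums
  open import Data.List.Membership.Propositional.Properties using (∈-∃++; ∈-filter⁺; ∈-filter⁻; ∈-map⁻)
  open import Data.List.Relation.Binary.Permutation.Propositional using (↭-refl; ↭-sym; ↭-trans; ↭-prep; ↭⇒↭ₛ)
  open import Data.List.Relation.Binary.Permutation.Propositional.Properties using (shift; ↭-length; ∈-resp-↭)
  open import Data.List.Relation.Binary.Permutation.Setoid.Properties using (foldr-commMonoid)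
  open import Data.List.Relation.Unary.All using (All; []; _∷_)
  open import Data.List.Relation.Unary.AllPairs using ([]; _∷_)
  open import Data.List.Relation.Unary.Any using (Any)
  open import Data.List.Relation.Unary.Unique.Propositional using (Unique)
  open import Data.List.Relation.Unary.Unique.Propositional.Properties using (map⁺; filter⁺)
  open import Relation.Binary.PropositionalEquality using (refl; setoid)
  open import Relation.Nullary using (¬?)

  module _ {a} {A : Set a} where

    extract : ∀ {x} {ys : List A} → x ∈ ys → ∃[ zs ] ys ↭ x ∷ zs
    extract {x} x∈ys with ∈-∃++ x∈ys
    ... | us , vs , refl = us ++ vs , shift x us vs

    private
      remaining : ∀ {x} {xs ys zs : List A} → All (x ≢_) xs → (∀ {y} → y ∈ x ∷ xs → y ∈ ys) →
        ys ↭ x ∷ zs → ∀ {y} → y ∈ xs → y ∈ zs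
      remaining x∉ sub p y∈xs with ∈-resp-↭ p (sub (there y∈xs))
      ... | here refl = contradiction refl (All.lookup x∉ y∈xs)
      ... | there y∈zs = y∈zs

    unique-⊆⇒length-≤ : ∀ {xs ys : List A} → Unique xs → (∀ {x} → x ∈ xs → x ∈ ys) → length xs ℕ.≤ length ys
    unique-⊆⇒length-≤ [] sub = z≤n
    unique-⊆⇒length-≤ (x∉ ∷ u) sub with extract (sub (here refl))
    ... | zs , p = subst (_ ℕ.≤_) (≡.sym (↭-length p)) (s≤s (unique-⊆⇒length-≤ u (remaining x∉ sub p)))

    unique-⊆⇒↭ : ∀ {xs ys : List A} → Unique xs → (∀ {x} → x ∈ xs → x ∈ ys) → length ys ℕ.≤ length xs → xs ↭ ys
    unique-⊆⇒↭ {ys = []} [] sub len = ↭-refl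
    unique-⊆⇒↭ {xs = x ∷ xs} {ys} (x∉ ∷ u) sub len with extract (sub (here refl))
    ... | zs , p = ↭-trans (↭-prep x (unique-⊆⇒↭ u (remaining x∉ sub p)
          (ℕₚ.≤-pred (subst (ℕ._≤ _) (↭-length p) len)))) (↭-sym p)

    -- Every change of variables in the sums over F, and Fermat's theorem, rests on this pigeonhole
    -- argument.
    injection-permutes : ∀ {xs : List A} {h : A → A} → Unique xs → (∀ {x y} → h x ≡ h y → x ≡ y) →
      (∀ {x} → x ∈ xs → h x ∈ xs) → map h xs ↭ xs
    injection-permutes {xs} {h} u inj closed = unique-⊆⇒↭ (map⁺ inj u) sub
        (ℕₚ.≤-reflexive (≡.sym (length-map h xs)))
      where
      sub : ∀ {y} → y ∈ map h xs → y ∈ xs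
      sub y∈ with ∈-map⁻ h y∈
      ... | x , x∈ , refl = closed x∈

  fieldRing : FiniteField → CommutativeRing 0ℓ 0ℓ
  fieldRing F = record { isCommutativeRing = FiniteField.isCommutativeRing F }

  module Elements (F : FiniteField) where
    open FiniteField F public using (elements; pow; _⁻¹; inverse; _≟_; complete; unique; 0≢1; trace; trℕ)
    open Kit (fieldRing F) public hiding (sym; reflexive; setoid)
    open ≡ using (sym; trans)
    open ≡.≡-Reasoning

    X = Carrier

    nz : List X
    nz = nonzero F

    q-1 : ℕ
    q-1 = length nz

    ∈-nz : ∀ {x} → x ≢ 0# → x ∈ nz
    ∈-nz {x} x≢0 = ∈-filter⁺ (λ x → ¬? (x ≟ 0#)) (complete x) x≢0

    nz-∈ : ∀ {x} → x ∈ nz → x ≢ 0#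
    nz-∈ x∈ = proj₂ (∈-filter⁻ (λ x → ¬? (x ≟ 0#)) {xs = elements} x∈)

    unique-nz : Unique nz
    unique-nz = filter⁺ (λ x → ¬? (x ≟ 0#)) unique

    private
      unique-0∷nz : Unique (0# ∷ nz)
      unique-0∷nz = All.tabulate (λ x∈ 0≡x → nz-∈ x∈ (sym 0≡x)) ∷ unique-nz

      elements⊆ : ∀ {x} → x ∈ elements → x ∈ 0# ∷ nz
      elements⊆ {x} _ with x ≟ 0#
      ... | yes x≡0 = here x≡0
      ... | no x≢0 = there (∈-nz x≢0)

    elements↭ : elements ↭ 0# ∷ nz
    elements↭ = unique-⊆⇒↭ unique elements⊆ (unique-⊆⇒length-≤ unique-0∷nz (λ {x} _ → complete x))

    order≡ : FiniteField.order F ≡ suc q-1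
    order≡ = ↭-length elements↭

    inverseˡ : ∀ {x} y → x ≢ 0# → (x ⁻¹) * (x * y) ≡ y
    inverseˡ {x} y x≢0 = trans (sym (*-assoc _ _ _)) (trans (cong (_* y) (trans (*-comm _ _) (inverse x x≢0))) (*-identityˡ y))

    *-cancelˡ : ∀ {x y z} → x ≢ 0# → x * y ≡ x * z → y ≡ z
    *-cancelˡ {x} {y} {z} x≢0 eq = trans (sym (inverseˡ y x≢0)) (trans (cong ((x ⁻¹) *_) eq) (inverseˡ z x≢0))

    *-zero-cancelˡ : ∀ {x y} → x ≢ 0# → x * y ≡ 0# → y ≡ 0#
    *-zero-cancelˡ {x} x≢0 eq = *-cancelˡ x≢0 (trans eq (sym (zeroʳ x)))

    *-≢0 : ∀ {x y} → x ≢ 0# → y ≢ 0# → x * y ≢ 0#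
    *-≢0 x≢0 y≢0 eq = y≢0 (*-zero-cancelˡ x≢0 eq)

    x-y≡0⇒x≡y : ∀ {x y} → x - y ≡ 0# → x ≡ y
    x-y≡0⇒x≡y {x} {y} eq = trans (solve 2 (λ x y → x := (x :- y) :+ y) refl x y) (trans (cong (_+ y) eq) (+-identityˡ y))

    pow-+ : ∀ x m n → pow x (m ℕ.+ n) ≡ pow x m * pow x n
    pow-+ x zero n = sym (*-identityˡ _)
    pow-+ x (suc m) n = trans (cong (x *_) (pow-+ x m n)) (sym (*-assoc _ _ _))

    pow-1# : ∀ m → pow 1# m ≡ 1#
    pow-1# zero = refl
    pow-1# (suc m) = trans (*-identityˡ _) (pow-1# m)

    pow-0# : ∀ m → m ≢ 0 → pow 0# m ≡ 0#
    pow-0# zero m≢0 = contradiction refl m≢0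
    pow-0# (suc m) _ = zeroˡ _

    pow-distrib : ∀ x y m → pow (x * y) m ≡ pow x m * pow y m
    pow-distrib x y zero = sym (*-identityˡ _)
    pow-distrib x y (suc m) = trans (cong (x * y *_) (pow-distrib x y m))
      (solve 4 (λ x y a b → (x :* y) :* (a :* b) := (x :* a) :* (y :* b)) refl x y _ _)

    pow-* : ∀ x m n → pow x (m ℕ.* n) ≡ pow (pow x m) n
    pow-* x zero n = sym (pow-1# n)
    pow-* x (suc m) n = trans (pow-+ x n (m ℕ.* n)) (trans (cong (pow x n *_) (pow-* x m n)) (sym (pow-distrib x _ n)))

    pow-comm : ∀ x m n → pow (pow x m) n ≡ pow (pow x n) m
    pow-comm x m n = trans (sym (pow-* x m n)) (trans (cong (pow x) (ℕₚ.*-comm m n)) (pow-* x n m))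

    pow-≢0 : ∀ {x} m → x ≢ 0# → pow x m ≢ 0#
    pow-≢0 zero x≢0 eq = 0≢1 (sym eq)
    pow-≢0 (suc m) x≢0 = *-≢0 x≢0 (pow-≢0 m x≢0)

    pow-≡0 : ∀ {x} m → pow x m ≡ 0# → x ≡ 0#
    pow-≡0 {x} m eq with x ≟ 0#
    ... | yes x≡0 = x≡0
    ... | no x≢0 = contradiction eq (pow-≢0 m x≢0)

    -- Multiplication by x permutes the nonzero elements, so their product is unchanged by the
    -- factor x^(q-1) and can be cancelled.
    fermat : ∀ {x} → x ≢ 0# → pow x q-1 ≡ 1#
    fermat {x} x≢0 = *-cancelˡ (Π-≢0 nz (λ x∈ → nz-∈ x∈)) (begin
        Π nz * pow x q-1 ≡⟨ *-comm _ _ ⟩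
        pow x q-1 * Π nz ≡⟨ sym (Π-map nz) ⟩
        Π (map (x *_) nz) ≡⟨ foldr-commMonoid (setoid X) *-isCommutativeMonoid (↭⇒↭ₛ permuted) ⟩
        Π nz ≡⟨ sym (*-identityʳ _) ⟩
        Π nz * 1# ∎)
      where
      Π : List X → X
      Π = foldr _*_ 1#
      Π-≢0 : ∀ xs → (∀ {y} → y ∈ xs → y ≢ 0#) → Π xs ≢ 0#
      Π-≢0 [] _ eq = 0≢1 (sym eq)
      Π-≢0 (y ∷ ys) ne = *-≢0 (ne (here refl)) (Π-≢0 ys (λ y∈ → ne (there y∈)))
      Π-map : ∀ xs → Π (map (x *_) xs) ≡ pow x (length xs) * Π xs
      Π-map [] = sym (*-identityˡ _)
      Π-map (y ∷ ys) = trans (cong (x * y *_) (Π-map ys))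
        (solve 4 (λ x y a b → (x :* y) :* (a :* b) := (x :* a) :* (y :* b)) refl x y _ _)
      permuted : map (x *_) nz ↭ nz
      permuted = injection-permutes unique-nz (*-cancelˡ x≢0) (λ y∈ → ∈-nz (*-≢0 x≢0 (nz-∈ y∈)))

    pow-q : ∀ x → pow x (suc q-1) ≡ x
    pow-q x with x ≟ 0#
    ... | yes refl = zeroˡ _
    ... | no x≢0 = trans (cong (x *_) (fermat x≢0)) (*-identityʳ x)

    -- A monic polynomial of degree m, given as a function together with its Horner form c + x g(x);
    -- this avoids lists of coefficients.
    data Monic : ℕ → (X → X) → Set where
      one : ∀ {f} → (∀ x → f x ≡ 1#) → Monic 0 f
      step : ∀ {m f g} c → (∀ x → f x ≡ c + x * g x) → Monic m g → Monic (suc m) f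

    monic-+ : ∀ {m f g} a → Monic (suc m) f → Monic m g → Monic (suc m) (λ x → f x + a * g x)
    monic-+ a (step c f≡ Mf) (one g≡1) = step (c + a)
      (λ x → trans (cong₂ (λ u v → u + a * v) (f≡ x) (g≡1 x))
        (solve 3 (λ c a xh → (c :+ xh) :+ a :* con (ℤ.+ 1) := (c :+ a) :+ xh) refl c a _)) Mf
    monic-+ a (step c f≡ Mf) (step c' g≡ Mg) = step (c + a * c')
      (λ x → trans (cong₂ (λ u v → u + a * v) (f≡ x) (g≡ x))
        (solve 6 (λ c a c' x u v → (c :+ x :* u) :+ a :* (c' :+ x :* v) := (c :+ a :* c') :+ x :* (u :+ a :* v)) refl c a c' x _ _))
      (monic-+ a Mf Mg)

    -- In Horner form f(x) - f(a) = (x - a) g(x) + a (g(x) - g(a)), and the last difference is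
    -- factored recursively.
    factor-root : ∀ {m f} → Monic (suc m) f → ∀ a → ∃[ h ] Monic m h × (∀ x → f x - f a ≡ (x - a) * h x)
    factor-root (step {g = g} c f≡ Mg@(one g≡1)) a = g , Mg , λ x →
      trans (cong₂ _-_ (f≡ x) (f≡ a)) (trans (cong (λ u → c + x * g x - (c + a * u)) (trans (g≡1 a) (sym (g≡1 x))))
        (solve 4 (λ c x a u → (c :+ x :* u) :- (c :+ a :* u) := (x :- a) :* u) refl c x a (g x)))
    factor-root (step {g = g} c f≡ Mg@(step _ _ _)) a with factor-root Mg a
    ... | h , Mh , eq = (λ x → g x + a * h x) , monic-+ a Mg Mh , λ x →
      trans (cong₂ _-_ (f≡ x) (f≡ a)) (trans
        (solve 5 (λ c x a u v → (c :+ x :* u) :- (c :+ a :* v) := (x :- a) :* u :+ a :* (u :- v)) refl c x a (g x) (g a))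
        (trans (cong (λ u → (x - a) * g x + a * u) (eq x))
        (solve 4 (λ x a u v → (x :- a) :* u :+ a :* ((x :- a) :* v) := (x :- a) :* (u :+ a :* v)) refl x a (g x) (h x))))

    root-bound : ∀ {m f} → Monic m f → ∀ {xs} → Unique xs → (∀ {x} → x ∈ xs → f x ≡ 0#) → length xs ℕ.≤ m
    root-bound Mf [] roots = z≤n
    root-bound (one f≡1) (_∷_ {x} _ _) roots = contradiction (trans (sym (roots (here refl))) (f≡1 x)) 0≢1
    root-bound {f = f} Mf@(step _ _ _) (_∷_ {a} {xs} a∉ u) roots with factor-root Mf a
    ... | h , Mh , eq = s≤s (root-bound Mh u λ {x} x∈ →
      *-zero-cancelˡ (λ x-a≡0 → All.lookup a∉ x∈ (sym (x-y≡0⇒x≡y x-a≡0)))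
        (trans (sym (eq x)) (trans (cong₂ _-_ (roots (there x∈)) (roots (here refl))) (-‿inverseʳ 0#))))

    monic-pow : ∀ m → Monic m (λ x → pow x m)
    monic-pow zero = one (λ _ → refl)
    monic-pow (suc m) = step 0# (λ x → sym (+-identityˡ _)) (monic-pow m)

    -- The polynomial x^m - 1 has at most m roots. Such a g takes the place of a primitive root in
    -- the evaluation of power sums.
    non-root-of-unity : ∀ m → m ≢ 0 → m ℕ.< q-1 → ∃[ g ] g ≢ 0# × pow g m ≢ 1#
    non-root-of-unity zero m≢0 _ = contradiction refl m≢0
    non-root-of-unity m@(suc m') _ m<q-1 with all? (λ g → pow g m ≟ 1#) nz
    ... | yes all = contradiction (root-bound {f = λ x → pow x m - 1#}
            (step (- 1#) (λ x → +-comm _ _) (monic-pow m')) unique-nz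
            (λ x∈ → trans (cong (_- 1#) (All.lookup all x∈)) (-‿inverseʳ 1#))) (ℕₚ.<⇒≱ m<q-1)
    ... | no ¬all = find nz (λ x∈ → nz-∈ x∈) (¬All⇒Any¬ (λ g → pow g m ≟ 1#) nz ¬all)
      where
      find : ∀ xs → (∀ {y} → y ∈ xs → y ≢ 0#) → Any (λ g → pow g m ≢ 1#) xs → ∃[ g ] g ≢ 0# × pow g m ≢ 1#
      find (x ∷ _) ne (here px) = x , ne (here refl) , px
      find (_ ∷ xs) ne (there p) = find xs (λ y∈ → ne (there y∈)) p

  -- The ring of values stays arbitrary because the same substitutions are made for sums with values
  -- in F, ℤ[ω], 𝒪 and ℤ.
  module SumsOver (F : FiniteField) {c ℓ} (R : CommutativeRing c ℓ) where
    private module F = Elements F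
    open F using (X; elements; nz)
    open Kit R

    ∑ : (X → Carrier) → Carrier
    ∑ = Σ elements

    ∑-split : ∀ f → ∑ f ≈ f F.0# + Σ nz f
    ∑-split f = Σ-↭ f F.elements↭

    ∑-reindex : ∀ {h : X → X} → (∀ {x y} → h x ≡ h y → x ≡ y) → ∀ f → ∑ (λ x → f (h x)) ≈ ∑ f
    ∑-reindex {h} inj f = ≈-trans (sym (Σ-map h elements f))
      (Σ-↭ f (injection-permutes F.unique inj (λ {x} _ → F.complete (h x))))

    ∑-translate : ∀ c f → ∑ (λ x → f (c F.+ x)) ≈ ∑ f
    ∑-translate c = ∑-reindex λ {x} {y} eq → ≡.trans (cancel x) (≡.trans (cong (F._+_ (F.- c)) eq) (≡.sym (cancel y)))
      where
      cancel : ∀ x → x ≡ F.- c F.+ (c F.+ x)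
      cancel x = F.solve 2 (λ c x → x F.:= F.:- c F.:+ (c F.:+ x)) refl c x

    ∑-reflect : ∀ c f → ∑ (λ x → f (c F.- x)) ≈ ∑ f
    ∑-reflect c = ∑-reindex λ {x} {y} eq → ≡.trans (cancel x) (≡.trans (cong (F._-_ c) eq) (≡.sym (cancel y)))
      where
      cancel : ∀ x → x ≡ c F.- (c F.- x)
      cancel x = F.solve 2 (λ c x → x F.:= c F.:- (c F.:- x)) refl c x

    ∑-scale : ∀ {c} → c ≢ F.0# → ∀ f → ∑ (λ x → f (c F.* x)) ≈ ∑ f
    ∑-scale c≢0 = ∑-reindex (F.*-cancelˡ c≢0)

    ∑-neg : ∀ f → ∑ (λ x → f (F.- x)) ≈ ∑ f
    ∑-neg = ∑-reindex λ {x} {y} eq → ≡.trans (≡.sym (F.-‿involutive x)) (≡.trans (cong F.-_ eq) (F.-‿involutive y))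

    ∑-single : ∀ y f → (∀ x → x ≢ y → f x ≈ 0#) → ∑ f ≈ f y
    ∑-single y f vanish = ≈-trans (sym (∑-translate y f)) (≈-trans (∑-split _)
      (≈-trans (+-cong (reflexive (cong f (F.+-identityʳ y)))
        (Σ-zero nz (λ {x} x∈ → vanish _ (λ eq → F.nz-∈ x∈
          (F.+-cancelˡ y x F.0# (≡.trans eq (≡.sym (F.+-identityʳ y))))))))
      (+-identityʳ _)))

-- Eisenstein integers, conjugation and divisibility by powers of λ.

module EisensteinIntegers where
  open RingSums
  open import Data.Integer using (+_)
  open import Data.Fin using (zero; suc)
  open import Data.Integer.DivMod using (_%_; _/_; a≡a%n+[a/n]*n; n%d<d)
  open import Data.Integer.Solver using (module +-*-Solver)
  import Data.Nat.DivMod as ℕ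
  open import Relation.Binary.PropositionalEquality using (refl)

  -ω_ : ℤω → ℤω
  -ω (a , b) = (ℤ.- a , ℤ.- b)

  infixl 21 _*ω_

  opaque
    -- From ω² = -1 - ω. It is opaque so that products are treated by ring laws and unfold into
    -- coordinates only where this is asked for.
    _*ω_ : ℤω → ℤω → ℤω
    (a , b) *ω (c , d) = (a ℤ.* c ℤ.- b ℤ.* d , a ℤ.* d ℤ.+ b ℤ.* c ℤ.- b ℤ.* d)

    private
      open +-*-Solver

      *ω-assoc : ∀ x y z → (x *ω y) *ω z ≡ x *ω (y *ω z)
      *ω-assoc (a , b) (c , d) (e , f) = cong₂ _,_
        (solve 6 (λ a b c d e f → (a :* c :- b :* d) :* e :- (a :* d :+ b :* c :- b :* d) :* f
          := a :* (c :* e :- d :* f) :- b :* (c :* f :+ d :* e :- d :* f)) refl a b c d e f)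
        (solve 6 (λ a b c d e f → (a :* c :- b :* d) :* f :+ (a :* d :+ b :* c :- b :* d) :* e :- (a :* d :+ b :* c :- b :* d) :* f
          := a :* (c :* f :+ d :* e :- d :* f) :+ b :* (c :* e :- d :* f) :- b :* (c :* f :+ d :* e :- d :* f)) refl a b c d e f)

      *ω-comm : ∀ x y → x *ω y ≡ y *ω x
      *ω-comm (a , b) (c , d) = cong₂ _,_
        (solve 4 (λ a b c d → a :* c :- b :* d := c :* a :- d :* b) refl a b c d)
        (solve 4 (λ a b c d → a :* d :+ b :* c :- b :* d := c :* b :+ d :* a :- d :* b) refl a b c d)

      *ω-identityˡ : ∀ x → embℤ (+ 1) *ω x ≡ x
      *ω-identityˡ (a , b) = cong₂ _,_
        (solve 2 (λ a b → con (+ 1) :* a :- con (+ 0) :* b := a) refl a b)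
        (solve 2 (λ a b → con (+ 1) :* b :+ con (+ 0) :* a :- con (+ 0) :* b := b) refl a b)

      *ω-distribˡ : ∀ x y z → x *ω (y +ω z) ≡ (x *ω y) +ω (x *ω z)
      *ω-distribˡ (a , b) (c , d) (e , f) = cong₂ _,_
        (solve 6 (λ a b c d e f → a :* (c :+ e) :- b :* (d :+ f)
          := (a :* c :- b :* d) :+ (a :* e :- b :* f)) refl a b c d e f)
        (solve 6 (λ a b c d e f → a :* (d :+ f) :+ b :* (c :+ e) :- b :* (d :+ f)
          := (a :* d :+ b :* c :- b :* d) :+ (a :* f :+ b :* e :- b :* f)) refl a b c d e f)

    embℤ-* : ∀ i j → embℤ i *ω embℤ j ≡ embℤ (i ℤ.* j)
    embℤ-* i j = cong₂ _,_
      (solve 2 (λ i j → i :* j :- con (+ 0) :* con (+ 0) := i :* j) refl i j)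
      (solve 2 (λ i j → i :* con (+ 0) :+ con (+ 0) :* j :- con (+ 0) :* con (+ 0) := con (+ 0)) refl i j)

    embℤ-scale : ∀ i a b → embℤ i *ω (a , b) ≡ (i ℤ.* a , i ℤ.* b)
    embℤ-scale i a b = cong₂ _,_
      (solve 3 (λ i a b → i :* a :- con (+ 0) :* b := i :* a) refl i a b)
      (solve 3 (λ i a b → i :* b :+ con (+ 0) :* a :- con (+ 0) :* b := i :* b) refl i a b)

    ωpow-* : ∀ (i j : Fin 3) → ωpow (toℕ i) *ω ωpow (toℕ j) ≡ ωpow ((toℕ i ℕ.+ toℕ j) ℕ.% 3)
    ωpow-* zero zero = refl
    ωpow-* zero (suc zero) = refl
    ωpow-* zero (suc (suc zero)) = refl
    ωpow-* (suc zero) zero = refl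
    ωpow-* (suc zero) (suc zero) = refl
    ωpow-* (suc zero) (suc (suc zero)) = refl
    ωpow-* (suc (suc zero)) zero = refl
    ωpow-* (suc (suc zero)) (suc zero) = refl
    ωpow-* (suc (suc zero)) (suc (suc zero)) = refl

    *ω-≡ : ∀ a b c d → (a , b) *ω (c , d) ≡ (a ℤ.* c ℤ.- b ℤ.* d , a ℤ.* d ℤ.+ b ℤ.* c ℤ.- b ℤ.* d)
    *ω-≡ a b c d = refl

  ωRing : CommutativeRing 0ℓ 0ℓ
  ωRing = record
    { Carrier = ℤω ; _≈_ = _≡_ ; _+_ = _+ω_ ; _*_ = _*ω_ ; -_ = -ω_ ; 0# = 0ω ; 1# = embℤ (+ 1)
    ; isCommutativeRing = record
      { isRing = record
        { +-isAbelianGroup = record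
          { isGroup = record
            { isMonoid = record
              { isSemigroup = record
                { isMagma = record { isEquivalence = ≡.isEquivalence ; ∙-cong = cong₂ _+ω_ }
                ; assoc = λ (a , b) (c , d) (e , f) → cong₂ _,_ (ℤₚ.+-assoc a c e) (ℤₚ.+-assoc b d f) }
              ; identity = (λ (a , b) → cong₂ _,_ (ℤₚ.+-identityˡ a) (ℤₚ.+-identityˡ b))
                         , (λ (a , b) → cong₂ _,_ (ℤₚ.+-identityʳ a) (ℤₚ.+-identityʳ b)) }
            ; inverse = (λ (a , b) → cong₂ _,_ (ℤₚ.+-inverseˡ a) (ℤₚ.+-inverseˡ b))
                      , (λ (a , b) → cong₂ _,_ (ℤₚ.+-inverseʳ a) (ℤₚ.+-inverseʳ b))
            ; ⁻¹-cong = cong -ω_ }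
          ; comm = λ (a , b) (c , d) → cong₂ _,_ (ℤₚ.+-comm a c) (ℤₚ.+-comm b d) }
        ; *-cong = cong₂ _*ω_
        ; *-assoc = *ω-assoc
        ; *-identity = *ω-identityˡ , (λ x → ≡.trans (*ω-comm x (embℤ (+ 1))) (*ω-identityˡ x))
        ; distrib = *ω-distribˡ , (λ x y z → ≡.trans (*ω-comm (y +ω z) x)
                      (≡.trans (*ω-distribˡ x y z) (cong₂ _+ω_ (*ω-comm x y) (*ω-comm x z)))) }
      ; *-comm = *ω-comm } }

  module E = Kit ωRing

  E-ᴺ : ∀ k → k E.ᴺ ≡ embℤ (+ k)
  E-ᴺ zero = refl
  E-ᴺ (suc k) = ≡.trans (E.ᴺ-suc k) (cong (embℤ (+ 1) +ω_) (E-ᴺ k))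

  embℤ-cancel : ∀ k {x y} → embℤ (+ suc k) *ω x ≡ embℤ (+ suc k) *ω y → x ≡ y
  embℤ-cancel k {a , b} {c , d} eq = cong₂ _,_ (ℤₚ.*-cancelˡ-≡ (+ suc k) a c (cong proj₁ eq′)) (ℤₚ.*-cancelˡ-≡ (+ suc k) b d (cong proj₂ eq′))
    where
    eq′ = ≡.trans (≡.sym (embℤ-scale (+ suc k) a b)) (≡.trans eq (embℤ-scale (+ suc k) c d))

  ω λω : ℤω
  ω = ωpow 1
  λω = embℤ (+ 1) +ω (-ω ω)

  -- Complex conjugation, which sends ω to ω² = -1 - ω.
  conj : ℤω → ℤω
  conj (a , b) = (a ℤ.- b , ℤ.- b)

  conj-+ : ∀ x y → conj (x +ω y) ≡ conj x +ω conj y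
  conj-+ (a , b) (c , d) = cong₂ _,_
    (solve 4 (λ a b c d → (a :+ c) :- (b :+ d) := (a :- b) :+ (c :- d)) refl a b c d)
    (solve 2 (λ b d → :- (b :+ d) := (:- b) :+ (:- d)) refl b d)
    where open +-*-Solver

  private
    i+i≡0 : ∀ i → i ℤ.+ i ≡ + 0 → i ≡ + 0
    i+i≡0 (+ zero) _ = refl
    i+i≡0 (+ suc _) ()
    i+i≡0 -[1+ _ ] ()

    3i≡0 : ∀ i → (i ℤ.+ i) ℤ.+ i ≡ + 0 → i ≡ + 0
    3i≡0 (+ zero) _ = refl
    3i≡0 (+ suc _) ()
    3i≡0 -[1+ _ ] ()

  conj-fixed : ∀ {z} → conj z ≡ z → z ≡ embℤ (proj₁ z)
  conj-fixed {a , b} eq = cong (a ,_) (i+i≡0 b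
    (≡.trans (cong (λ v → b ℤ.+ v) (≡.sym (cong proj₂ eq))) (ℤₚ.+-inverseʳ b)))

  ω-triple≡0 : ∀ z → (z +ω z) +ω z ≡ 0ω → z ≡ 0ω
  ω-triple≡0 (a , b) eq = cong₂ _,_ (3i≡0 a (cong proj₁ eq)) (3i≡0 b (cong proj₂ eq))

  λ^ : ℕ → ℤω
  λ^ zero = E.1#
  λ^ (suc k) = λω *ω λ^ k

  λ^-+ : ∀ j k → λ^ (j ℕ.+ k) ≡ λ^ j *ω λ^ k
  λ^-+ zero k = ≡.sym (E.*-identityˡ _)
  λ^-+ (suc j) k = ≡.trans (cong (λω *ω_) (λ^-+ j k)) (≡.sym (E.*-assoc λω (λ^ j) (λ^ k)))

  infix 4 λ^_∣_
  record λ^_∣_ (k : ℕ) (z : ℤω) : Set where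
    constructor _,_
    field
      quotient : ℤω
      equality : z ≡ λ^ k *ω quotient

  ∣-zero : ∀ z → λ^ 0 ∣ z
  ∣-zero z = z , ≡.sym (E.*-identityˡ z)

  ∣-0 : ∀ k → λ^ k ∣ 0ω
  ∣-0 k = 0ω , ≡.sym (E.zeroʳ (λ^ k))

  ∣-weaken : ∀ {j k z} → j ℕ.≤ k → λ^ k ∣ z → λ^ j ∣ z
  ∣-weaken {j} {k} j≤k (y , eq) = λ^ (k ℕ.∸ j) *ω y , ≡.trans eq (≡.trans (cong (λ i → λ^ i *ω y) (≡.sym (ℕₚ.m+[n∸m]≡n j≤k)))
    (≡.trans (cong (_*ω y) (λ^-+ j (k ℕ.∸ j))) (E.*-assoc (λ^ j) (λ^ (k ℕ.∸ j)) y)))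

  ∣-+ : ∀ {k x y} → λ^ k ∣ x → λ^ k ∣ y → λ^ k ∣ x +ω y
  ∣-+ {k} (u , refl) (v , refl) = u +ω v , ≡.sym (E.distribˡ (λ^ k) u v)

  ∣-* : ∀ {j k x y} → λ^ j ∣ x → λ^ k ∣ y → λ^ (j ℕ.+ k) ∣ x *ω y
  ∣-* {j} {k} (u , refl) (v , refl) = u *ω v , ≡.trans
    (E.solve 4 (λ a b u v → (a E.:* u) E.:* (b E.:* v) E.:= (a E.:* b) E.:* (u E.:* v)) refl (λ^ j) (λ^ k) u v)
    (cong (_*ω (u *ω v)) (≡.sym (λ^-+ j k)))

  ∣-*ˡ : ∀ {k x} c → λ^ k ∣ x → λ^ k ∣ c *ω x
  ∣-*ˡ c p = ∣-* (∣-zero c) p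

  ∣-neg : ∀ {k x} → λ^ k ∣ x → λ^ k ∣ -ω x
  ∣-neg {k} (u , refl) = -ω u , E.solve 2 (λ a u → E.:- (a E.:* u) E.:= a E.:* (E.:- u)) refl (λ^ k) u

  ∣-Σ : ∀ {a} {A : Set a} {k} xs {f : A → ℤω} → (∀ x → λ^ k ∣ f x) → λ^ k ∣ E.Σ xs f
  ∣-Σ {k = k} [] p = ∣-0 k
  ∣-Σ (x ∷ xs) p = ∣-+ (p x) (∣-Σ xs p)

  opaque
    unfolding _*ω_

    λω-* : ∀ x y → λω *ω (x , y) ≡ (x ℤ.+ y , y ℤ.+ y ℤ.- x)
    λω-* x y = cong₂ _,_
        (solve 2 (λ x y → con (+ 1) :* x :- con -[1+ 0 ] :* y := x :+ y) refl x y)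
        (solve 2 (λ x y → con (+ 1) :* y :+ con -[1+ 0 ] :* x :- con -[1+ 0 ] :* y := (y :+ y) :- x) refl x y)
      where open +-*-Solver

  opaque
    unfolding _*ω_

    -- Here λ² = -3ω, and 1 + ω = -ω² is a unit with inverse -ω; so 3 is λ² up to a unit.
    3≡μλ² : embℤ (+ 3) ≡ (+ 1 , + 1) *ω (λω *ω λω)
    3≡μλ² = refl

    μ-inverse : (+ 0 , -[1+ 0 ]) *ω (+ 1 , + 1) ≡ embℤ (+ 1)
    μ-inverse = refl

  -- The ω-coordinate of λ(x + yω) is 2y - x. If it vanishes, the other coordinate x + y is 3y.
  λ∣⇒3∣ : ∀ {w} → λ^ 1 ∣ embℤ w → ∃[ v ] w ≡ + 3 ℤ.* v
  λ∣⇒3∣ {w} ((x , y) , eq) = y , (begin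
      w ≡⟨ cong proj₁ eq′ ⟩
      x ℤ.+ y ≡⟨ solve 2 (λ x y → x :+ y := con (+ 3) :* y :- ((y :+ y) :- x)) refl x y ⟩
      + 3 ℤ.* y ℤ.- (y ℤ.+ y ℤ.- x) ≡⟨ cong (λ z → + 3 ℤ.* y ℤ.- z) (≡.sym (cong proj₂ eq′)) ⟩
      + 3 ℤ.* y ℤ.- + 0 ≡⟨ ℤₚ.+-identityʳ _ ⟩
      + 3 ℤ.* y ∎)
    where
    open +-*-Solver
    open ≡.≡-Reasoning
    eq′ : embℤ w ≡ (x ℤ.+ y , y ℤ.+ y ℤ.- x)
    eq′ = ≡.trans eq (≡.trans (cong (_*ω (x , y)) (E.*-identityʳ λω)) (λω-* x y))

  -- Write λ^(j+2) as λ²λ^j; multiplied by the unit μ, λ² becomes 3, which cancels. The inverse ν of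
  -- μ then moves into the quotient.
  λ²∣⇒ : ∀ {j v} → λ^ suc (suc j) ∣ embℤ (+ 3 ℤ.* v) → λ^ j ∣ embℤ v
  λ²∣⇒ {j} {v} (y , eq) = ν *ω y , (begin
      embℤ v ≡⟨ ≡.sym (≡.trans (cong (_*ω embℤ v) μ-inverse) (E.*-identityˡ (embℤ v))) ⟩
      (ν *ω μ) *ω embℤ v ≡⟨ E.*-assoc ν μ (embℤ v) ⟩
      ν *ω (μ *ω embℤ v) ≡⟨ cong (ν *ω_) (embℤ-cancel 2 cancelled) ⟩
      ν *ω (λ^ j *ω y) ≡⟨ E.solve 3 (λ n l y → n E.:* (l E.:* y) E.:= l E.:* (n E.:* y)) refl ν (λ^ j) y ⟩
      λ^ j *ω (ν *ω y) ∎)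
    where
    open ≡.≡-Reasoning
    μ ν : ℤω
    μ = (+ 1 , + 1)
    ν = (+ 0 , -[1+ 0 ])
    cancelled : embℤ (+ 3) *ω (μ *ω embℤ v) ≡ embℤ (+ 3) *ω (λ^ j *ω y)
    cancelled = begin
      embℤ (+ 3) *ω (μ *ω embℤ v) ≡⟨ E.solve 3 (λ a b c → a E.:* (b E.:* c) E.:= b E.:* (a E.:* c)) refl (embℤ (+ 3)) μ (embℤ v) ⟩
      μ *ω (embℤ (+ 3) *ω embℤ v) ≡⟨ cong (μ *ω_) (≡.trans (embℤ-* (+ 3) v) eq) ⟩
      μ *ω ((λω *ω (λω *ω λ^ j)) *ω y) ≡⟨ E.solve 4 (λ m l k y → m E.:* ((l E.:* (l E.:* k)) E.:* y) E.:= (m E.:* (l E.:* l)) E.:* (k E.:* y)) refl μ λω (λ^ j) y ⟩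
      (μ *ω (λω *ω λω)) *ω (λ^ j *ω y) ≡⟨ cong (_*ω (λ^ j *ω y)) (≡.sym 3≡μλ²) ⟩
      embℤ (+ 3) *ω (λ^ j *ω y) ∎

  private
    triple : ∀ c {w v u} → w ≡ + 3 ℤ.* v → v ≡ + c ℤ.* u → w ≡ + (3 ℕ.* c) ℤ.* u
    triple c {u = u} refl refl = ≡.trans (≡.sym (ℤₚ.*-assoc (+ 3) (+ c) u)) (cong (λ z → z ℤ.* u) (≡.sym (ℤₚ.pos-* 3 c)))

  -- A rational integer has an even λ-valuation, since 3 is λ² up to a unit. The exponent 2m + 1
  -- thus rounds up to 2m + 2, and this is how 3^(m+1) arises rather than 3^m.
  λ^odd∣⇒3^∣ : ∀ m {w} → λ^ suc (m ℕ.+ m) ∣ embℤ w → ∃[ v ] w ≡ + (3 ℕ.^ suc m) ℤ.* v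
  λ^odd∣⇒3^∣ zero p = λ∣⇒3∣ p
  λ^odd∣⇒3^∣ (suc m) {w} p =
    let v , w≡3v = λ∣⇒3∣ {w} (∣-weaken {1} (s≤s z≤n) p)
        q : λ^ suc (suc (suc (m ℕ.+ m))) ∣ embℤ (+ 3 ℤ.* v)
        q = ≡.subst₂ (λ k w → λ^ suc (suc k) ∣ embℤ w) (ℕₚ.+-suc m m) w≡3v p
        u , v≡ = λ^odd∣⇒3^∣ m {v} (λ²∣⇒ {suc (m ℕ.+ m)} {v} q)
    in u , triple (3 ℕ.^ suc m) w≡3v v≡

  λ∣⇐3∣ : ∀ a b c → a ℤ.+ b ≡ c ℤ.* + 3 → λ^ 1 ∣ (a , b)
  λ∣⇐3∣ a b c eq = (a ℤ.- c , c) , ≡.sym (≡.trans (cong (_*ω (a ℤ.- c , c)) (E.*-identityʳ λω)) (≡.trans (λω-* (a ℤ.- c) c) (cong₂ _,_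
      (solve 2 (λ a c → (a :- c) :+ c := a) refl a c)
      (≡.trans (solve 2 (λ a c → (c :+ c) :- (a :- c) := c :* con (+ 3) :- a) refl a c) (≡.trans (cong (λ v → v ℤ.- a) (≡.sym eq))
        (solve 2 (λ a b → (a :+ b) :- a := b) refl a b))))))
    where open +-*-Solver

  module Residue {c ℓ} (K : CommutativeRing c ℓ) where
    open CommutativeRing K using (_≈_; 0#; 1#)
    private module K = Kit K

    opaque
      -- Reduction modulo λ = 1 - ω: it sends ω to 1. As 1 + ω + ω² goes to 3, it is multiplicative
      -- in characteristic three.
      π : ℤω → K.Carrier
      π (a , b) = K.⟦ a ⟧ℤ K.+ K.⟦ b ⟧ℤ

      π-≡ : ∀ a b → π (a , b) ≡ K.⟦ a ⟧ℤ K.+ K.⟦ b ⟧ℤ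
      π-≡ a b = refl

    module Char3 (3≈0 : K._ᴺ 3 ≈ 0#) (1≉0 : ¬ (1# ≈ 0#)) where

      π-+ : ∀ x y → π (x +ω y) ≈ π x K.+ π y
      π-+ (a , b) (c , d) = K.≈-trans (K.reflexive (π-≡ (a ℤ.+ c) (b ℤ.+ d))) (K.≈-trans (K.+-cong (K.⟦⟧-+ a c) (K.⟦⟧-+ b d)) (K.≈-trans
        (K.solve 4 (λ a b c d → (a K.:+ c) K.:+ (b K.:+ d) K.:= (a K.:+ b) K.:+ (c K.:+ d)) K.≈-refl _ _ _ _)
        (K.reflexive (≡.sym (cong₂ K._+_ (π-≡ a b) (π-≡ c d))))))

      private
        ⟦⟧-- : ∀ i j → K.⟦ i ℤ.- j ⟧ℤ ≈ K.⟦ i ⟧ℤ K.- K.⟦ j ⟧ℤ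
        ⟦⟧-- i j = K.≈-trans (K.⟦⟧-+ i (ℤ.- j)) (K.+-congˡ (K.⟦⟧-neg j))

      π-* : ∀ x y → π (x *ω y) ≈ π x K.* π y
      π-* (a , b) (c , d) = begin
          π ((a , b) *ω (c , d))
        ≡⟨ ≡.trans (cong π (*ω-≡ a b c d)) (π-≡ (a ℤ.* c ℤ.- b ℤ.* d) (a ℤ.* d ℤ.+ b ℤ.* c ℤ.- b ℤ.* d)) ⟩
          K.⟦ a ℤ.* c ℤ.- b ℤ.* d ⟧ℤ K.+ K.⟦ a ℤ.* d ℤ.+ b ℤ.* c ℤ.- b ℤ.* d ⟧ℤ
        ≈⟨ K.+-cong (⟦⟧-- (a ℤ.* c) (b ℤ.* d)) (K.≈-trans (⟦⟧-- (a ℤ.* d ℤ.+ b ℤ.* c) (b ℤ.* d)) (K.+-congʳ (K.⟦⟧-+ (a ℤ.* d) (b ℤ.* c)))) ⟩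
          (K.⟦ a ℤ.* c ⟧ℤ K.- K.⟦ b ℤ.* d ⟧ℤ) K.+ ((K.⟦ a ℤ.* d ⟧ℤ K.+ K.⟦ b ℤ.* c ⟧ℤ) K.- K.⟦ b ℤ.* d ⟧ℤ)
        ≈⟨ K.+-cong (K.+-cong (K.⟦⟧-* a c) (K.-‿cong (K.⟦⟧-* b d)))
             (K.+-cong (K.+-cong (K.⟦⟧-* a d) (K.⟦⟧-* b c)) (K.-‿cong (K.⟦⟧-* b d))) ⟩
          (A K.* C K.- B K.* D) K.+ ((A K.* D K.+ B K.* C) K.- B K.* D)
        ≈⟨ K.solve 4 (λ A B C D → (A K.:* C K.:- B K.:* D) K.:+ ((A K.:* D K.:+ B K.:* C) K.:- B K.:* D)
             K.:= (A K.:+ B) K.:* (C K.:+ D) K.:- K.con (+ 3) K.:* (B K.:* D)) K.≈-refl A B C D ⟩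
          (A K.+ B) K.* (C K.+ D) K.- K._ᴺ 3 K.* (B K.* D)
        ≈⟨ K.+-congˡ (K.-‿cong (K.≈-trans (K.*-congʳ 3≈0) (K.zeroˡ _))) ⟩
          (A K.+ B) K.* (C K.+ D) K.- 0#
        ≈⟨ K.≈-trans (K.+-congˡ K.-0#≈0#) (K.+-identityʳ _) ⟩
          (A K.+ B) K.* (C K.+ D)
        ≡⟨ ≡.sym (cong₂ K._*_ (π-≡ a b) (π-≡ c d)) ⟩
          π (a , b) K.* π (c , d) ∎
        where
        open import Relation.Binary.Reasoning.Setoid K.setoid
        A = K.⟦ a ⟧ℤ
        B = K.⟦ b ⟧ℤ
        C = K.⟦ c ⟧ℤ
        D = K.⟦ d ⟧ℤ

      π-1 : π E.1# ≈ 1#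
      π-1 = K.≈-trans (K.reflexive (π-≡ (+ 1) (+ 0))) (K.+-identityʳ _)

      ⟦⟧≈0⇒3∣ : ∀ i → K.⟦ i ⟧ℤ ≈ 0# → ∃[ c ] i ≡ c ℤ.* + 3
      ⟦⟧≈0⇒3∣ i eq = i / + 3 , ≡.trans div (≡.trans (cong (λ r → + r ℤ.+ i / + 3 ℤ.* + 3) (rem≡0 (i % + 3) (n%d<d i (+ 3)) rem≈0)) (ℤₚ.+-identityˡ _))
        where
        div : i ≡ + (i % + 3) ℤ.+ (i / + 3) ℤ.* + 3
        div = a≡a%n+[a/n]*n i (+ 3)
        rem≈0 : K._ᴺ (i % + 3) ≈ 0#
        rem≈0 = K.≈-trans (K.sym (K.≈-trans (K.reflexive (cong K.⟦_⟧ℤ div)) (K.≈-trans (K.⟦⟧-+ (+ (i % + 3)) (i / + 3 ℤ.* + 3))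
          (K.≈-trans (K.+-congˡ (K.≈-trans (K.⟦⟧-* (i / + 3) (+ 3)) (K.≈-trans (K.*-congˡ 3≈0) (K.zeroʳ _)))) (K.+-identityʳ _))))) eq
        rem≡0 : ∀ m → m ℕ.< 3 → K._ᴺ m ≈ 0# → m ≡ 0
        rem≡0 0 _ _ = refl
        rem≡0 1 _ 1≈0 = contradiction 1≈0 1≉0
        rem≡0 2 _ 2≈0 = contradiction (K.≈-trans (K.sym (K.+-identityˡ _)) (K.≈-trans (K.+-congʳ (K.sym 2≈0)) 3≈0)) 1≉0
        rem≡0 (suc (suc (suc _))) (s≤s (s≤s (s≤s ()))) _

      π≈0⇒λ∣ : ∀ z → π z ≈ 0# → λ^ 1 ∣ z
      π≈0⇒λ∣ (a , b) eq with ⟦⟧≈0⇒3∣ (a ℤ.+ b) (K.≈-trans (K.⟦⟧-+ a b) (K.≈-trans (K.reflexive (≡.sym (π-≡ a b))) eq))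
      ... | c , a+b≡3c = λ∣⇐3∣ a b c a+b≡3c

-- Frobenius, trace, power sums and the additive character in characteristic three.

module CharacteristicThree where
  open RingSums
  open FiniteFields
  open EisensteinIntegers
  open import Data.List.Relation.Unary.Any using (satisfied)
  open import Relation.Binary.PropositionalEquality using (refl; sym; trans)

  module Ternary (F : FiniteField) (n : ℕ) (order≡3^n : FiniteField.order F ≡ 3 ℕ.^ n) (1<n : 1 ℕ.< n) where
    open Elements F public
    open SumsOver F (fieldRing F) public
    open ≡.≡-Reasoning

    q : ℕ
    q = 3 ℕ.^ n

    q≡ : suc q-1 ≡ q
    q≡ = trans (sym order≡) order≡3^n

    ᴺ-^ : ∀ b k → (b ℕ.^ k) ᴺ ≡ pow (b ᴺ) k
    ᴺ-^ b zero = refl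
    ᴺ-^ b (suc k) = trans (ᴺ-* b (b ℕ.^ k)) (cong (b ᴺ *_) (ᴺ-^ b k))

    -- The translation x ↦ 1 + x preserves the sum of all elements but adds 1 to each of the q
    -- summands.
    order·1≡0 : suc q-1 ᴺ ≡ 0#
    order·1≡0 = +-cancelʳ (∑ (λ x → x)) _ _ (begin
      suc q-1 ᴺ + ∑ (λ x → x) ≡⟨ cong (_+ ∑ (λ x → x)) (sym (*-identityʳ _)) ⟩
      suc q-1 ᴺ * 1# + ∑ (λ x → x) ≡⟨ cong (λ k → k ᴺ * 1# + ∑ (λ x → x)) (sym order≡) ⟩
      length elements ᴺ * 1# + ∑ (λ x → x) ≡⟨ cong (_+ ∑ (λ x → x)) (sym (Σ-const elements 1#)) ⟩
      ∑ (λ _ → 1#) + ∑ (λ x → x) ≡⟨ sym (Σ-+ elements (λ _ → 1#) (λ x → x)) ⟩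
      ∑ (λ x → 1# + x) ≡⟨ ∑-translate 1# (λ x → x) ⟩
      ∑ (λ x → x) ≡⟨ sym (+-identityˡ _) ⟩
      0# + ∑ (λ x → x) ∎)

    3≡0 : 3 ᴺ ≡ 0#
    3≡0 = pow-≡0 n (trans (sym (ᴺ-^ 3 n)) (trans (cong _ᴺ (sym q≡)) order·1≡0))

    3*≡0 : ∀ x → 3 ᴺ * x ≡ 0#
    3*≡0 x = trans (cong (_* x) 3≡0) (zeroˡ x)

    +3*≡ : ∀ x y → x + 3 ᴺ * y ≡ x
    +3*≡ x y = trans (cong (x +_) (3*≡0 y)) (+-identityʳ x)

    1≢0 : ¬ 1# ≡ 0#
    1≢0 eq = 0≢1 (sym eq)

    open Residue (fieldRing F) public using (π; π-≡)
    open Residue.Char3 (fieldRing F) 3≡0 1≢0 public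

    cube-+ : ∀ x y → pow (x + y) 3 ≡ pow x 3 + pow y 3
    cube-+ x y = trans
      (solve 2 (λ x y → (x :+ y) :* ((x :+ y) :* ((x :+ y) :* con (ℤ.+ 1)))
        := (x :* (x :* (x :* con (ℤ.+ 1))) :+ y :* (y :* (y :* con (ℤ.+ 1)))) :+ con (ℤ.+ 3) :* (x :* x :* y :+ x :* y :* y)) refl x y)
      (+3*≡ _ _)

    pow-3^suc : ∀ x k → pow x (3 ℕ.^ suc k) ≡ pow (pow x 3) (3 ℕ.^ k)
    pow-3^suc x k = pow-* x 3 (3 ℕ.^ k)

    frobenius-+ : ∀ k x y → pow (x + y) (3 ℕ.^ k) ≡ pow x (3 ℕ.^ k) + pow y (3 ℕ.^ k)
    frobenius-+ zero x y = trans (*-identityʳ _) (sym (cong₂ _+_ (*-identityʳ x) (*-identityʳ y)))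
    frobenius-+ (suc k) x y = trans (pow-3^suc (x + y) k) (trans (cong (λ z → pow z (3 ℕ.^ k)) (cube-+ x y))
      (trans (frobenius-+ k _ _) (sym (cong₂ _+_ (pow-3^suc x k) (pow-3^suc y k)))))

    3^k≢0 : ∀ k → 3 ℕ.^ k ≢ 0
    3^k≢0 k eq with ℕₚ.m^n≡0⇒m≡0 3 k eq
    ... | ()

    frobenius-neg : ∀ k x → pow (- x) (3 ℕ.^ k) ≡ - pow x (3 ℕ.^ k)
    frobenius-neg k x = +-cancelˡ (pow x (3 ℕ.^ k)) _ _ (trans (sym (frobenius-+ k x (- x)))
      (trans (cong (λ z → pow z (3 ℕ.^ k)) (-‿inverseʳ x)) (trans (pow-0# _ (3^k≢0 k)) (sym (-‿inverseʳ _)))))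

    frobenius-injective : ∀ k {x y} → pow x (3 ℕ.^ k) ≡ pow y (3 ℕ.^ k) → x ≡ y
    frobenius-injective k {x} {y} eq = x-y≡0⇒x≡y (pow-≡0 (3 ℕ.^ k)
      (trans (frobenius-+ k x (- y)) (trans (cong₂ _+_ eq (frobenius-neg k y)) (-‿inverseʳ _))))

    pow-3^n : ∀ x → pow x q ≡ x
    pow-3^n x = trans (cong (pow x) (sym q≡)) (pow-q x)

    -- This iterates x^q = x, which holds at x = 0 as well. The exponent must stay positive, because
    -- x^0 is 1 even at x = 0.
    pow-mod : ∀ x m k → m ≢ 0 → pow x (m ℕ.+ k ℕ.* q-1) ≡ pow x m
    pow-mod x zero k m≢0 = contradiction refl m≢0
    pow-mod x m zero m≢0 = cong (pow x) (ℕₚ.+-identityʳ m)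
    pow-mod x m@(suc m') (suc k) m≢0 = begin
        pow x (m ℕ.+ (q-1 ℕ.+ k ℕ.* q-1)) ≡⟨ cong (pow x) (solve-rearrange m' q-1 (k ℕ.* q-1)) ⟩
        pow x (suc q-1 ℕ.+ (m' ℕ.+ k ℕ.* q-1)) ≡⟨ pow-+ x (suc q-1) _ ⟩
        pow x (suc q-1) * pow x (m' ℕ.+ k ℕ.* q-1) ≡⟨ cong (_* pow x (m' ℕ.+ k ℕ.* q-1)) (pow-q x) ⟩
        pow x (m ℕ.+ k ℕ.* q-1) ≡⟨ pow-mod x m k m≢0 ⟩
        pow x m ∎
      where
      solve-rearrange : ∀ a b c → suc a ℕ.+ (b ℕ.+ c) ≡ suc b ℕ.+ (a ℕ.+ c)
      solve-rearrange = S.solve-∀ where import Data.Nat.Tactic.RingSolver as S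

    q-2 : ℕ
    q-2 = ℕ.pred q-1

    9≤q : 9 ℕ.≤ q
    9≤q = ℕₚ.^-monoʳ-≤ 3 1<n

    8≤q-1 : 8 ℕ.≤ q-1
    8≤q-1 = ℕₚ.≤-pred (subst (9 ℕ.≤_) (sym q≡) 9≤q)

    q-1≡ : q-1 ≡ suc q-2
    q-1≡ with q-1 | 8≤q-1
    ... | suc _ | _ = refl

    q-2<q-1 : q-2 ℕ.< q-1
    q-2<q-1 = ℕₚ.≤-reflexive (sym q-1≡)

    q-2≢0 : q-2 ≢ 0
    q-2≢0 with q-1 | 8≤q-1
    ... | suc (suc _) | _ = λ ()
    ... | suc zero | s≤s ()

    -- If g^m ≠ 1, the substitution of g x for x multiplies the sum by g^m without changing it.
    power-sum : ∀ m → m ≢ 0 → m ℕ.< q-1 → ∑ (λ x → pow x m) ≡ 0#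
    power-sum m m≢0 m<q-1 with non-root-of-unity m m≢0 m<q-1
    ... | g , g≢0 , g^m≢1 = *-zero-cancelˡ (λ eq → g^m≢1 (x-y≡0⇒x≡y eq)) (begin
      (pow g m - 1#) * S ≡⟨ solve 2 (λ a s → (a :- con (ℤ.+ 1)) :* s := a :* s :- s) refl (pow g m) S ⟩
      pow g m * S - S ≡⟨ cong (_- S) (sym (Σ-*ˡ elements (pow g m) _)) ⟩
      ∑ (λ x → pow g m * pow x m) - S ≡⟨ cong (_- S) (Σ-cong elements (λ x → sym (pow-distrib g x m))) ⟩
      ∑ (λ x → pow (g * x) m) - S ≡⟨ cong (_- S) (∑-scale g≢0 (λ x → pow x m)) ⟩
      S - S ≡⟨ -‿inverseʳ S ⟩
      0# ∎)
      where S = ∑ (λ x → pow x m)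

    power-sum-top : ∑ (λ x → pow x q-1) ≡ - 1#
    power-sum-top = trans (∑-split _) (trans (cong₂ _+_ (trans (cong (pow 0#) q-1≡) (zeroˡ _))
        (trans (Σ-cong-∈ nz (λ x∈ → fermat (nz-∈ x∈))) (Σ-const nz 1#)))
      (+-cancelʳ 1# _ _ (trans (trans (solve 1 (λ x → (con (ℤ.+ 0) :+ x :* con (ℤ.+ 1)) :+ con (ℤ.+ 1) := con (ℤ.+ 1) :+ x) refl (q-1 ᴺ))
        (trans (sym (ᴺ-suc q-1)) order·1≡0)) (sym (-‿inverseˡ 1#)))))

    Tr : X → X
    Tr = trace n

    trace-+ : ∀ i x y → trace i (x + y) ≡ trace i x + trace i y
    trace-+ zero x y = sym (+-identityˡ _)
    trace-+ (suc i) x y = trans (cong₂ _+_ (frobenius-+ i x y) (trace-+ i x y))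
      (solve 4 (λ a b c d → (a :+ b) :+ (c :+ d) := (a :+ c) :+ (b :+ d)) refl _ _ _ _)

    Tr-+ : ∀ x y → Tr (x + y) ≡ Tr x + Tr y
    Tr-+ = trace-+ n

    Tr-0 : Tr 0# ≡ 0#
    Tr-0 = +-cancelˡ (Tr 0#) _ _ (trans (sym (Tr-+ 0# 0#)) (trans (cong Tr (+-identityˡ 0#)) (sym (+-identityʳ _))))

    private
      trace-telescope : ∀ i x → trace i (pow x 3) + x ≡ pow x (3 ℕ.^ i) + trace i x
      trace-telescope zero x = trans (+-identityˡ x) (sym (trans (+-identityʳ _) (*-identityʳ x)))
      trace-telescope (suc i) x = begin
        (pow (pow x 3) (3 ℕ.^ i) + trace i (pow x 3)) + x ≡⟨ +-assoc _ _ _ ⟩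
        pow (pow x 3) (3 ℕ.^ i) + (trace i (pow x 3) + x) ≡⟨ cong₂ _+_ (sym (pow-3^suc x i)) (trace-telescope i x) ⟩
        pow x (3 ℕ.^ suc i) + (pow x (3 ℕ.^ i) + trace i x) ∎

      trace-cube : ∀ i x → pow (trace i x) 3 ≡ trace i (pow x 3)
      trace-cube zero x = zeroˡ _
      trace-cube (suc i) x = trans (cube-+ _ _) (cong₂ _+_ (pow-comm x (3 ℕ.^ i) 3) (trace-cube i x))

    Tr-cube : ∀ x → Tr (pow x 3) ≡ Tr x
    Tr-cube x = +-cancelʳ x _ _ (trans (trace-telescope n x) (trans (cong (_+ Tr x) (pow-3^n x)) (+-comm x _)))

    private
      Tr-fixed : ∀ x → pow (Tr x) 3 ≡ Tr x
      Tr-fixed x = trans (trace-cube n x) (Tr-cube x)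

    -- Modulo 3, t³ - t = t(t - 1)(t - 2).
    prime-field : ∀ {t} → pow t 3 ≡ t → t ≡ 0# ⊎ t ≡ 1# ⊎ t ≡ 1# + 1#
    prime-field {t} t³≡t with t ≟ 0# | t ≟ 1#
    ... | yes t≡0 | _ = inj₁ t≡0
    ... | no _ | yes t≡1 = inj₂ (inj₁ t≡1)
    ... | no t≢0 | no t≢1 = inj₂ (inj₂ (x-y≡0⇒x≡y
          (*-zero-cancelˡ (λ eq → t≢1 (x-y≡0⇒x≡y eq)) (*-zero-cancelˡ t≢0 (begin
            t * ((t - 1#) * (t - (1# + 1#)))
              ≡⟨ solve 1 (λ t → t :* ((t :- con (ℤ.+ 1)) :* (t :- (con (ℤ.+ 1) :+ con (ℤ.+ 1))))
                   := (t :* (t :* (t :* con (ℤ.+ 1))) :- t) :+ con (ℤ.+ 3) :* (t :- t :* t)) refl t ⟩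
            (pow t 3 - t) + 3 ᴺ * (t - t * t) ≡⟨ +3*≡ _ _ ⟩
            pow t 3 - t ≡⟨ cong (_- t) t³≡t ⟩
            t - t ≡⟨ -‿inverseʳ t ⟩
            0# ∎)))))

    Tr-prime-field : ∀ x → Tr x ≡ 0# ⊎ Tr x ≡ 1# ⊎ Tr x ≡ 1# + 1#
    Tr-prime-field x = prime-field (Tr-fixed x)

    -- A second inverse beside `_⁻¹`: as the power x^(q-2) it vanishes at 0, is multiplicative, and
    -- merges with other powers into power sums.
    inv : X → X
    inv x = pow x q-2

    inv-inverse : ∀ {x} → x ≢ 0# → x * inv x ≡ 1#
    inv-inverse {x} x≢0 = trans (cong (pow x) (sym q-1≡)) (fermat x≢0)

    private
      3^i : ∀ i → ∃[ k ] 3 ℕ.^ suc i ≡ suc (suc (suc k))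
      3^i i with 3 ℕ.^ suc i | ℕₚ.*-monoʳ-≤ 3 (ℕₚ.m^n>0 3 i)
      ... | suc (suc (suc k)) | _ = k , refl
      ... | suc zero | s≤s ()
      ... | suc (suc zero) | s≤s (s≤s ())

      power-sum-3^i : ∀ i → suc i ℕ.< n → ∑ (λ x → pow x (3 ℕ.^ suc i) * inv x) ≡ 0#
      power-sum-3^i i i<n with 3^i i
      ... | k , 3^i≡ = trans (Σ-cong elements (λ x → begin
          pow x (3 ℕ.^ suc i) * inv x ≡⟨ sym (pow-+ x (3 ℕ.^ suc i) q-2) ⟩
          pow x (3 ℕ.^ suc i ℕ.+ q-2) ≡⟨ cong (λ m → pow x (m ℕ.+ q-2)) 3^i≡ ⟩
          pow x (suc (suc (suc k)) ℕ.+ q-2) ≡⟨ cong (pow x) (trans (sym (ℕₚ.+-suc (suc (suc k)) q-2))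
                                                    (cong (suc (suc k) ℕ.+_) (trans (sym q-1≡) (sym (ℕₚ.*-identityˡ q-1))))) ⟩
          pow x (suc (suc k) ℕ.+ 1 ℕ.* q-1) ≡⟨ pow-mod x (suc (suc k)) 1 (λ ()) ⟩
          pow x (suc (suc k)) ∎))
        (power-sum (suc (suc k)) (λ ()) (ℕₚ.≤-pred (subst (suc (suc (suc (suc k))) ℕ.≤_) (sym q≡)
          (subst (λ m → suc m ℕ.≤ q) 3^i≡ (ℕₚ.^-monoʳ-< 3 (s≤s (s≤s z≤n)) i<n)))))

      trace-inv-sum : ∀ i → suc i ℕ.≤ n → ∑ (λ x → trace (suc i) x * inv x) ≡ - 1#
      trace-inv-sum zero _ = trans (Σ-cong elements (λ x →
        trans (cong (_* inv x) (trans (+-identityʳ _) (*-identityʳ x))) (cong (pow x) (sym q-1≡)))) power-sum-top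
      trace-inv-sum (suc i) i<n = trans (Σ-cong elements (λ x → distribʳ (inv x) _ _))
        (trans (Σ-+ elements _ _) (trans (cong₂ _+_ (power-sum-3^i i i<n) (trace-inv-sum i (ℕₚ.<⇒≤ i<n))) (+-identityˡ _)))

    -- Among the products x^(3^j) x^(q-2) only j = 0 gives the exponent q - 1, whose power sum is
    -- -1; the other power sums vanish. The identity shows that the trace is not zero, and later it
    -- normalises `projector`.
    ∑-Tr-inv : ∑ (λ x → Tr x * inv x) ≡ - 1#
    ∑-Tr-inv = go n ℕₚ.≤-refl (ℕₚ.<-trans (s≤s z≤n) 1<n)
      where
      go : ∀ i → i ℕ.≤ n → 0 ℕ.< i → ∑ (λ x → trace i x * inv x) ≡ - 1#
      go (suc i) i≤n _ = trace-inv-sum i i≤n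

    Tr-nonzero : ∃[ b ] Tr b ≢ 0#
    Tr-nonzero with all? (λ x → Tr x ≟ 0#) elements
    ... | no ¬all = satisfied (¬All⇒Any¬ (λ x → Tr x ≟ 0#) elements ¬all)
    ... | yes all = contradiction (begin
        1# ≡⟨ sym (-‿involutive 1#) ⟩
        - (- 1#) ≡⟨ cong -_ (trans (sym ∑-Tr-inv) (Σ-zero elements (λ x∈ → trans (cong (_* inv _) (All.lookup all x∈)) (zeroˡ _)))) ⟩
        - 0# ≡⟨ -0#≈0# ⟩
        0# ∎) 1≢0

    Tr-neg : ∀ x → Tr (- x) ≡ - Tr x
    Tr-neg x = +-cancelˡ (Tr x) _ _ (trans (sym (Tr-+ x (- x))) (trans (cong Tr (-‿inverseʳ x)) (trans Tr-0 (sym (-‿inverseʳ _)))))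

    2≢0 : 1# + 1# ≢ 0#
    2≢0 eq = 1≢0 (trans (sym (+-identityˡ 1#)) (trans (cong (_+ 1#) (sym eq)) 3≡0))

    ψ′ : X → ℤω
    ψ′ = ψ F n

    ψ-0 : ∀ {x} → Tr x ≡ 0# → ψ′ x ≡ E.1#
    ψ-0 {x} eq with trace n x ≟ 0#
    ... | yes _ = refl
    ... | no ne = contradiction eq ne

    ψ-1 : ∀ {x} → Tr x ≡ 1# → ψ′ x ≡ ωpow 1
    ψ-1 {x} eq with trace n x ≟ 0#
    ... | yes eq′ = contradiction (trans (sym eq) eq′) 1≢0
    ... | no ne with trace n x ≟ 1#
    ...   | yes _ = refl
    ...   | no ne′ = contradiction eq ne′

    ψ-2 : ∀ {x} → Tr x ≡ 1# + 1# → ψ′ x ≡ ωpow 2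
    ψ-2 {x} eq with trace n x ≟ 0#
    ... | yes eq′ = contradiction (trans (sym eq) eq′) 2≢0
    ... | no ne with trace n x ≟ 1#
    ...   | yes eq′ = contradiction (+-cancelˡ 1# _ _ (trans (sym eq) (trans eq′ (sym (+-identityʳ 1#))))) 1≢0
    ...   | no ne′ = refl

    ψ-Tr : ∀ {x y} → Tr x ≡ Tr y → ψ′ x ≡ ψ′ y
    ψ-Tr {x} {y} eq with Tr-prime-field y
    ... | inj₁ t = trans (ψ-0 (trans eq t)) (sym (ψ-0 t))
    ... | inj₂ (inj₁ t) = trans (ψ-1 (trans eq t)) (sym (ψ-1 t))
    ... | inj₂ (inj₂ t) = trans (ψ-2 (trans eq t)) (sym (ψ-2 t))

    ψ-+ : ∀ x y → ψ′ (x + y) ≡ ψ′ x *ω ψ′ y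
    ψ-+ x y with Tr-prime-field x | Tr-prime-field y
    ... | inj₁ s | inj₁ t = trans (ψ-0 (trans (Tr-+ x y) (trans (cong₂ _+_ s t) (+-identityˡ _)))) (sym (trans (cong₂ _*ω_ (ψ-0 s) (ψ-0 t)) (ωpow-* 0F 0F)))
    ... | inj₁ s | inj₂ (inj₁ t) = trans (ψ-1 (trans (Tr-+ x y) (trans (cong₂ _+_ s t) (+-identityˡ _)))) (sym (trans (cong₂ _*ω_ (ψ-0 s) (ψ-1 t)) (ωpow-* 0F 1F)))
    ... | inj₁ s | inj₂ (inj₂ t) = trans (ψ-2 (trans (Tr-+ x y) (trans (cong₂ _+_ s t) (+-identityˡ _)))) (sym (trans (cong₂ _*ω_ (ψ-0 s) (ψ-2 t)) (ωpow-* 0F 2F)))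
    ... | inj₂ (inj₁ s) | inj₁ t = trans (ψ-1 (trans (Tr-+ x y) (trans (cong₂ _+_ s t) (+-identityʳ _)))) (sym (trans (cong₂ _*ω_ (ψ-1 s) (ψ-0 t)) (ωpow-* 1F 0F)))
    ... | inj₂ (inj₁ s) | inj₂ (inj₁ t) = trans (ψ-2 (trans (Tr-+ x y) (cong₂ _+_ s t))) (sym (trans (cong₂ _*ω_ (ψ-1 s) (ψ-1 t)) (ωpow-* 1F 1F)))
    ... | inj₂ (inj₁ s) | inj₂ (inj₂ t) = trans (ψ-0 (trans (Tr-+ x y) (trans (cong₂ _+_ s t) (trans (+-comm _ _) 3≡0)))) (sym (trans (cong₂ _*ω_ (ψ-1 s) (ψ-2 t)) (ωpow-* 1F 2F)))
    ... | inj₂ (inj₂ s) | inj₁ t = trans (ψ-2 (trans (Tr-+ x y) (trans (cong₂ _+_ s t) (+-identityʳ _)))) (sym (trans (cong₂ _*ω_ (ψ-2 s) (ψ-0 t)) (ωpow-* 2F 0F)))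
    ... | inj₂ (inj₂ s) | inj₂ (inj₁ t) = trans (ψ-0 (trans (Tr-+ x y) (trans (cong₂ _+_ s t) 3≡0))) (sym (trans (cong₂ _*ω_ (ψ-2 s) (ψ-1 t)) (ωpow-* 2F 1F)))
    ... | inj₂ (inj₂ s) | inj₂ (inj₂ t) = trans (ψ-1 (trans (Tr-+ x y) (trans (cong₂ _+_ s t)
            (trans (sym (+-assoc _ _ _)) (trans (cong (_+ 1#) 3≡0) (+-identityˡ _)))))) (sym (trans (cong₂ _*ω_ (ψ-2 s) (ψ-2 t)) (ωpow-* 2F 2F)))

    ψ-cube : ∀ x → ψ′ (pow x 3) ≡ ψ′ x
    ψ-cube x = ψ-Tr (Tr-cube x)

    ψ-frobenius : ∀ k x → ψ′ (pow x (3 ℕ.^ k)) ≡ ψ′ x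
    ψ-frobenius zero x = cong ψ′ (*-identityʳ x)
    ψ-frobenius (suc k) x = trans (cong ψ′ (pow-3^suc x k)) (trans (ψ-frobenius k (pow x 3)) (ψ-cube x))

    ψ-0# : ψ′ 0# ≡ E.1#
    ψ-0# = ψ-0 Tr-0

    ψ-neg : ∀ x → ψ′ (- x) ≡ conj (ψ′ x)
    ψ-neg x with Tr-prime-field x
    ... | inj₁ t = trans (ψ-0 (trans (Tr-neg x) (trans (cong -_ t) -0#≈0#))) (sym (cong conj (ψ-0 t)))
    ... | inj₂ (inj₁ t) = trans (ψ-2 (trans (Tr-neg x) (trans (cong -_ t) (+-cancelʳ 1# _ _ (trans (-‿inverseˡ 1#) (sym 3≡0)))))) (sym (cong conj (ψ-1 t)))
    ... | inj₂ (inj₂ t) = trans (ψ-1 (trans (Tr-neg x) (trans (cong -_ t) (+-cancelˡ (1# + 1#) _ _ (trans (-‿inverseʳ _) (sym 3≡0)))))) (sym (cong conj (ψ-2 t)))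

    π-ψ : ∀ x → π (ψ′ x) ≡ 1#
    π-ψ x with Tr-prime-field x
    ... | inj₁ t = trans (cong π (ψ-0 t)) π-1
    ... | inj₂ (inj₁ t) = trans (cong π (ψ-1 t)) (trans (π-≡ (ℤ.+ 0) (ℤ.+ 1)) (+-identityˡ _))
    ... | inj₂ (inj₂ t) = trans (cong π (ψ-2 t)) (trans (π-≡ ℤ.-[1+ 0 ] ℤ.-[1+ 0 ]) (trans (solve 0 (:- con (ℤ.+ 1) :+ :- con (ℤ.+ 1) := con (ℤ.+ 1) :- con (ℤ.+ 3)) refl)
        (trans (cong (λ z → 1# - z) 3≡0) (trans (cong (1# +_) -0#≈0#) (+-identityʳ _)))))

    module ∑ω = SumsOver F ωRing

    -- Choose b with Tr b ≠ 0. Translations by b and 2b give 3S = (1 + ψ(b) + ψ(b)²) S = 0, and ℤ[ω]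
    -- has no 3-torsion.
    ∑ψ≡0 : ∑ω.∑ ψ′ ≡ 0ω
    ∑ψ≡0 with Tr-nonzero
    ... | b , Trb≢0 = ω-triple≡0 S (begin
        (S +ω S) +ω S
      ≡⟨ cong₂ _+ω_ (cong₂ _+ω_ (sym (E.*-identityˡ S)) (shifted b)) (shifted (b + b)) ⟩
        (E.1# *ω S +ω ψ′ b *ω S) +ω ψ′ (b + b) *ω S
      ≡⟨ E.solve 4 (λ a b c s → (a E.:* s E.:+ b E.:* s) E.:+ c E.:* s E.:= ((a E.:+ b) E.:+ c) E.:* s) refl E.1# (ψ′ b) (ψ′ (b + b)) S ⟩
        ((E.1# +ω ψ′ b) +ω ψ′ (b + b)) *ω S
      ≡⟨ cong (_*ω S) (trans (cong ((E.1# +ω ψ′ b) +ω_) (ψ-+ b b)) roots) ⟩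
        0ω *ω S
      ≡⟨ E.zeroˡ S ⟩
        0ω ∎)
      where
      S = ∑ω.∑ ψ′
      shifted : ∀ b → S ≡ ψ′ b *ω S
      shifted b = trans (sym (∑ω.∑-translate b ψ′)) (trans (E.Σ-cong elements (ψ-+ b)) (E.Σ-*ˡ elements (ψ′ b) ψ′))
      roots : (E.1# +ω ψ′ b) +ω (ψ′ b *ω ψ′ b) ≡ 0ω
      roots with Tr-prime-field b
      ... | inj₁ t = contradiction t Trb≢0
      ... | inj₂ (inj₁ t) = trans (cong (λ z → (E.1# +ω z) +ω (z *ω z)) (ψ-1 t)) (cong ((E.1# +ω ωpow 1) +ω_) (ωpow-* 1F 1F))
      ... | inj₂ (inj₂ t) = trans (cong (λ z → (E.1# +ω z) +ω (z *ω z)) (ψ-2 t)) (cong ((E.1# +ω ωpow 2) +ω_) (ωpow-* 2F 2F))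

    ∑ψ-scaled : ∀ {c} → c ≢ 0# → ∑ω.∑ (λ x → ψ′ (c * x)) ≡ 0ω
    ∑ψ-scaled c≢0 = trans (∑ω.∑-scale c≢0 ψ′) ∑ψ≡0

-- The monoid ring ℤ[ω][F], its residue map and its localisation.

module FormalSums where
  open RingSums
  open FiniteFields
  open EisensteinIntegers
  open CharacteristicThree
  open import Relation.Binary.PropositionalEquality using (refl; sym; trans)

  module Teichmüller (F : FiniteField) (n : ℕ) (order≡3^n : FiniteField.order F ≡ 3 ℕ.^ n) (1<n : 1 ℕ.< n) where
    open Ternary F n order≡3^n 1<n public
    open ≡.≡-Reasoning

    -- A formal sum of c[g], possibly with repeated g. The whole multiplicative monoid of F is used,
    -- so [0] is a basis element different from the empty sum.
    Formal : Set
    Formal = List (ℤω × X)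

    infixl 7 _⊛_
    _⊛_ : Formal → Formal → Formal
    _⊛_ = cartesianProductWith (λ (c , g) (d , h) → (c *ω d , g * h))

    ⊖_ : Formal → Formal
    ⊖_ = map (λ (c , g) → (-ω c , g))

    [_] : X → Formal
    [ g ] = (E.1# , g) ∷ []

    scalar : ℤω → Formal
    scalar c = (c , 1#) ∷ []

    -- The ℤ[ω]-linear functional that extends κ. Equality and divisibility of formal sums are both
    -- tested on all functionals, which spares collecting coefficients.
    ⟨_,_⟩ : Formal → (X → ℤω) → ℤω
    ⟨ z , κ ⟩ = E.Σ z (λ (c , g) → c *ω κ g)

    ⟨⟩-cong : ∀ z {κ κ′} → (∀ g → κ g ≡ κ′ g) → ⟨ z , κ ⟩ ≡ ⟨ z , κ′ ⟩
    ⟨⟩-cong z eq = E.Σ-cong z (λ (c , g) → cong (c *ω_) (eq g))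

    ⟨⟩-++ : ∀ z w κ → ⟨ z ++ w , κ ⟩ ≡ ⟨ z , κ ⟩ +ω ⟨ w , κ ⟩
    ⟨⟩-++ z w κ = E.Σ-++ z w _

    ⟨⟩-⊛ : ∀ z w κ → ⟨ z ⊛ w , κ ⟩ ≡ ⟨ z , (λ g → ⟨ w , (λ h → κ (g * h)) ⟩) ⟩
    ⟨⟩-⊛ z w κ = trans (E.Σ-cartesian _ z w _) (E.Σ-cong z λ (c , g) →
      trans (E.Σ-cong w (λ (d , h) → E.*-assoc c d (κ (g * h)))) (E.Σ-*ˡ w c _))

    ⟨⟩-⊖ : ∀ z κ → ⟨ ⊖ z , κ ⟩ ≡ -ω ⟨ z , κ ⟩
    ⟨⟩-⊖ z κ = trans (E.Σ-map _ z _) (trans (E.Σ-cong z (λ (c , g) → sym (E.-‿distribˡ-* c (κ g)))) (E.Σ-neg z _))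

    ⟨⟩-[] : ∀ g κ → ⟨ [ g ] , κ ⟩ ≡ κ g
    ⟨⟩-[] g κ = trans (E.+-identityʳ _) (E.*-identityˡ (κ g))

    ⟨⟩-scalar : ∀ c κ → ⟨ scalar c , κ ⟩ ≡ c *ω κ 1#
    ⟨⟩-scalar c κ = E.+-identityʳ _

    infix 4 _≋_
    record _≋_ (z w : Formal) : Set where
      constructor pairing
      field ⟨⟩-≡ : ∀ κ → ⟨ z , κ ⟩ ≡ ⟨ w , κ ⟩
    open _≋_

    private
      ⊛-comm : ∀ z w → z ⊛ w ≋ w ⊛ z
      ⊛-comm z w = pairing λ κ → begin
        ⟨ z ⊛ w , κ ⟩ ≡⟨ E.Σ-cartesian _ z w _ ⟩
        E.Σ z (λ (c , g) → E.Σ w (λ (d , h) → (c *ω d) *ω κ (g * h))) ≡⟨ E.Σ-swap z w _ ⟩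
        E.Σ w (λ (d , h) → E.Σ z (λ (c , g) → (c *ω d) *ω κ (g * h)))
          ≡⟨ E.Σ-cong w (λ (d , h) → E.Σ-cong z (λ (c , g) → cong₂ _*ω_ (E.*-comm c d) (cong κ (*-comm g h)))) ⟩
        E.Σ w (λ (d , h) → E.Σ z (λ (c , g) → (d *ω c) *ω κ (h * g))) ≡⟨ sym (E.Σ-cartesian _ w z _) ⟩
        ⟨ w ⊛ z , κ ⟩ ∎

      ⊛-cong : ∀ {x y z w} → x ≋ y → z ≋ w → x ⊛ z ≋ y ⊛ w
      ⊛-cong {x} {y} {z} {w} (pairing p) (pairing r) = pairing λ κ → trans (⟨⟩-⊛ x z κ)
        (trans (⟨⟩-cong x (λ g → r (λ h → κ (g * h)))) (trans (p _) (sym (⟨⟩-⊛ y w κ))))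

      ⊛-assoc : ∀ x y z → (x ⊛ y) ⊛ z ≋ x ⊛ (y ⊛ z)
      ⊛-assoc x y z = pairing λ κ → begin
        ⟨ (x ⊛ y) ⊛ z , κ ⟩ ≡⟨ ⟨⟩-⊛ (x ⊛ y) z κ ⟩
        ⟨ x ⊛ y , (λ g → ⟨ z , (λ h → κ (g * h)) ⟩) ⟩ ≡⟨ ⟨⟩-⊛ x y _ ⟩
        ⟨ x , (λ f → ⟨ y , (λ g → ⟨ z , (λ h → κ ((f * g) * h)) ⟩) ⟩) ⟩
          ≡⟨ ⟨⟩-cong x (λ f → trans (⟨⟩-cong y (λ g → ⟨⟩-cong z (λ h → cong κ (*-assoc f g h)))) (sym (⟨⟩-⊛ y z _))) ⟩
        ⟨ x , (λ f → ⟨ y ⊛ z , (λ h → κ (f * h)) ⟩) ⟩ ≡⟨ sym (⟨⟩-⊛ x (y ⊛ z) κ) ⟩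
        ⟨ x ⊛ (y ⊛ z) , κ ⟩ ∎

      ⊛-identityˡ : ∀ z → [ 1# ] ⊛ z ≋ z
      ⊛-identityˡ z = pairing λ κ → trans (⟨⟩-⊛ [ 1# ] z κ) (trans (⟨⟩-[] 1# (λ g → ⟨ z , (λ h → κ (g * h)) ⟩)) (⟨⟩-cong z (λ g → cong κ (*-identityˡ g))))

      ⊛-distribʳ : ∀ z x y → (x ++ y) ⊛ z ≋ x ⊛ z ++ y ⊛ z
      ⊛-distribʳ z x y = pairing λ κ → trans (⟨⟩-⊛ (x ++ y) z κ) (trans (E.Σ-++ x y _)
        (trans (cong₂ _+ω_ (sym (⟨⟩-⊛ x z κ)) (sym (⟨⟩-⊛ y z κ))) (sym (E.Σ-++ (x ⊛ z) (y ⊛ z) _))))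

      ≋-trans : ∀ {x y z} → x ≋ y → y ≋ z → x ≋ z
      ≋-trans (pairing p) (pairing r) = pairing λ κ → trans (p κ) (r κ)

      ++-cong : ∀ {x y z w} → x ≋ y → z ≋ w → x ++ z ≋ y ++ w
      ++-cong {x} {y} {z} {w} (pairing p) (pairing r) = pairing λ κ →
        trans (E.Σ-++ x z _) (trans (cong₂ _+ω_ (p κ) (r κ)) (sym (E.Σ-++ y w _)))

      ++-comm : ∀ x y → x ++ y ≋ y ++ x
      ++-comm x y = pairing λ κ → trans (E.Σ-++ x y _) (trans (E.+-comm ⟨ x , κ ⟩ ⟨ y , κ ⟩) (sym (E.Σ-++ y x _)))

      ⊖-inverseˡ : ∀ x → ⊖ x ++ x ≋ []
      ⊖-inverseˡ x = pairing λ κ → trans (E.Σ-++ (⊖ x) x _) (trans (cong (_+ω ⟨ x , κ ⟩) (⟨⟩-⊖ x κ)) (E.-‿inverseˡ ⟨ x , κ ⟩))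

    formalRing : CommutativeRing 0ℓ 0ℓ
    formalRing = record
      { Carrier = Formal ; _≈_ = _≋_ ; _+_ = _++_ ; _*_ = _⊛_ ; -_ = ⊖_ ; 0# = [] ; 1# = [ 1# ]
      ; isCommutativeRing = record
        { isRing = record
          { +-isAbelianGroup = record
            { isGroup = record
              { isMonoid = record
                { isSemigroup = record
                  { isMagma = record
                    { isEquivalence = record
                      { refl = pairing λ _ → refl ; sym = λ (pairing p) → pairing λ κ → sym (p κ) ; trans = ≋-trans }
                    ; ∙-cong = ++-cong }
                  ; assoc = λ x y z → pairing λ κ → cong ⟨_, κ ⟩ (++-assoc x y z) }
                ; identity = (λ _ → pairing λ _ → refl) , (λ x → pairing λ κ → cong ⟨_, κ ⟩ (++-identityʳ x)) }
              ; inverse = ⊖-inverseˡ , (λ x → ≋-trans (++-comm x (⊖ x)) (⊖-inverseˡ x))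
              ; ⁻¹-cong = λ {x} {y} (pairing p) → pairing λ κ → trans (⟨⟩-⊖ x κ) (trans (cong -ω_ (p κ)) (sym (⟨⟩-⊖ y κ))) }
            ; comm = ++-comm }
          ; *-cong = ⊛-cong
          ; *-assoc = ⊛-assoc
          ; *-identity = ⊛-identityˡ , (λ x → ≋-trans (⊛-comm x [ 1# ]) (⊛-identityˡ x))
          ; distrib = (λ z x y → ≋-trans (⊛-comm z (x ++ y)) (≋-trans (⊛-distribʳ z x y) (++-cong (⊛-comm x z) (⊛-comm y z))))
                    , ⊛-distribʳ }
        ; *-comm = ⊛-comm } }
      where open import Data.List.Properties using (++-assoc; ++-identityʳ)

    private module B = Kit formalRing

    π-0 : π 0ω ≡ 0#
    π-0 = trans (π-≡ (ℤ.+ 0) (ℤ.+ 0)) (+-identityˡ 0#)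

    π-neg : ∀ c → π (-ω c) ≡ - π c
    π-neg c = +-cancelˡ (π c) _ _ (trans (sym (π-+ c (-ω c))) (trans (cong π (E.-‿inverseʳ c)) (trans π-0 (sym (-‿inverseʳ _)))))

    π-Σ : ∀ {a} {A : Set a} (xs : List A) f → π (E.Σ xs f) ≡ Σ xs (λ x → π (f x))
    π-Σ [] f = π-0
    π-Σ (x ∷ xs) f = trans (π-+ (f x) (E.Σ xs f)) (cong (π (f x) +_) (π-Σ xs f))

    π-cube : ∀ c → pow (π c) 3 ≡ π c
    π-cube (a , b) = subst (λ z → pow z 3 ≡ z) (sym (π-≡ a b)) (trans (cube-+ _ _) (cong₂ _+_ (ℤ-cube a) (ℤ-cube b)))
      where
      ℕ-cube : ∀ k → pow (k ᴺ) 3 ≡ k ᴺ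
      ℕ-cube zero = zeroˡ _
      ℕ-cube (suc k) = trans (cong (λ z → pow z 3) (ᴺ-suc k)) (trans (cube-+ _ _)
        (trans (cong₂ _+_ (pow-1# 3) (ℕ-cube k)) (sym (ᴺ-suc k))))
      ℤ-cube : ∀ i → pow ⟦ i ⟧ℤ 3 ≡ ⟦ i ⟧ℤ
      ℤ-cube (ℤ.+ k) = ℕ-cube k
      ℤ-cube ℤ.-[1+ k ] = trans (frobenius-neg 1 (suc k ᴺ)) (cong -_ (ℕ-cube (suc k)))

    Tr-π : ∀ c y → Tr (π c * y) ≡ π c * Tr y
    Tr-π c y with prime-field (π-cube c)
    ... | inj₁ t = trans (cong (λ t → Tr (t * y)) t) (trans (cong Tr (zeroˡ y)) (trans Tr-0 (sym (trans (cong (_* Tr y) t) (zeroˡ _)))))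
    ... | inj₂ (inj₁ t) = trans (cong (λ t → Tr (t * y)) t) (trans (cong Tr (*-identityˡ y)) (sym (trans (cong (_* Tr y) t) (*-identityˡ _))))
    ... | inj₂ (inj₂ t) = trans (cong (λ t → Tr (t * y)) t) (trans (cong Tr (double y)) (trans (Tr-+ y y) (sym (trans (cong (_* Tr y) t) (double _)))))
      where
      double : ∀ y → (1# + 1#) * y ≡ y + y
      double y = trans (distribʳ y 1# 1#) (cong₂ _+_ (*-identityˡ y) (*-identityˡ y))

    -- The ring homomorphism onto F that sends [g] to g and ω to 1: the residue map of the
    -- substitute for the Witt ring.
    reduce : Formal → X
    reduce z = Σ z (λ (c , g) → π c * g)

    reduce-++ : ∀ z w → reduce (z ++ w) ≡ reduce z + reduce w
    reduce-++ z w = Σ-++ z w _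

    reduce-⊖ : ∀ z → reduce (⊖ z) ≡ - reduce z
    reduce-⊖ z = trans (Σ-map _ z _) (trans (Σ-cong z (λ (c , g) → trans (cong (_* g) (π-neg c)) (sym (-‿distribˡ-* _ _)))) (Σ-neg z _))

    reduce-⊛ : ∀ z w → reduce (z ⊛ w) ≡ reduce z * reduce w
    reduce-⊛ z w = trans (Σ-cartesian _ z w _) (trans
      (Σ-cong z (λ (c , g) → Σ-cong w (λ (d , h) → trans (cong (_* (g * h)) (π-* c d))
        (solve 4 (λ c d g h → (c :* d) :* (g :* h) := (c :* g) :* (d :* h)) refl (π c) (π d) g h))))
      (sym (Σ-*-Σ z w _ _)))

    reduce-[] : ∀ g → reduce [ g ] ≡ g
    reduce-[] g = trans (+-identityʳ _) (trans (cong (_* g) π-1) (*-identityˡ g))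

    reduce-scalar : ∀ c → reduce (scalar c) ≡ π c
    reduce-scalar c = trans (+-identityʳ _) (*-identityʳ _)

    reduce-Σ : ∀ {a} {A : Set a} (xs : List A) f → reduce (B.Σ xs f) ≡ Σ xs (λ x → reduce (f x))
    reduce-Σ [] f = refl
    reduce-Σ (x ∷ xs) f = trans (reduce-++ (f x) _) (cong (reduce (f x) +_) (reduce-Σ xs f))

    record Divisible (k : ℕ) (z : Formal) : Set where
      constructor divisible
      field pairing-divisible : ∀ κ → λ^ k ∣ ⟨ z , κ ⟩

    divisible-≋ : ∀ {k z w} → z ≋ w → Divisible k z → Divisible k w
    divisible-≋ {k} (pairing p) (divisible d) = divisible λ κ → subst (λ^ k ∣_) (p κ) (d κ)

    divisible-++ : ∀ {k z w} → Divisible k z → Divisible k w → Divisible k (z ++ w)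
    divisible-++ {k} {z} {w} (divisible d) (divisible e) = divisible λ κ → subst (λ^ k ∣_) (sym (E.Σ-++ z w _)) (∣-+ (d κ) (e κ))

    -- A functional of the product pairs z with the function g ↦ ⟨w, κ(g ·)⟩. Each of these inner
    -- values is λ^k y(g), and the pairing of z with the quotients y contributes λ^j.
    divisible-⊛ : ∀ {j k z w} → Divisible j z → Divisible k w → Divisible (j ℕ.+ k) (z ⊛ w)
    divisible-⊛ {j} {k} {z} {w} (divisible d) (divisible e) = divisible λ κ → let y = y κ in subst (λ^ (j ℕ.+ k) ∣_)
      (trans (E.*-comm (⟨ z , y ⟩) (λ^ k)) (trans (sym (E.Σ-*ˡ z (λ^ k) _)) (trans
        (E.Σ-cong z (λ (c , g) → trans (E.solve 3 (λ l c y → l E.:* (c E.:* y) E.:= c E.:* (l E.:* y)) refl (λ^ k) c (y g))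
          (cong (c *ω_) (sym (λ^_∣_.equality (e (λ h → κ (g * h))))))))
        (sym (⟨⟩-⊛ z w κ)))))
      (∣-* (d y) (E.1# , sym (E.*-identityʳ (λ^ k))))
      where
      y : (X → ℤω) → X → ℤω
      y κ g = λ^_∣_.quotient (e (λ h → κ (g * h)))

    divisible-⊛ˡ : ∀ {k} u {z} → Divisible k z → Divisible k (u ⊛ z)
    divisible-⊛ˡ u d = divisible-⊛ {z = u} (divisible λ κ → ∣-zero _) d

    -- Divisibility by λ^k in the monoid ring ℤ[ω][F] localised at the elements with nonzero
    -- image under reduce.
    record Valued (k : ℕ) (z : Formal) : Set where
      constructor valued
      field
        multiplier : Formal
        normalised : reduce multiplier ≡ 1#
        isDivisible : Divisible k (multiplier ⊛ z)

    valued-≋ : ∀ {k z w} → z ≋ w → Valued k z → Valued k w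
    valued-≋ eq (valued u πu d) = valued u πu (divisible-≋ (B.*-congˡ {u} eq) d)

    valued-zero : ∀ z → Valued 0 z
    valued-zero z = valued [ 1# ] (reduce-[] 1#) (divisible λ κ → ∣-zero _)

    valued-[] : ∀ k → Valued k []
    valued-[] k = valued [ 1# ] (reduce-[] 1#) (divisible λ κ → ∣-0 k)

    private
      normalised-⊛ : ∀ {u v} → reduce u ≡ 1# → reduce v ≡ 1# → reduce (u ⊛ v) ≡ 1#
      normalised-⊛ {u} {v} πu πv = trans (reduce-⊛ u v) (trans (cong₂ _*_ πu πv) (*-identityˡ 1#))

    valued-++ : ∀ {k z w} → Valued k z → Valued k w → Valued k (z ++ w)
    valued-++ {z = z} {w} (valued u πu d) (valued v πv e) = valued (u ⊛ v) (normalised-⊛ {u} {v} πu πv)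
      (divisible-≋ (B.solve 4 (λ u v z w → v B.:* (u B.:* z) B.:+ u B.:* (v B.:* w) B.:= (u B.:* v) B.:* (z B.:+ w)) B.≈-refl u v z w)
        (divisible-++ {z = v ⊛ (u ⊛ z)} (divisible-⊛ˡ v {u ⊛ z} d) (divisible-⊛ˡ u {v ⊛ w} e)))

    valued-⊛ : ∀ {j k z w} → Valued j z → Valued k w → Valued (j ℕ.+ k) (z ⊛ w)
    valued-⊛ {z = z} {w} (valued u πu d) (valued v πv e) = valued (u ⊛ v) (normalised-⊛ {u} {v} πu πv)
      (divisible-≋ (B.solve 4 (λ u v z w → (u B.:* z) B.:* (v B.:* w) B.:= (u B.:* v) B.:* (z B.:* w)) B.≈-refl u v z w)
        (divisible-⊛ {z = u ⊛ z} {v ⊛ w} d e))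

    valued-⊛ˡ : ∀ {k} z {w} → Valued k w → Valued k (z ⊛ w)
    valued-⊛ˡ z p = valued-⊛ (valued-zero z) p

    valued-weaken : ∀ {j k z} → j ℕ.≤ k → Valued k z → Valued j z
    valued-weaken {j} {k} j≤k (valued u πu (divisible d)) = valued u πu (divisible λ κ → ∣-weaken j≤k (d κ))

    -- An element u of nonzero residue becomes a unit: if v is a normalised multiplier, then so is
    -- the product of v and u with [1 / reduce u].
    valued-cancel : ∀ {k} u {z} → reduce u ≢ 0# → Valued k (u ⊛ z) → Valued k z
    valued-cancel u {z} πu≢0 (valued v πv d) = valued ([ c ] ⊛ (v ⊛ u))
      (trans (reduce-⊛ [ c ] (v ⊛ u)) (trans (cong₂ _*_ (reduce-[] c) (trans (reduce-⊛ v u) (trans (cong (_* reduce u) πv) (*-identityˡ _))))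
        (trans (*-comm _ _) (inv-inverse πu≢0))))
      (divisible-≋ (B.solve 4 (λ c v u z → c B.:* (v B.:* (u B.:* z)) B.:= (c B.:* (v B.:* u)) B.:* z) B.≈-refl [ c ] v u z)
        (divisible-⊛ˡ [ c ] {v ⊛ (u ⊛ z)} d))
      where c = inv (reduce u)

    -- The trace takes its values in F, but a functional needs values in ℤ[ω]; this is the trace
    -- lifted to 0, 1, 2.
    liftTr : X → ℤω
    liftTr x with Tr-prime-field x
    ... | inj₁ _ = 0ω
    ... | inj₂ (inj₁ _) = E.1#
    ... | inj₂ (inj₂ _) = E.1# +ω E.1#

    π-liftTr : ∀ x → π (liftTr x) ≡ Tr x
    π-liftTr x with Tr-prime-field x
    ... | inj₁ t = trans π-0 (sym t)
    ... | inj₂ (inj₁ t) = trans π-1 (sym t)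
    ... | inj₂ (inj₂ t) = trans (π-+ E.1# E.1#) (trans (cong₂ _+_ π-1 π-1) (sym t))

    -- Modulo λ this is the idempotent of the group ring that projects onto the
    -- component F of reduce.
    projector : Formal
    projector = map (λ x → (-ω liftTr x , inv x)) elements

    reduce-projector : reduce projector ≡ 1#
    reduce-projector = trans (Σ-map _ elements _) (trans
      (Σ-cong elements (λ x → trans (cong (_* inv x) (trans (π-neg (liftTr x)) (cong -_ (π-liftTr x)))) (sym (-‿distribˡ-* _ _))))
      (trans (Σ-neg elements _) (trans (cong -_ ∑-Tr-inv) (-‿involutive 1#))))

    ∑-Tr : ∑ Tr ≡ 0#
    ∑-Tr = go n
      where
      go : ∀ i → ∑ (trace i) ≡ 0#
      go zero = Σ-zero elements (λ _ → refl)
      go (suc i) = trans (Σ-+ elements (λ x → pow x (3 ℕ.^ i)) (trace i)) (trans (cong₂ _+_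
        (trans (∑-reindex (frobenius-injective i) (λ x → x))
          (trans (Σ-cong elements (λ x → sym (*-identityʳ x))) (power-sum 1 (λ ()) (ℕₚ.≤-trans (s≤s (s≤s z≤n)) 8≤q-1)))) (go i)) (+-identityˡ 0#))

    private
      -- For g ≠ 0 substitute g x for x. For g = 0 both sides vanish, the left one because the trace
      -- sums to 0 over F.
      project-term : ∀ (κ : X → X) g → ∑ (λ x → Tr x * κ (inv x * g)) ≡ ∑ (λ x → Tr (g * x) * κ (inv x))
      project-term κ g with g ≟ 0#
      ... | yes refl = trans (Σ-cong elements (λ x → cong (λ y → Tr x * κ y) (zeroʳ (inv x))))
          (trans (Σ-*ʳ elements (κ 0#) Tr) (trans (cong (_* κ 0#) ∑-Tr) (trans (zeroˡ _)
          (sym (Σ-zero elements (λ {x} _ → trans (cong (_* κ (inv x)) (trans (cong Tr (zeroˡ x)) Tr-0)) (zeroˡ _)))))))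
      ... | no g≢0 = trans (sym (∑-scale g≢0 _)) (Σ-cong elements (λ x → cong (λ y → Tr (g * x) * κ y) (begin
          inv (g * x) * g ≡⟨ cong (_* g) (pow-distrib g x q-2) ⟩
          (inv g * inv x) * g ≡⟨ solve 3 (λ g a b → (a :* b) :* g := (g :* a) :* b) refl g (inv g) (inv x) ⟩
          (g * inv g) * inv x ≡⟨ cong (_* inv x) (inv-inverse g≢0) ⟩
          1# * inv x ≡⟨ *-identityˡ _ ⟩
          inv x ∎)))

      trace-reduce : ∀ z x → Σ z (λ (c , g) → π c * Tr (g * x)) ≡ Tr (reduce z * x)
      trace-reduce [] x = sym (trans (cong Tr (zeroˡ x)) Tr-0)
      trace-reduce ((c , g) ∷ z) x = trans (cong₂ _+_ (sym (Tr-π c (g * x))) (trace-reduce z x))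
        (trans (sym (Tr-+ _ _)) (cong Tr (solve 4 (λ c g r x → c :* (g :* x) :+ r :* x := (c :* g :+ r) :* x) refl (π c) g (reduce z) x)))

      -- The point is the shape of the right side: modulo λ, a functional of projector ⊛ z depends
      -- on z through `reduce z` alone.
      π-projected : ∀ z κ → π ⟨ projector ⊛ z , κ ⟩ ≡ - ∑ (λ x → π (κ (inv x)) * Tr (reduce z * x))
      π-projected z κ = begin
          π ⟨ projector ⊛ z , κ ⟩
        ≡⟨ trans (cong π (trans (E.Σ-cartesian _ projector z _) (E.Σ-map _ elements _))) (trans (π-Σ elements _) (Σ-cong elements (λ x → π-Σ z _))) ⟩
          ∑ (λ x → Σ z (λ (c , g) → π (((-ω liftTr x) *ω c) *ω κ (inv x * g))))
        ≡⟨ Σ-cong elements (λ x → Σ-cong z (λ (c , g) → trans (π-* _ _) (cong (_* π (κ (inv x * g))) (trans (π-* _ c)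
             (cong (_* π c) (trans (π-neg (liftTr x)) (cong -_ (π-liftTr x)))))))) ⟩
          ∑ (λ x → Σ z (λ (c , g) → ((- Tr x) * π c) * π (κ (inv x * g))))
        ≡⟨ Σ-swap elements z _ ⟩
          Σ z (λ (c , g) → ∑ (λ x → ((- Tr x) * π c) * π (κ (inv x * g))))
        ≡⟨ Σ-cong z (λ (c , g) → trans (Σ-cong elements (λ x → solve 3 (λ t c k → ((:- t) :* c) :* k := (:- c) :* (t :* k)) refl (Tr x) (π c) _))
             (trans (Σ-*ˡ elements (- π c) _) (cong ((- π c) *_) (project-term (λ y → π (κ y)) g)))) ⟩
          Σ z (λ (c , g) → (- π c) * ∑ (λ x → Tr (g * x) * π (κ (inv x))))
        ≡⟨ Σ-cong z (λ (c , g) → trans (sym (Σ-*ˡ elements (- π c) _)) (Σ-cong elements (λ x →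
             solve 3 (λ t c k → (:- c) :* (t :* k) := (:- k) :* (c :* t)) refl (Tr (g * x)) (π c) _))) ⟩
          Σ z (λ (c , g) → ∑ (λ x → (- π (κ (inv x))) * (π c * Tr (g * x))))
        ≡⟨ Σ-swap z elements _ ⟩
          ∑ (λ x → Σ z (λ (c , g) → (- π (κ (inv x))) * (π c * Tr (g * x))))
        ≡⟨ Σ-cong elements (λ x → trans (Σ-*ˡ z (- π (κ (inv x))) _) (trans (cong ((- π (κ (inv x))) *_) (trace-reduce z x)) (sym (-‿distribˡ-* _ _)))) ⟩
          ∑ (λ x → - (π (κ (inv x)) * Tr (reduce z * x)))
        ≡⟨ Σ-neg elements _ ⟩
          - ∑ (λ x → π (κ (inv x)) * Tr (reduce z * x)) ∎

    -- With `projector` as multiplier, an element of residue 0 becomes divisible by λ. So λ acts as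
    -- a uniformiser of the localised ring, with residue field F.
    reduce≡0⇒valued : ∀ {z} → reduce z ≡ 0# → Valued 1 z
    reduce≡0⇒valued {z} πz = valued projector reduce-projector (divisible λ κ → π≈0⇒λ∣ _ (trans (π-projected z κ)
      (trans (cong -_ (Σ-zero elements (λ {x} _ → trans (cong (π (κ (inv x)) *_) (trans (cong Tr (trans (cong (_* x) πz) (zeroˡ x))) Tr-0)) (zeroʳ _)))) -0#≈0#)))

    private
      -- The residue of c is 1 or -1, so λ divides c² - 1. From w = c(cw) - (c² - 1)w the
      -- divisibility of w grows by one factor λ at a time, up to λ^k.
      λ∣-cancel : ∀ k {c w} → π c ≢ 0# → λ^ k ∣ c *ω w → λ^ k ∣ w
      λ∣-cancel k {c} {w} πc≢0 k∣cw = go k ℕₚ.≤-refl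
        where
        πcc : π (c *ω c) ≡ 1#
        πcc = *-cancelˡ πc≢0 (trans (trans (cong (π c *_) (trans (π-* c c) (cong (π c *_) (sym (*-identityʳ _))))) (π-cube c)) (sym (*-identityʳ _)))
        λ∣ : λ^ 1 ∣ (c *ω c) +ω (-ω E.1#)
        λ∣ = π≈0⇒λ∣ _ (trans (π-+ (c *ω c) (-ω E.1#)) (trans (cong₂ _+_ πcc (trans (π-neg E.1#) (cong -_ π-1))) (-‿inverseʳ 1#)))
        go : ∀ j → j ℕ.≤ k → λ^ j ∣ w
        go zero _ = ∣-zero w
        go (suc j) j<k = subst (λ^ suc j ∣_)
          (E.solve 2 (λ c w → c E.:* (c E.:* w) E.:- (c E.:* c E.:- E.con (ℤ.+ 1)) E.:* w E.:= w) refl c w)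
          (∣-+ (∣-*ˡ c (∣-weaken j<k k∣cw)) (∣-neg (∣-* λ∣ (go j (ℕₚ.<⇒≤ j<k)))))

    -- The way back to ℤ[ω]. Under g ↦ liftTr(g b) the multiplier u takes a value of residue Tr(b) ≠
    -- 0, which is prime to λ and cancels.
    valued-scalar : ∀ {k c} → Valued k (scalar c) → λ^ k ∣ c
    valued-scalar {k} {c} (valued u πu (divisible d)) with Tr-nonzero
    ... | b , Trb≢0 = λ∣-cancel k {⟨ u , κ ⟩}
        (λ eq → Trb≢0 (trans (sym πκ) eq))
        (subst (λ^ k ∣_) (trans (⟨⟩-⊛ u (scalar c) κ) (trans (⟨⟩-cong u (λ g → trans (⟨⟩-scalar c (λ h → κ (g * h)))
          (trans (cong (λ y → c *ω κ y) (*-identityʳ g)) (E.*-comm c (κ g))))) (trans (E.Σ-cong u (λ (e , g) → sym (E.*-assoc e (κ g) c))) (E.Σ-*ʳ u c _)))) (d κ))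
      where
      κ : X → ℤω
      κ g = liftTr (g * b)
      πκ : π ⟨ u , κ ⟩ ≡ Tr b
      πκ = trans (π-Σ u _) (trans (Σ-cong u (λ (e , g) → trans (π-* e (κ g)) (cong (π e *_) (π-liftTr (g * b)))))
        (trans (trace-reduce u b) (cong Tr (trans (cong (_* b) πu) (*-identityˡ b)))))

    -- The intersection of the powers of λ. It contains [0] and those sums of Teichmüller elements
    -- that vanish in the Witt ring by an invariance argument.
    Negligible : Formal → Set
    Negligible z = ∀ k → Valued k z

    negligible : Ideal formalRing
    negligible = record
      { I = Negligible
      ; I-resp = λ eq p k → valued-≋ eq (p k)
      ; I-0 = valued-[]
      ; I-+ = λ p r k → valued-++ (p k) (r k)
      ; I-* = λ z p k → valued-⊛ˡ z (p k) }

    open Quotient formalRing negligible public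
      using (_∼_; ≈⇒∼; I⇒∼0; difference∈I) renaming (quotient to 𝒪)

    valued-∼ : ∀ {k z w} → z ∼ w → Valued k z → Valued k w
    valued-∼ {k} {z} {w} eq p = valued-≋
      (B.solve 2 (λ z w → z B.:+ B.con (ℤ.- ℤ.+ 1) B.:* (z B.:- w) B.:= w) B.≈-refl z w)
      (valued-++ p (valued-⊛ˡ (⊖ [ 1# ]) (difference∈I eq k)))

-- The laws of the Teichmüller lift, gathered into an interface.

module TeichmüllerLifts where
  open RingSums
  open EisensteinIntegers
  open CharacteristicThree
  open FormalSums
  import Data.Integer
  open import Relation.Binary.PropositionalEquality using (refl; sym; trans)

  module _ (F : FiniteField) (n : ℕ) (order≡3^n : FiniteField.order F ≡ 3 ℕ.^ n) (1<n : 1 ℕ.< n) where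
    open Ternary F n order≡3^n 1<n

    -- A substitute for the ring of Witt vectors of F with ω adjoined: τ is the Teichmüller
    -- character and Valued k collects the elements divisible by λ^k.
    record TeichmüllerLift : Set₁ where
      field
        𝒪 : CommutativeRing 0ℓ 0ℓ
      private module O = CommutativeRing 𝒪
      field
        τ : X → O.Carrier
        ι : ℤω → O.Carrier
        reduce : O.Carrier → X
        Valued : ℕ → O.Carrier → Set
        τ-* : ∀ g h → τ (g * h) O.≈ τ g O.* τ h
        τ-1 : τ 1# O.≈ O.1#
        ι-+ : ∀ c d → ι (c +ω d) O.≈ ι c O.+ ι d
        ι-* : ∀ c d → ι (c *ω d) O.≈ ι c O.* ι d
        ι-0 : ι 0ω O.≈ O.0#
        ι-1 : ι E.1# O.≈ O.1#
        reduce-τ : ∀ g → reduce (τ g) ≡ g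
        reduce-ι : ∀ c → reduce (ι c) ≡ π c
        reduce-+ : ∀ x y → reduce (x O.+ y) ≡ reduce x + reduce y
        reduce-* : ∀ x y → reduce (x O.* y) ≡ reduce x * reduce y
        reduce-neg : ∀ x → reduce (O.- x) ≡ - reduce x
        reduce-0 : reduce O.0# ≡ 0#
        reduce-1 : reduce O.1# ≡ 1#
        valued-≈ : ∀ {k x y} → x O.≈ y → Valued k x → Valued k y
        valued-zero : ∀ x → Valued 0 x
        valued-0# : ∀ k → Valued k O.0#
        valued-+ : ∀ {k x y} → Valued k x → Valued k y → Valued k (x O.+ y)
        valued-* : ∀ {j k x y} → Valued j x → Valued k y → Valued (j ℕ.+ k) (x O.* y)
        valued-weaken : ∀ {j k x} → j ℕ.≤ k → Valued k x → Valued j x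
        valued-cancel : ∀ {k} u {x} → reduce u ≢ 0# → Valued k (u O.* x) → Valued k x
        valued-ι : ∀ {k c} → Valued k (ι c) → λ^ k ∣ c
        reduce≡0⇒valued : ∀ {x} → reduce x ≡ 0# → Valued 1 x
        all-valued⇒≈0 : ∀ {x} → (∀ k → Valued k x) → x O.≈ O.0#

    opaque
      teichmüllerLift : TeichmüllerLift
      teichmüllerLift = record
        { 𝒪 = T.𝒪
        ; τ = [_]
        ; ι = scalar
        ; reduce = reduce
        ; Valued = Valued
        ; τ-* = λ g h → ≈⇒∼ (pairing λ κ → cong (λ c → (c *ω κ (g * h)) +ω 0ω) (sym (E.*-identityˡ E.1#)))
        ; τ-1 = O.≈-refl
        ; ι-+ = λ c d → ≈⇒∼ (pairing λ κ → trans (⟨⟩-scalar (c +ω d) κ) (trans (E.distribʳ (κ 1#) c d)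
            (sym (trans (⟨⟩-++ (scalar c) (scalar d) κ) (cong₂ _+ω_ (⟨⟩-scalar c κ) (⟨⟩-scalar d κ))))))
        ; ι-* = λ c d → ≈⇒∼ (pairing λ κ → cong (λ g → ((c *ω d) *ω κ g) +ω 0ω) (sym (*-identityˡ 1#)))
        ; ι-0 = ≈⇒∼ (pairing λ κ → trans (⟨⟩-scalar 0ω κ) (E.zeroˡ (κ 1#)))
        ; ι-1 = O.≈-refl
        ; reduce-τ = reduce-[]
        ; reduce-ι = reduce-scalar
        ; reduce-+ = reduce-++
        ; reduce-* = reduce-⊛
        ; reduce-neg = reduce-⊖
        ; reduce-0 = refl
        ; reduce-1 = reduce-[] 1#
        ; valued-≈ = valued-∼
        ; valued-zero = valued-zero
        ; valued-0# = valued-[]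
        ; valued-+ = valued-++
        ; valued-* = valued-⊛
        ; valued-weaken = valued-weaken
        ; valued-cancel = valued-cancel
        ; valued-ι = valued-scalar
        ; reduce≡0⇒valued = reduce≡0⇒valued
        ; all-valued⇒≈0 = I⇒∼0 }
        where
        module T = Teichmüller F n order≡3^n 1<n
        open T using
          ( [_]; scalar; reduce; Valued; ≈⇒∼; I⇒∼0; pairing; ⟨⟩-scalar; ⟨⟩-++; reduce-[]; reduce-scalar; reduce-++; reduce-⊛; reduce-⊖
          ; valued-∼; valued-zero; valued-[]; valued-++; valued-⊛; valued-weaken; valued-cancel; valued-scalar; reduce≡0⇒valued )
        module O = Kit T.𝒪

-- Gauss and Jacobi sums, their valuations, and the expansion of the Weil sum.

module GaussSumValuations where
  open RingSums
  open FiniteFields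
  open EisensteinIntegers
  open CharacteristicThree
  open TeichmüllerLifts
  open import Data.Fin using (zero; suc; inject₁)
  open import Data.List using (downFrom)
  open import Data.List.Properties using (length-++)
  open import Data.List.Membership.Propositional.Properties using (∈-downFrom⁻)
  open import Relation.Binary.PropositionalEquality using (refl; sym; trans)

  val : List (Fin 3) → ℕ
  val [] = 0
  val (d ∷ ds) = toℕ d ℕ.+ 3 ℕ.* val ds

  val-++ : ∀ u w → val (u ++ w) ≡ val u ℕ.+ 3 ℕ.^ length u ℕ.* val w
  val-++ [] w = sym (ℕₚ.+-identityʳ _)
  val-++ (d ∷ u) w = trans (cong (λ v → toℕ d ℕ.+ 3 ℕ.* v) (val-++ u w)) (rearrange (toℕ d) (val u) (3 ℕ.^ length u) (val w))
    where
    rearrange : ∀ d u l w → d ℕ.+ 3 ℕ.* (u ℕ.+ l ℕ.* w) ≡ (d ℕ.+ 3 ℕ.* u) ℕ.+ 3 ℕ.* l ℕ.* w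
    rearrange = ℕ-Solver.solve-∀

  val-bound : ∀ v → val v ℕ.< 3 ℕ.^ length v
  val-bound [] = s≤s z≤n
  val-bound (d ∷ v) = ℕₚ.≤-trans (ℕₚ.+-monoˡ-< (3 ℕ.* val v) (Finₚ.toℕ<n d))
    (ℕₚ.≤-trans (ℕₚ.≤-reflexive (sym (ℕₚ.*-suc 3 (val v)))) (ℕₚ.*-monoʳ-≤ 3 (val-bound v)))

  codigit : Fin 3 → ℕ
  codigit d = 2 ℕ.∸ toℕ d

  -- For n digits of sum w this is 2n - w, the exponent of λ that Stickelberger's theorem attaches
  -- to φ.
  deficit : List (Fin 3) → ℕ
  deficit [] = 0
  deficit (d ∷ ds) = codigit d ℕ.+ deficit ds

  deficit-++ : ∀ u w → deficit (u ++ w) ≡ deficit u ℕ.+ deficit w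
  deficit-++ [] w = refl
  deficit-++ (d ∷ u) w = trans (cong (codigit d ℕ.+_) (deficit-++ u w)) (sym (ℕₚ.+-assoc (codigit d) _ _))

  -- With x in `Fin 2`, the digit `inject₁ x` is 0 or 1 and `suc x` is the digit raised by one.
  non-maximal-digit : ∀ v → deficit v ≢ 0 → ∃[ u ] ∃[ x ] ∃[ w ] v ≡ u ++ inject₁ {2} x ∷ w
  non-maximal-digit [] ne = contradiction refl ne
  non-maximal-digit (0F ∷ v) ne = [] , 0F , v , refl
  non-maximal-digit (1F ∷ v) ne = [] , 1F , v , refl
  non-maximal-digit (2F ∷ v) ne with non-maximal-digit v ne
  ... | u , x , w , eq = 2F ∷ u , x , w , cong (2F ∷_) eq

  module GaussSums (F : FiniteField) (n : ℕ) (order≡3^n : FiniteField.order F ≡ 3 ℕ.^ n) (1<n : 1 ℕ.< n) where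
    open Ternary F n order≡3^n 1<n public
    open TeichmüllerLift (teichmüllerLift F n order≡3^n 1<n) public
    private module O = Kit 𝒪
    open O public using () renaming (_≈_ to infix 4 _∼_; _*_ to infixl 7 _·_; _+_ to infixl 6 _⊕_)
    open SumsOver F 𝒪 using () renaming
      (∑ to ∑ᴼ; ∑-reindex to ∑ᴼ-reindex; ∑-translate to ∑ᴼ-translate; ∑-scale to ∑ᴼ-scale; ∑-single to ∑ᴼ-single)
    open import Relation.Binary.Reasoning.Setoid O.setoid

    ι-∑ : ∀ {a} {A : Set a} (xs : List A) f → ι (E.Σ xs f) ∼ O.Σ xs (λ x → ι (f x))
    ι-∑ [] f = ι-0
    ι-∑ (x ∷ xs) f = O.≈-trans (ι-+ (f x) (E.Σ xs f)) (O.+-congˡ (ι-∑ xs f))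

    reduce-Σ : ∀ {a} {A : Set a} (xs : List A) f → reduce (O.Σ xs f) ≡ Σ xs (λ x → reduce (f x))
    reduce-Σ [] f = reduce-0
    reduce-Σ (x ∷ xs) f = trans (reduce-+ (f x) (O.Σ xs f)) (cong (reduce (f x) +_) (reduce-Σ xs f))

    τ-≡ : ∀ {x y} → x ≡ y → τ x ∼ τ y
    τ-≡ eq = O.reflexive (cong τ eq)

    ι-≡ : ∀ {x y} → x ≡ y → ι x ∼ ι y
    ι-≡ eq = O.reflexive (cong ι eq)

    ∼0⇒valued : ∀ {z} → z ∼ O.0# → ∀ k → Valued k z
    ∼0⇒valued eq k = valued-≈ (O.sym eq) (valued-0# k)

    cancel-∼0 : ∀ u {z} → reduce u ≢ 0# → u · z ∼ O.0# → z ∼ O.0#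
    cancel-∼0 u πu≢0 eq = all-valued⇒≈0 (λ k → valued-cancel u πu≢0 (∼0⇒valued eq k))

    -- The element τ(0) is idempotent and has residue 0, hence lies in every power of λ.
    τ-0 : τ 0# ∼ O.0#
    τ-0 = all-valued⇒≈0 go
      where
      go : ∀ k → Valued k (τ 0#)
      go zero = valued-zero _
      go (suc k) = valued-≈ (O.≈-trans (O.sym (τ-* 0# 0#)) (τ-≡ (zeroˡ 0#)))
        (valued-* (reduce≡0⇒valued (reduce-τ 0#)) (go k))

    -- The factor τ(g) - 1 has the nonzero residue g - 1 and cancels. All vanishing sums of
    -- Teichmüller elements come from such an invariance.
    fixed⇒∼0 : ∀ {g z} → g ≢ 1# → τ g · z ∼ z → z ∼ O.0#
    fixed⇒∼0 {g} {z} g≢1 eq = cancel-∼0 (τ g O.- O.1#)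
      (λ πu≡0 → g≢1 (x-y≡0⇒x≡y (trans (sym (trans (reduce-+ (τ g) (O.- O.1#))
        (cong₂ _+_ (reduce-τ g) (trans (reduce-neg O.1#) (cong -_ reduce-1))))) πu≡0)))
      (begin
        (τ g O.- O.1#) · z ≈⟨ O.solve 2 (λ t z → (t O.:- O.con (ℤ.+ 1)) O.:* z O.:= t O.:* z O.:- z) O.≈-refl (τ g) z ⟩
        τ g · z O.- z ≈⟨ O.+-congʳ eq ⟩
        z O.- z ≈⟨ O.-‿inverseʳ z ⟩
        O.0# ∎)

    power-sum-τ : ∀ m → m ≢ 0 → m ℕ.< q-1 → ∑ᴼ (λ x → τ (pow x m)) ∼ O.0#
    power-sum-τ m m≢0 m<q-1 with non-root-of-unity m m≢0 m<q-1
    ... | g , g≢0 , g^m≢1 = fixed⇒∼0 g^m≢1 (begin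
      τ (pow g m) · ∑ᴼ (λ x → τ (pow x m)) ≈⟨ O.sym (O.Σ-*ˡ elements (τ (pow g m)) _) ⟩
      ∑ᴼ (λ x → τ (pow g m) · τ (pow x m)) ≈⟨ O.Σ-cong elements (λ x → O.≈-trans (O.sym (τ-* _ _)) (τ-≡ (sym (pow-distrib g x m)))) ⟩
      ∑ᴼ (λ x → τ (pow (g * x) m)) ≈⟨ ∑ᴼ-scale g≢0 (λ x → τ (pow x m)) ⟩
      ∑ᴼ (λ x → τ (pow x m)) ∎)

    -- The term y = 0 is included and counts 1 for m = 0. Hence φ(0) = 0 but φ(q - 1) = -1, although
    -- both exponents give the trivial character of F^×.
    φ : ℕ → O.Carrier
    φ m = ∑ᴼ (λ y → ι (ψ′ y) · τ (pow y m))

    φ-cong : ∀ m m′ → (∀ y → pow y m ≡ pow y m′) → φ m ∼ φ m′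
    φ-cong m m′ eq = O.Σ-cong elements (λ y → O.*-congˡ (τ-≡ (eq y)))

    φ-0 : φ 0 ∼ O.0#
    φ-0 = begin
      φ 0 ≈⟨ O.Σ-cong elements (λ y → O.≈-trans (O.*-congˡ τ-1) (O.*-identityʳ (ι (ψ′ y)))) ⟩
      ∑ᴼ (λ y → ι (ψ′ y)) ≈⟨ O.sym (ι-∑ elements ψ′) ⟩
      ι (∑ω.∑ ψ′) ≈⟨ ι-≡ ∑ψ≡0 ⟩
      ι 0ω ≈⟨ ι-0 ⟩
      O.0# ∎

    φ-frobenius : ∀ k m → φ (3 ℕ.^ k ℕ.* m) ∼ φ m
    φ-frobenius k m = begin
      ∑ᴼ (λ y → ι (ψ′ y) · τ (pow y (3 ℕ.^ k ℕ.* m)))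
        ≈⟨ O.Σ-cong elements (λ y → O.*-cong (ι-≡ (sym (ψ-frobenius k y))) (τ-≡ (pow-* y (3 ℕ.^ k) m))) ⟩
      ∑ᴼ (λ y → ι (ψ′ (pow y (3 ℕ.^ k))) · τ (pow (pow y (3 ℕ.^ k)) m))
        ≈⟨ ∑ᴼ-reindex (frobenius-injective k) (λ y → ι (ψ′ y) · τ (pow y m)) ⟩
      φ m ∎

    reduce-φ : ∀ m → reduce (φ m) ≡ ∑ (λ y → pow y m)
    reduce-φ m = trans (reduce-Σ elements _) (Σ-cong elements (λ y →
      trans (reduce-* (ι (ψ′ y)) (τ (pow y m))) (trans (cong₂ _*_ (trans (reduce-ι (ψ′ y)) (π-ψ y)) (reduce-τ (pow y m))) (*-identityˡ _))))

    -- This is the Gauss sum of τ^(-1). Its factor λ is what each use of `jacobi` hands on.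
    φ-q-2 : Valued 1 (φ q-2)
    φ-q-2 = reduce≡0⇒valued (trans (reduce-φ q-2) (power-sum q-2 q-2≢0 q-2<q-1))

    private
      x^m·x^q-2 : ∀ x m → m ≢ 0 → pow x (suc m) * pow x q-2 ≡ pow x m
      x^m·x^q-2 x m m≢0 = trans (sym (pow-+ x (suc m) q-2)) (trans (cong (pow x)
        (trans (sym (ℕₚ.+-suc m q-2)) (cong (m ℕ.+_) (trans (sym q-1≡) (sym (ℕₚ.*-identityˡ q-1)))))) (pow-mod x m 1 m≢0))

    -- The Jacobi sum of τ^m and τ^(-1), the latter with exponent q - 2.
    J : ℕ → O.Carrier
    J m = ∑ᴼ (λ u → τ (pow u m * pow (1# - u) q-2))

    private
      -- On the fibre x + y = t with t ≠ 0, the substitution x = t u extracts τ(t)^m. At t = 0 a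
      -- power sum of exponent m remains, which vanishes, and so does τ(0)^m.
      jacobi-fibre : ∀ m → m ≢ 0 → m ℕ.< q-1 → ∀ t →
        ∑ᴼ (λ x → τ (pow x (suc m) * pow (- x + t) q-2)) ∼ τ (pow t m) · J (suc m)
      jacobi-fibre m m≢0 m<q-1 t with t ≟ 0#
      ... | yes refl = begin
          ∑ᴼ (λ x → τ (pow x (suc m) * pow (- x + 0#) q-2))
        ≈⟨ O.Σ-cong elements (λ x → O.≈-trans (τ-≡ (degenerate x)) (τ-* _ _)) ⟩
          ∑ᴼ (λ x → τ (pow (- 1#) q-2) · τ (pow x m))
        ≈⟨ O.Σ-*ˡ elements (τ (pow (- 1#) q-2)) _ ⟩
          τ (pow (- 1#) q-2) · ∑ᴼ (λ x → τ (pow x m))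
        ≈⟨ O.*-congˡ (power-sum-τ m m≢0 m<q-1) ⟩
          τ (pow (- 1#) q-2) · O.0#
        ≈⟨ O.zeroʳ _ ⟩
          O.0#
        ≈⟨ O.sym (O.≈-trans (O.*-congʳ (O.≈-trans (τ-≡ (pow-0# m m≢0)) τ-0)) (O.zeroˡ _)) ⟩
          τ (pow 0# m) · J (suc m) ∎
        where
        degenerate : ∀ x → pow x (suc m) * pow (- x + 0#) q-2 ≡ pow (- 1#) q-2 * pow x m
        degenerate x = trans (cong (λ y → pow x (suc m) * pow y q-2) (solve 1 (λ x → :- x :+ con (ℤ.+ 0) := :- con (ℤ.+ 1) :* x) refl x))
          (trans (cong (pow x (suc m) *_) (pow-distrib (- 1#) x q-2)) (trans
            (solve 3 (λ a b c → a :* (b :* c) := b :* (a :* c)) refl (pow x (suc m)) (pow (- 1#) q-2) (pow x q-2))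
            (cong (pow (- 1#) q-2 *_) (x^m·x^q-2 x m m≢0))))
      ... | no t≢0 = begin
          ∑ᴼ (λ x → τ (pow x (suc m) * pow (- x + t) q-2))
        ≈⟨ O.sym (∑ᴼ-scale t≢0 _) ⟩
          ∑ᴼ (λ u → τ (pow (t * u) (suc m) * pow (- (t * u) + t) q-2))
        ≈⟨ O.Σ-cong elements (λ u → O.≈-trans (τ-≡ (homogeneous u)) (τ-* _ _)) ⟩
          ∑ᴼ (λ u → τ (pow t m) · τ (pow u (suc m) * pow (1# - u) q-2))
        ≈⟨ O.Σ-*ˡ elements (τ (pow t m)) _ ⟩
          τ (pow t m) · J (suc m) ∎
        where
        homogeneous : ∀ u → pow (t * u) (suc m) * pow (- (t * u) + t) q-2 ≡ pow t m * (pow u (suc m) * pow (1# - u) q-2)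
        homogeneous u = trans (cong₂ _*_ (pow-distrib t u (suc m)) (trans
            (cong (λ y → pow y q-2) (solve 2 (λ t u → :- (t :* u) :+ t := t :* (con (ℤ.+ 1) :- u)) refl t u)) (pow-distrib t (1# - u) q-2)))
          (trans (solve 4 (λ a b c d → (a :* b) :* (c :* d) := (a :* c) :* (b :* d)) refl (pow t (suc m)) (pow u (suc m)) (pow t q-2) (pow (1# - u) q-2))
            (cong (_* (pow u (suc m) * pow (1# - u) q-2)) (x^m·x^q-2 t m m≢0)))

    -- The double sum is grouped by t = x + y. The characters τ^(m+1) and τ^(-1) multiply to τ^m, so
    -- the identity links neighbouring Gauss sums.
    jacobi : ∀ m → m ≢ 0 → m ℕ.< q-1 → φ q-2 · φ (suc m) ∼ J (suc m) · φ m
    jacobi m m≢0 m<q-1 = begin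
        φ q-2 · φ (suc m)
      ≈⟨ O.*-comm (φ q-2) (φ (suc m)) ⟩
        φ (suc m) · φ q-2
      ≈⟨ O.Σ-*-Σ elements elements (λ x → ι (ψ′ x) · τ (pow x (suc m))) (λ y → ι (ψ′ y) · τ (pow y q-2)) ⟩
        ∑ᴼ (λ x → ∑ᴼ (λ y → (ι (ψ′ x) · τ (pow x (suc m))) · (ι (ψ′ y) · τ (pow y q-2))))
      ≈⟨ O.Σ-cong elements (λ x → O.≈-trans (O.Σ-cong elements (λ y → merge x y))
           (O.sym (∑ᴼ-translate (- x) (λ y → ι (ψ′ (x + y)) · τ (pow x (suc m) * pow y q-2))))) ⟩
        ∑ᴼ (λ x → ∑ᴼ (λ t → ι (ψ′ (x + (- x + t))) · τ (pow x (suc m) * pow (- x + t) q-2)))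
      ≈⟨ O.Σ-cong elements (λ x → O.Σ-cong elements (λ t → O.*-congʳ (ι-≡ (cong ψ′ (solve 2 (λ x t → x :+ (:- x :+ t) := t) refl x t))))) ⟩
        ∑ᴼ (λ x → ∑ᴼ (λ t → ι (ψ′ t) · τ (pow x (suc m) * pow (- x + t) q-2)))
      ≈⟨ O.Σ-swap elements elements _ ⟩
        ∑ᴼ (λ t → ∑ᴼ (λ x → ι (ψ′ t) · τ (pow x (suc m) * pow (- x + t) q-2)))
      ≈⟨ O.Σ-cong elements (λ t → O.≈-trans (O.Σ-*ˡ elements (ι (ψ′ t)) _) (O.≈-trans (O.*-congˡ (jacobi-fibre m m≢0 m<q-1 t))
           (O.solve 3 (λ a b c → a O.:* (b O.:* c) O.:= c O.:* (a O.:* b)) O.≈-refl (ι (ψ′ t)) (τ (pow t m)) (J (suc m))))) ⟩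
        ∑ᴼ (λ t → J (suc m) · (ι (ψ′ t) · τ (pow t m)))
      ≈⟨ O.Σ-*ˡ elements (J (suc m)) _ ⟩
        J (suc m) · φ m ∎
      where
      merge : ∀ x y → (ι (ψ′ x) · τ (pow x (suc m))) · (ι (ψ′ y) · τ (pow y q-2)) ∼ ι (ψ′ (x + y)) · τ (pow x (suc m) * pow y q-2)
      merge x y = O.≈-trans (O.solve 4 (λ a b c d → (a O.:* b) O.:* (c O.:* d) O.:= (a O.:* c) O.:* (b O.:* d)) O.≈-refl (ι (ψ′ x)) (τ (pow x (suc m))) (ι (ψ′ y)) (τ (pow y q-2)))
        (O.*-cong (O.≈-trans (O.sym (ι-* (ψ′ x) (ψ′ y))) (ι-≡ (sym (ψ-+ x y)))) (O.sym (τ-* _ _)))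

    private
      power-sum′ : ∀ m → m ℕ.< q-1 → ∑ (λ x → pow x m) ≡ 0#
      power-sum′ zero _ = trans (Σ-const elements 1#) (trans (*-identityʳ _) (trans (cong _ᴺ (trans order≡3^n (sym q≡))) order·1≡0))
      power-sum′ (suc m) = power-sum (suc m) (λ ())

      -- The factor (1 - u)^(q-1) is 1 except at u = 1, where it is 0. It removes the term 1 from a
      -- vanishing power sum.
      punctured : ∀ m → m ℕ.< q-1 → ∑ (λ u → pow u m * pow (1# - u) q-1) ≡ - 1#
      punctured m m<q-1 = trans (solve 2 (λ a b → b := a :- (a :- b)) refl (∑ (λ u → pow u m)) (∑ (λ u → pow u m * pow (1# - u) q-1)))
        (trans (cong₂ _-_ (power-sum′ m m<q-1) (trans (sym (Σ-- elements (λ u → pow u m) _)) (trans (∑-single 1# _ away)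
          (trans (cong₂ _-_ (pow-1# m) (trans (cong (pow 1# m *_) (trans (cong (λ y → pow y q-1) (-‿inverseʳ 1#))
            (trans (cong (pow 0#) q-1≡) (zeroˡ _)))) (zeroʳ _))) (trans (cong (1# +_) -0#≈0#) (+-identityʳ 1#)))))) (+-identityˡ _))
        where
        away : ∀ u → u ≢ 1# → pow u m - pow u m * pow (1# - u) q-1 ≡ 0#
        away u u≢1 = trans (cong (λ y → pow u m - pow u m * y) (fermat (λ eq → u≢1 (sym (x-y≡0⇒x≡y eq)))))
          (solve 1 (λ a → a :- a :* con (ℤ.+ 1) := con (ℤ.+ 0)) refl (pow u m))

      -- Since u = 1 - (1 - u), passing from m to m + 1 subtracts the sum of u^m (1 - u)^(q-1),
      -- which is -1.
      jacobi-sum : ∀ m → m ℕ.≤ q-1 → ∑ (λ u → pow u m * pow (1# - u) q-2) ≡ m ᴺ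
      jacobi-sum zero _ = trans (Σ-cong elements (λ u → *-identityˡ _)) (trans (∑-reflect 1# (λ u → pow u q-2)) (power-sum q-2 q-2≢0 q-2<q-1))
      jacobi-sum (suc m) m<q-1 = trans
        (trans (Σ-cong elements (λ u → trans (solve 3 (λ u a b → (u :* a) :* b := a :* b :- a :* ((con (ℤ.+ 1) :- u) :* b)) refl u (pow u m) (pow (1# - u) q-2))
          (cong (λ k → pow u m * pow (1# - u) q-2 - pow u m * pow (1# - u) k) (sym q-1≡))))
          (trans (Σ-- elements (λ u → pow u m * pow (1# - u) q-2) _) (cong₂ _-_ (jacobi-sum m (ℕₚ.<⇒≤ m<q-1)) (punctured m m<q-1))))
        (trans (solve 1 (λ a → a :- (:- con (ℤ.+ 1)) := con (ℤ.+ 1) :+ a) refl (m ᴺ)) (sym (ᴺ-suc m)))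

    reduce-J : ∀ m → m ℕ.≤ q-1 → reduce (J m) ≡ m ᴺ
    reduce-J m m≤q-1 = trans (reduce-Σ elements _) (trans (Σ-cong elements (λ u → reduce-τ _)) (jacobi-sum m m≤q-1))

    -- The Jacobi sum J(m + 1) has residue m + 1. When this is not 0 it cancels in `jacobi`, and
    -- φ(m) has one more factor λ than φ(m + 1).
    φ-step : ∀ {k} m → m ≢ 0 → m ℕ.< q-1 → suc m ᴺ ≢ 0# → Valued k (φ (suc m)) → Valued (suc k) (φ m)
    φ-step m m≢0 m<q-1 m+1≢0 p = valued-cancel (J (suc m)) (λ eq → m+1≢0 (trans (sym (reduce-J (suc m) m<q-1)) eq))
      (valued-≈ (jacobi m m≢0 m<q-1) (valued-* φ-q-2 p))

    -- Rotation of the n ternary digits is multiplication of the exponent by a power of 3 modulo q -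
    -- 1, and Frobenius preserves ψ.
    φ-rotate : ∀ u w → length u ℕ.+ length w ≡ n → φ (val (u ++ w)) ∼ φ (val (w ++ u))
    φ-rotate u w len = O.≈-trans (O.sym (φ-frobenius (length w) (val (u ++ w)))) (φ-cong (3 ℕ.^ length w ℕ.* val (u ++ w)) (val (w ++ u)) λ y →
      trans (cong (pow y) exponents) (trans (pow-+ y (3 ℕ.^ length w ℕ.* val u) (q ℕ.* val w))
        (trans (cong (pow y (3 ℕ.^ length w ℕ.* val u) *_) (trans (pow-* y q (val w)) (cong (λ z → pow z (val w)) (pow-3^n y))))
          (trans (*-comm _ _) (trans (sym (pow-+ y (val w) _)) (cong (pow y) (sym (val-++ w u))))))))
      where
      exponents : 3 ℕ.^ length w ℕ.* val (u ++ w) ≡ 3 ℕ.^ length w ℕ.* val u ℕ.+ q ℕ.* val w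
      exponents = trans (cong (3 ℕ.^ length w ℕ.*_) (val-++ u w)) (trans (rearrange (3 ℕ.^ length w) (val u) (3 ℕ.^ length u) (val w))
        (cong (λ k → 3 ℕ.^ length w ℕ.* val u ℕ.+ k ℕ.* val w) (trans (sym (ℕₚ.^-distribˡ-+-* 3 (length u) (length w))) (cong (3 ℕ.^_) len))))
        where
        rearrange : ∀ a b c d → a ℕ.* (b ℕ.+ c ℕ.* d) ≡ a ℕ.* b ℕ.+ c ℕ.* a ℕ.* d
        rearrange = ℕ-Solver.solve-∀

    private
      digit-unit : ∀ (x : Fin 2) k → (toℕ (suc x) ℕ.+ 3 ℕ.* k) ᴺ ≢ 0#
      digit-unit x k eq = unit x (trans (sym (trans (ᴺ-+ (toℕ (suc x)) (3 ℕ.* k)) (trans (cong (toℕ (suc x) ᴺ +_) (ᴺ-* 3 k)) (+3*≡ _ (k ᴺ))))) eq)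
        where
        unit : ∀ (x : Fin 2) → toℕ (suc x) ᴺ ≢ 0#
        unit 0F eq = 1≢0 eq
        unit 1F eq = 1≢0 (trans (sym (+-identityˡ 1#)) (trans (cong (_+ 1#) (sym eq)) 3≡0))

      valued-rotated : ∀ {k} u (x : Fin 2) w → length u ℕ.+ length (inject₁ x ∷ w) ≡ n →
        Valued k (φ (val (suc x ∷ w ++ u))) → Valued (suc k) (φ (val (u ++ inject₁ x ∷ w)))
      valued-rotated {k} u x w len p = valued-≈ (O.sym (φ-rotate u (inject₁ x ∷ w) len)) (subst (λ d → Valued (suc k) (φ (d ℕ.+ r))) (sym (Finₚ.toℕ-inject₁ x)) shifted)
        where
        r = 3 ℕ.* val (w ++ u)
        bound : suc (toℕ x ℕ.+ r) ℕ.< suc q-1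
        bound = ℕₚ.≤-trans (val-bound (suc x ∷ w ++ u)) (ℕₚ.≤-reflexive (trans (cong (3 ℕ.^_)
          (trans (cong suc (trans (length-++ w) (ℕₚ.+-comm (length w) (length u)))) (trans (sym (ℕₚ.+-suc (length u) (length w))) len))) (sym q≡)))
        shifted : Valued (suc k) (φ (toℕ x ℕ.+ r))
        shifted with toℕ x ℕ.+ r ℕ.≟ 0
        -- The Jacobi identity excludes the exponent 0, but there φ vanishes.
        ... | yes eq = ∼0⇒valued (O.≈-trans (O.reflexive (cong φ eq)) φ-0) (suc k)
        ... | no ne = φ-step (toℕ x ℕ.+ r) ne (ℕₚ.≤-pred bound) (digit-unit x (val (w ++ u))) p

    -- A digit below 2 is rotated to the lowest place and raised by one. This never carries and
    -- leaves an exponent prime to 3, so `φ-step` applies: the deficit drops by one in exchange for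
    -- one factor λ. With all digits equal to 2 nothing is left to show.
    φ-valued : ∀ k v → length v ≡ n → deficit v ≡ k → Valued k (φ (val v))
    φ-valued zero v len eq = valued-zero _
    φ-valued (suc k) v len eq with non-maximal-digit v (λ eq′ → ℕₚ.0≢1+n (trans (sym eq′) eq))
    ... | u , x , w , refl = valued-rotated u x w (trans (sym (length-++ u)) len)
        (φ-valued k (suc x ∷ w ++ u) (trans (cong suc (trans (length-++ w) (ℕₚ.+-comm (length w) (length u))))
          (trans (sym (ℕₚ.+-suc (length u) (length w))) (trans (sym (length-++ u)) len)))
        (ℕₚ.suc-injective (trans (sym (trans (deficit-++ u (inject₁ x ∷ w)) (trans (digit x (deficit u) (deficit w))
           (cong (λ d → suc (codigit (suc x) ℕ.+ d)) (sym (deficit-++ w u)))))) eq)))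
      where
      rearrange : ∀ c u w → u ℕ.+ (suc c ℕ.+ w) ≡ suc (c ℕ.+ (w ℕ.+ u))
      rearrange = ℕ-Solver.solve-∀
      digit : ∀ (x : Fin 2) u w → u ℕ.+ (codigit (inject₁ x) ℕ.+ w) ≡ suc (codigit (suc x) ℕ.+ (w ℕ.+ u))
      digit 0F = rearrange 1
      digit 1F = rearrange 0

    -- The terms of φ(0) and φ(q - 1) agree except at y = 0, where they are 1 and 0.
    φ-top : φ q-1 ∼ O.- O.1#
    φ-top = begin
        φ q-1
      ≈⟨ O.solve 2 (λ a b → a O.:= b O.:- (b O.:- a)) O.≈-refl (φ q-1) (φ 0) ⟩
        φ 0 O.- (φ 0 O.- φ q-1)
      ≈⟨ O.+-cong φ-0 (O.-‿cong (O.≈-trans (O.sym (O.Σ-- elements (λ y → ι (ψ′ y) · τ (pow y 0)) _)) (∑ᴼ-single 0# _ away))) ⟩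
        O.0# O.- (ι (ψ′ 0#) · τ 1# O.- ι (ψ′ 0#) · τ (pow 0# q-1))
      ≈⟨ O.+-congˡ (O.-‿cong (O.+-cong (O.≈-trans (O.*-cong (O.≈-trans (ι-≡ ψ-0#) ι-1) τ-1) (O.*-identityˡ O.1#))
           (O.-‿cong (O.≈-trans (O.*-congˡ (O.≈-trans (τ-≡ (trans (cong (pow 0#) q-1≡) (zeroˡ _))) τ-0)) (O.zeroʳ _))))) ⟩
        O.0# O.- (O.1# O.- O.0#)
      ≈⟨ O.solve 0 (O.con (ℤ.+ 0) O.:- (O.con (ℤ.+ 1) O.:- O.con (ℤ.+ 0)) O.:= O.:- O.con (ℤ.+ 1)) O.≈-refl ⟩
        O.- O.1# ∎
      where
      away : ∀ y → y ≢ 0# → ι (ψ′ y) · τ 1# O.- ι (ψ′ y) · τ (pow y q-1) ∼ O.0#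
      away y y≢0 = O.≈-trans (O.+-congˡ (O.-‿cong (O.*-congˡ {ι (ψ′ y)} (τ-≡ (fermat y≢0))))) (O.-‿inverseʳ (ι (ψ′ y) · τ 1#))

    private
      geometric : ∀ N u → (τ u O.- O.1#) · O.Σ (downFrom N) (λ i → τ (pow u i)) ∼ τ (pow u N) O.- O.1#
      geometric zero u = O.≈-trans (O.zeroʳ _) (O.sym (O.≈-trans (O.+-congʳ τ-1) (O.-‿inverseʳ O.1#)))
      geometric (suc N) u = begin
        (τ u O.- O.1#) · (τ (pow u N) ⊕ S) ≈⟨ O.distribˡ _ _ _ ⟩
        (τ u O.- O.1#) · τ (pow u N) ⊕ (τ u O.- O.1#) · S ≈⟨ O.+-congˡ (geometric N u) ⟩
        (τ u O.- O.1#) · τ (pow u N) ⊕ (τ (pow u N) O.- O.1#)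
          ≈⟨ O.solve 2 (λ a b → (a O.:- O.con (ℤ.+ 1)) O.:* b O.:+ (b O.:- O.con (ℤ.+ 1)) O.:= a O.:* b O.:- O.con (ℤ.+ 1)) O.≈-refl (τ u) (τ (pow u N)) ⟩
        τ u · τ (pow u N) O.- O.1# ≈⟨ O.+-congʳ (O.sym (τ-* u (pow u N))) ⟩
        τ (u * pow u N) O.- O.1# ∎
        where S = O.Σ (downFrom N) (λ i → τ (pow u i))

      geometric-1 : ∀ N → O.Σ (downFrom N) (λ i → τ (pow 1# i)) ∼ ι (N E.ᴺ)
      geometric-1 zero = O.sym ι-0
      geometric-1 (suc N) = O.≈-trans (O.+-cong (O.≈-trans (τ-≡ (pow-1# N)) (O.≈-trans τ-1 (O.sym ι-1))) (geometric-1 N)) (O.≈-trans (O.sym (ι-+ E.1# (N E.ᴺ))) (ι-≡ (sym (E.ᴺ-suc N))))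

      geometric-≢1 : ∀ {u} → u ≢ 0# → u ≢ 1# → O.Σ (downFrom q-1) (λ i → τ (pow u i)) ∼ O.0#
      geometric-≢1 {u} u≢0 u≢1 = fixed⇒∼0 u≢1 (begin
        τ u · S ≈⟨ O.solve 2 (λ t s → t O.:* s O.:= (t O.:- O.con (ℤ.+ 1)) O.:* s O.:+ s) O.≈-refl (τ u) S ⟩
        (τ u O.- O.1#) · S ⊕ S ≈⟨ O.+-congʳ (geometric q-1 u) ⟩
        (τ (pow u q-1) O.- O.1#) ⊕ S ≈⟨ O.+-congʳ (O.≈-trans (O.+-congʳ (O.≈-trans (τ-≡ (fermat u≢0)) τ-1)) (O.-‿inverseʳ O.1#)) ⟩
        O.0# ⊕ S ≈⟨ O.+-identityˡ S ⟩
        S ∎)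
        where S = O.Σ (downFrom q-1) (λ i → τ (pow u i))

      i<N : ∀ {N i} → i ∈ downFrom N → i ℕ.< N
      i<N = ∈-downFrom⁻

    π-ᴺ : ∀ k → π (k E.ᴺ) ≡ k ᴺ
    π-ᴺ zero = trans (π-≡ (ℤ.+ 0) (ℤ.+ 0)) (+-identityˡ 0#)
    π-ᴺ (suc k) = trans (cong π (E.ᴺ-suc k)) (trans (π-+ E.1# (k E.ᴺ)) (trans (cong₂ _+_ π-1 (π-ᴺ k)) (sym (ᴺ-suc k))))

    q-1ω : ℤω
    q-1ω = q-1 E.ᴺ

    -- The Fourier expansion of (q - 1)ψ over the characters τ^i of F^×. The coefficient of τ^i is
    -- the Gauss sum of τ^(-i), with exponent q - 1 - i; for i = 0 this is φ(q - 1), not φ(0).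
    expansion : X → O.Carrier
    expansion x = O.Σ (downFrom q-1) (λ i → φ (q-1 ℕ.∸ i) · τ (pow x i))

    ψ-expansion : ∀ {x} → x ≢ 0# → expansion x ∼ ι q-1ω · ι (ψ′ x)
    ψ-expansion {x} x≢0 = begin
        O.Σ (downFrom q-1) (λ i → φ (q-1 ℕ.∸ i) · τ (pow x i))
      ≈⟨ O.Σ-cong (downFrom q-1) (λ i → O.≈-trans (O.sym (O.Σ-*ʳ elements (τ (pow x i)) _)) (O.Σ-cong elements (λ y →
           O.≈-trans (O.*-assoc (ι (ψ′ y)) _ _) (O.*-congˡ (O.sym (τ-* _ _)))))) ⟩
        O.Σ (downFrom q-1) (λ i → ∑ᴼ (λ y → ι (ψ′ y) · τ (pow y (q-1 ℕ.∸ i) * pow x i)))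
      ≈⟨ O.Σ-swap (downFrom q-1) elements _ ⟩
        ∑ᴼ (λ y → O.Σ (downFrom q-1) (λ i → ι (ψ′ y) · τ (pow y (q-1 ℕ.∸ i) * pow x i)))
      ≈⟨ O.Σ-cong elements (λ y → O.Σ-*ˡ (downFrom q-1) (ι (ψ′ y)) _) ⟩
        ∑ᴼ (λ y → ι (ψ′ y) · O.Σ (downFrom q-1) (λ i → τ (pow y (q-1 ℕ.∸ i) * pow x i)))
      ≈⟨ ∑ᴼ-single x _ (λ y y≢x → O.≈-trans (O.*-congˡ (away y y≢x)) (O.zeroʳ _)) ⟩
        ι (ψ′ x) · O.Σ (downFrom q-1) (λ i → τ (pow x (q-1 ℕ.∸ i) * pow x i))
      ≈⟨ O.*-congˡ (O.≈-trans (O.Σ-cong-∈ (downFrom q-1) (λ {i} i∈ → τ-≡ (trans (sym (pow-+ x (q-1 ℕ.∸ i) i))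
           (trans (cong (pow x) (ℕₚ.m∸n+n≡m (ℕₚ.<⇒≤ (i<N i∈)))) (trans (fermat x≢0) (sym (pow-1# i))))))) (geometric-1 q-1)) ⟩
        ι (ψ′ x) · ι q-1ω
      ≈⟨ O.*-comm (ι (ψ′ x)) (ι q-1ω) ⟩
        ι q-1ω · ι (ψ′ x) ∎
      where
      away : ∀ y → y ≢ x → O.Σ (downFrom q-1) (λ i → τ (pow y (q-1 ℕ.∸ i) * pow x i)) ∼ O.0#
      away y y≢x with y ≟ 0#
      ... | yes refl = O.Σ-zero (downFrom q-1) (λ {i} i∈ → O.≈-trans (τ-≡ (trans (cong (_* pow x i) (pow-0# (q-1 ℕ.∸ i) (ℕₚ.m>n⇒m∸n≢0 (i<N i∈)))) (zeroˡ _))) τ-0)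
      ... | no y≢0 = O.≈-trans (O.Σ-cong-∈ (downFrom q-1) (λ {i} i∈ → τ-≡ (as-power i i∈)))
          (geometric-≢1 (*-≢0 (pow-≢0 q-2 y≢0) x≢0) (λ eq → y≢x (*-cancelˡ (pow-≢0 q-2 y≢0) (trans (*-comm _ y) (trans (inv-inverse y≢0) (sym eq))))))
        where
        as-power : ∀ i → i ∈ downFrom q-1 → pow y (q-1 ℕ.∸ i) * pow x i ≡ pow (inv y * x) i
        as-power i i∈ = trans (cong (_* pow x i) (*-cancelˡ (pow-≢0 i y≢0) (trans (trans (*-comm _ _) (trans (sym (pow-+ y (q-1 ℕ.∸ i) i))
            (trans (cong (pow y) (ℕₚ.m∸n+n≡m (ℕₚ.<⇒≤ (i<N i∈)))) (fermat y≢0))))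
            (sym (trans (sym (pow-distrib y (inv y) i)) (trans (cong (λ z → pow z i) (inv-inverse y≢0)) (pow-1# i)))))))
          (sym (pow-distrib (inv y) x i))

    private
      expansion-0 : expansion 0# ∼ O.- O.1#
      expansion-0 = O.≈-trans (go q-1 q-1≡) (O.≈-trans (O.≈-trans (O.*-congˡ τ-1) (O.*-identityʳ (φ q-1))) φ-top)
        where
        go : ∀ N {p} → N ≡ suc p → O.Σ (downFrom N) (λ i → φ (q-1 ℕ.∸ i) · τ (pow 0# i)) ∼ φ q-1 · τ 1#
        go (suc zero) _ = O.+-identityʳ _
        go (suc (suc N)) _ = O.≈-trans (O.+-cong (O.≈-trans (O.*-congˡ (O.≈-trans (τ-≡ (zeroˡ _)) τ-0)) (O.zeroʳ _)) (go (suc N) refl)) (O.+-identityˡ _)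

      valued-q : ∀ k → Valued k (ι ((3 ℕ.^ k) E.ᴺ))
      valued-q zero = valued-zero _
      valued-q (suc k) = valued-≈ (O.≈-trans (O.sym (ι-* (3 E.ᴺ) ((3 ℕ.^ k) E.ᴺ))) (ι-≡ (sym (E.ᴺ-* 3 (3 ℕ.^ k)))))
        (valued-* (reduce≡0⇒valued (trans (reduce-ι (3 E.ᴺ)) (trans (π-ᴺ 3) 3≡0))) (valued-q k))

    module _ (d : ℕ) (d≢0 : d ≢ 0)
      (paired : ∀ i → i ≢ 0 → i ℕ.< q-1 → Valued n (φ (q-1 ℕ.∸ i) · φ (d ℕ.* i))) where

      private
        valued-Σ : ∀ {a} {A : Set a} {k} (xs : List A) (f : A → O.Carrier) → (∀ {x} → x ∈ xs → Valued k (f x)) → Valued k (O.Σ xs f)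
        valued-Σ [] f p = valued-0# _
        valued-Σ (x ∷ xs) f p = valued-+ (p (here refl)) (valued-Σ xs f (λ x∈ → p (there x∈)))

        module _ (a : X) (a≢0 : a ≢ 0#) where
          c : X
          c = - inv a

          -- The substitution x = c y with c = -1/a turns -a x into y, so a only enters through the
          -- factor τ(c)^(d i).
          twisted : ∀ i → ∑ᴼ (λ x → τ (pow (pow x d) i) · ι (ψ′ (- (a * x)))) ∼ τ (pow c (d ℕ.* i)) · φ (d ℕ.* i)
          twisted i = begin
              ∑ᴼ (λ x → τ (pow (pow x d) i) · ι (ψ′ (- (a * x))))
            ≈⟨ O.sym (∑ᴼ-scale c≢0 _) ⟩
              ∑ᴼ (λ y → τ (pow (pow (c * y) d) i) · ι (ψ′ (- (a * (c * y)))))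
            ≈⟨ O.Σ-cong elements (λ y → O.≈-trans (O.*-cong (O.≈-trans (τ-≡ (trans (sym (pow-* (c * y) d i)) (pow-distrib c y (d ℕ.* i)))) (τ-* _ _)) (ι-≡ (cong ψ′ (unscale y))))
                 (O.solve 3 (λ a b c → (a O.:* b) O.:* c O.:= a O.:* (c O.:* b)) O.≈-refl (τ (pow c (d ℕ.* i))) (τ (pow y (d ℕ.* i))) (ι (ψ′ y)))) ⟩
              ∑ᴼ (λ y → τ (pow c (d ℕ.* i)) · (ι (ψ′ y) · τ (pow y (d ℕ.* i))))
            ≈⟨ O.Σ-*ˡ elements (τ (pow c (d ℕ.* i))) _ ⟩
              τ (pow c (d ℕ.* i)) · φ (d ℕ.* i) ∎
            where
            c≢0 : c ≢ 0#
            c≢0 eq = pow-≢0 q-2 a≢0 (trans (sym (-‿involutive _)) (trans (cong -_ eq) -0#≈0#))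
            unscale : ∀ y → - (a * (c * y)) ≡ y
            unscale y = trans (solve 3 (λ a b y → :- (a :* (:- b :* y)) := (a :* b) :* y) refl a (inv a) y) (trans (cong (_* y) (inv-inverse a≢0)) (*-identityˡ y))

          -- The expansion represents (q - 1)ψ on F^× only. At 0 it gives -1 instead of q - 1, and
          -- the difference q is itself divisible by λ^n.
          error : X → O.Carrier
          error x = ι q-1ω · ι (ψ′ (pow x d)) O.- expansion (pow x d)

          error-0 : error 0# ∼ ι (q E.ᴺ)
          error-0 = begin
              error 0#
            ≈⟨ O.+-cong (O.*-congˡ (O.≈-trans (ι-≡ (trans (cong ψ′ (pow-0# d d≢0)) ψ-0#)) ι-1))
                 (O.-‿cong (O.≈-trans (O.reflexive (cong expansion (pow-0# d d≢0))) expansion-0)) ⟩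
              ι q-1ω · O.1# O.- (O.- O.1#)
            ≈⟨ O.solve 1 (λ q → q O.:* O.con (ℤ.+ 1) O.:- (O.:- O.con (ℤ.+ 1)) O.:= O.con (ℤ.+ 1) O.:+ q) O.≈-refl (ι q-1ω) ⟩
              O.1# ⊕ ι q-1ω
            ≈⟨ O.≈-trans (O.≈-trans (O.+-congʳ (O.sym ι-1)) (O.sym (ι-+ E.1# q-1ω))) (ι-≡ (trans (sym (E.ᴺ-suc q-1)) (cong E._ᴺ q≡))) ⟩
              ι (q E.ᴺ) ∎

          -- Only ψ(x^d) is expanded. Summed against ψ(-a x), each power τ(x)^(d i) yields a second
          -- Gauss sum, so W becomes a sum of products of two Gauss sums.
          scaled-W : ι q-1ω · ι (W F n d a) ∼ ι (q E.ᴺ) ⊕ O.Σ (downFrom q-1) (λ i → φ (q-1 ℕ.∸ i) · (τ (pow c (d ℕ.* i)) · φ (d ℕ.* i)))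
          scaled-W = begin
              ι q-1ω · ι (W F n d a)
            ≈⟨ O.*-congˡ (ι-∑ elements (λ x → ψ′ (pow x d + - (a * x)))) ⟩
              ι q-1ω · ∑ᴼ (λ x → ι (ψ′ (pow x d + - (a * x))))
            ≈⟨ O.sym (O.Σ-*ˡ elements (ι q-1ω) _) ⟩
              ∑ᴼ (λ x → ι q-1ω · ι (ψ′ (pow x d + - (a * x))))
            ≈⟨ O.Σ-cong elements (λ x → O.≈-trans (O.*-congˡ (O.≈-trans (ι-≡ (ψ-+ _ _)) (ι-* _ _)))
                 (O.solve 4 (λ q p e s → q O.:* (p O.:* s) O.:= (q O.:* p O.:- e) O.:* s O.:+ e O.:* s) O.≈-refl (ι q-1ω) (ι (ψ′ (pow x d))) (expansion (pow x d)) (ι (ψ′ (- (a * x)))))) ⟩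
              ∑ᴼ (λ x → error x · ι (ψ′ (- (a * x))) ⊕ expansion (pow x d) · ι (ψ′ (- (a * x))))
            ≈⟨ O.Σ-+ elements _ _ ⟩
              ∑ᴼ (λ x → error x · ι (ψ′ (- (a * x)))) ⊕ ∑ᴼ (λ x → expansion (pow x d) · ι (ψ′ (- (a * x))))
            ≈⟨ O.+-cong (O.≈-trans (∑ᴼ-single 0# _ (λ x x≢0 → O.≈-trans (O.*-congʳ (no-error x≢0)) (O.zeroˡ _)))
                 (O.≈-trans (O.*-cong error-0 (O.≈-trans (ι-≡ (trans (cong ψ′ (trans (cong -_ (zeroʳ a)) -0#≈0#)) ψ-0#)) ι-1)) (O.*-identityʳ (ι (q E.ᴺ)))))
               (O.≈-trans (O.Σ-cong elements (λ x → O.≈-trans (O.sym (O.Σ-*ʳ (downFrom q-1) (ι (ψ′ (- (a * x)))) _))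
                 (O.Σ-cong (downFrom q-1) (λ i → O.*-assoc (φ (q-1 ℕ.∸ i)) _ _)))) (O.Σ-swap elements (downFrom q-1) _)) ⟩
              ι (q E.ᴺ) ⊕ O.Σ (downFrom q-1) (λ i → ∑ᴼ (λ x → φ (q-1 ℕ.∸ i) · (τ (pow (pow x d) i) · ι (ψ′ (- (a * x))))))
            ≈⟨ O.+-congˡ (O.Σ-cong (downFrom q-1) (λ i → O.≈-trans (O.Σ-*ˡ elements (φ (q-1 ℕ.∸ i)) _) (O.*-congˡ (twisted i)))) ⟩
              ι (q E.ᴺ) ⊕ O.Σ (downFrom q-1) (λ i → φ (q-1 ℕ.∸ i) · (τ (pow c (d ℕ.* i)) · φ (d ℕ.* i))) ∎
            where
            no-error : ∀ {x} → x ≢ 0# → error x ∼ O.0#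
            no-error {x} x≢0 = O.≈-trans (O.+-congˡ (O.-‿cong (ψ-expansion (pow-≢0 d x≢0)))) (O.-‿inverseʳ _)

          term-valued : ∀ i → i ℕ.< q-1 → Valued n (φ (q-1 ℕ.∸ i) · (τ (pow c (d ℕ.* i)) · φ (d ℕ.* i)))
          term-valued i i<q-1 with i ℕ.≟ 0
          ... | yes refl = ∼0⇒valued (O.≈-trans (O.*-congˡ (O.≈-trans (O.*-congˡ (O.≈-trans (O.reflexive (cong φ (ℕₚ.*-zeroʳ d))) φ-0)) (O.zeroʳ _))) (O.zeroʳ _)) n
          ... | no i≢0 = valued-≈ (O.solve 3 (λ t a b → t O.:* (a O.:* b) O.:= a O.:* (t O.:* b)) O.≈-refl (τ (pow c (d ℕ.* i))) (φ (q-1 ℕ.∸ i)) (φ (d ℕ.* i)))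
              (valued-* (valued-zero (τ (pow c (d ℕ.* i)))) (paired i i≢0 i<q-1))

      λ^n∣W : ∀ a → a ≢ 0# → λ^ n ∣ W F n d a
      -- The factor q - 1 has residue -1 and cancels.
      λ^n∣W a a≢0 = valued-ι (valued-cancel (ι q-1ω) (λ eq → 1≢0 (unit (trans (sym (trans (reduce-ι q-1ω) (π-ᴺ q-1))) eq)))
          (valued-≈ (O.sym (scaled-W a a≢0)) (valued-+ (valued-q n) (valued-Σ (downFrom q-1) _ (λ i∈ → term-valued a a≢0 _ (i<N i∈))))))
        where
        unit : q-1 ᴺ ≡ 0# → 1# ≡ 0#
        unit eq = trans (sym (+-identityʳ 1#)) (trans (cong (1# +_) (sym eq)) (trans (sym (ᴺ-suc q-1)) order·1≡0))

-- Digit sums and carries for L i + 2 i modulo 3^n - 1.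

module TernaryCarries where
  open GaussSumValuations using (val; val-++; val-bound; codigit; deficit)
  open import Data.Fin using (fromℕ<)
  open import Data.List using (applyUpTo)
  open import Data.List.Properties using (length-applyUpTo)
  open import Data.Nat using (_+_; _*_; _∸_; _^_; _≤_; _<_; _≤?_; _≟_; >-nonZero; >-nonZero⁻¹; pred)
  open import Data.Nat.DivMod using (_/_; _%_; _mod_; m≡m%n+[m/n]*n; m%n<n; m<n⇒m%n≡m; [m+n]%n≡m%n; m<n*o⇒m/o<n)
  open import Data.Nat.Properties
  open import Data.Nat.Tactic.RingSolver using (solve-∀)
  open import Function using (_∘_)
  open import Relation.Binary.PropositionalEquality using (refl; sym; trans; subst₂)
  open import Relation.Nullary.Decidable using (from-yes)

  -- Digits are sequences on ℕ, so that for periodic ones a rotation is a shift of the index. `Val`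
  -- admits digits above 2, as they occur before carrying.
  Sum Val : (ℕ → ℕ) → ℕ → ℕ
  Sum f zero = 0
  Sum f (suc n) = f 0 + Sum (f ∘ suc) n
  Val f zero = 0
  Val f (suc n) = f 0 + 3 * Val (f ∘ suc) n

  Sum-cong : ∀ {f g} n → (∀ s → f s ≡ g s) → Sum f n ≡ Sum g n
  Sum-cong zero eq = refl
  Sum-cong (suc n) eq = cong₂ _+_ (eq 0) (Sum-cong n (eq ∘ suc))

  Sum-mono : ∀ {f g} n → (∀ s → f s ≤ g s) → Sum f n ≤ Sum g n
  Sum-mono zero le = z≤n
  Sum-mono (suc n) le = +-mono-≤ (le 0) (Sum-mono n (le ∘ suc))

  Sum-+ : ∀ f g n → Sum (λ s → f s + g s) n ≡ Sum f n + Sum g n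
  Sum-+ f g zero = refl
  Sum-+ f g (suc n) = trans (cong (f 0 + g 0 +_) (Sum-+ (f ∘ suc) (g ∘ suc) n)) (rearrange (f 0) (g 0) _ _)
    where
    rearrange : ∀ a b c d → (a + b) + (c + d) ≡ (a + c) + (b + d)
    rearrange = solve-∀

  Sum-* : ∀ k f n → Sum (λ s → k * f s) n ≡ k * Sum f n
  Sum-* k f zero = sym (*-zeroʳ k)
  Sum-* k f (suc n) = trans (cong (k * f 0 +_) (Sum-* k (f ∘ suc) n)) (sym (*-distribˡ-+ k _ _))

  Sum-1 : ∀ n → Sum (λ _ → 1) n ≡ n
  Sum-1 zero = refl
  Sum-1 (suc n) = cong suc (Sum-1 n)

  Sum-last : ∀ f n → Sum f (suc n) ≡ Sum f n + f n
  Sum-last f zero = +-identityʳ _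
  Sum-last f (suc n) = trans (cong (f 0 +_) (Sum-last (f ∘ suc) n)) (sym (+-assoc (f 0) _ _))

  Val-cong : ∀ {f g} n → (∀ s → s < n → f s ≡ g s) → Val f n ≡ Val g n
  Val-cong zero eq = refl
  Val-cong (suc n) eq = cong₂ (λ a b → a + 3 * b) (eq 0 (s≤s z≤n)) (Val-cong n (λ s s<n → eq (suc s) (s≤s s<n)))

  Val-+ : ∀ f g n → Val (λ s → f s + g s) n ≡ Val f n + Val g n
  Val-+ f g zero = refl
  Val-+ f g (suc n) = trans (cong (λ v → f 0 + g 0 + 3 * v) (Val-+ (f ∘ suc) (g ∘ suc) n)) (rearrange (f 0) (g 0) (Val (f ∘ suc) n) (Val (g ∘ suc) n))
    where
    rearrange : ∀ a b c d → (a + b) + 3 * (c + d) ≡ (a + 3 * c) + (b + 3 * d)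
    rearrange = solve-∀

  Val-2* : ∀ f n → Val (λ s → 2 * f s) n ≡ 2 * Val f n
  Val-2* f zero = refl
  Val-2* f (suc n) = trans (cong (λ v → 2 * f 0 + 3 * v) (Val-2* (f ∘ suc) n)) (rearrange (f 0) (Val (f ∘ suc) n))
    where
    rearrange : ∀ a b → 2 * a + 3 * (2 * b) ≡ 2 * (a + 3 * b)
    rearrange = solve-∀

  Val-last : ∀ f n → Val f (suc n) ≡ Val f n + f n * 3 ^ n
  Val-last f zero = trans (+-identityʳ _) (sym (*-identityʳ _))
  Val-last f (suc n) = trans (cong (λ v → f 0 + 3 * v) (Val-last (f ∘ suc) n)) (rearrange (f 0) (Val (f ∘ suc) n) (f (suc n)) (3 ^ n))
    where
    rearrange : ∀ a b c d → a + 3 * (b + c * d) ≡ (a + 3 * b) + c * (3 * d)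
    rearrange = solve-∀

  Periodic : ∀ {a} {A : Set a} → ℕ → (ℕ → A) → Set a
  Periodic n f = ∀ s → f (n + s) ≡ f s

  module _ (n : ℕ) where

    Sum-shift : ∀ r {f} → Periodic n f → Sum (λ s → f (r + s)) n ≡ Sum f n
    Sum-shift zero per = refl
    Sum-shift (suc r) {f} per = trans (Sum-cong n (λ s → cong f (sym (+-suc r s)))) (trans (+-cancelˡ-≡ (g 0) _ _ (trans (Sum-last g n) (trans (+-comm _ (g n)) (cong (_+ Sum g n)
        (trans (cong f (trans (+-comm r n) (cong (n +_) (sym (+-identityʳ r))))) (per (r + 0))))))) (Sum-shift r per))
      where
      g : ℕ → ℕ
      g s = f (r + s)

    -- A rotation by one place moves f(0) from weight 1 to weight 3^n, which adds f(0) p.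
    Val-shift : ∀ {p} → suc p ≡ 3 ^ n → ∀ r {f} → Periodic n f → ∃[ C ] 3 ^ r * Val (λ s → f (r + s)) n ≡ Val f n + C * p
    Val-shift suc-p≡ zero {f} per = 0 , trans (+-identityʳ _) (sym (+-identityʳ _))
    Val-shift {p} suc-p≡ (suc r) {f} per with Val-shift suc-p≡ r {λ s → f (suc s)} (λ s → trans (cong f (sym (+-suc n s))) (per (suc s)))
    ... | C , eq = 3 * C + f 0 , (begin-equality
        3 * 3 ^ r * Val (λ s → f (suc r + s)) n ≡⟨ *-assoc 3 (3 ^ r) _ ⟩
        3 * (3 ^ r * Val (λ s → f (suc (r + s))) n) ≡⟨ cong (3 *_) eq ⟩
        3 * (Val (f ∘ suc) n + C * p) ≡⟨ *-distribˡ-+ 3 (Val (f ∘ suc) n) (C * p) ⟩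
        3 * Val (f ∘ suc) n + 3 * (C * p) ≡⟨ cong (_+ 3 * (C * p)) one-step ⟩
        (Val f n + f 0 * p) + 3 * (C * p) ≡⟨ rearrange (Val f n) (f 0) p C ⟩
        Val f n + (3 * C + f 0) * p ∎)
      where
      open ≤-Reasoning
      rearrange : ∀ a b c d → (a + b * c) + 3 * (d * c) ≡ a + (3 * d + b) * c
      rearrange = solve-∀
      one-step : 3 * Val (f ∘ suc) n ≡ Val f n + f 0 * p
      one-step = +-cancelˡ-≡ (f 0) _ _ (trans (Val-last f n) (trans (cong (λ v → Val f n + v * 3 ^ n) (trans (cong f (sym (+-identityʳ n))) (per 0)))
        (trans (cong (λ v → Val f n + f 0 * v) (sym suc-p≡)) (expand (Val f n) (f 0) p))))
        where
        expand : ∀ a b c → a + b * suc c ≡ b + (a + b * c)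
        expand = solve-∀

  -- One column of 2a + b with incoming carry c. The total is at most 8, so the outgoing carry is
  -- again at most 2.
  digit carry : Fin 3 → Fin 3 → Fin 3 → Fin 3
  digit a b c = (2 * toℕ a + toℕ b + toℕ c) mod 3
  carry a b c = ((2 * toℕ a + toℕ b + toℕ c) / 3) mod 3

  digit-carry : ∀ a b c → toℕ (digit a b c) + 3 * toℕ (carry a b c) ≡ 2 * toℕ a + toℕ b + toℕ c
  digit-carry = from-yes (Finₚ.all? λ a → Finₚ.all? λ b → Finₚ.all? λ c → (toℕ (digit a b c) + 3 * toℕ (carry a b c)) ≟ (2 * toℕ a + toℕ b + toℕ c))

  nth : List ℕ → ℕ → ℕ
  nth [] _ = 0
  nth (x ∷ _) zero = x
  nth (_ ∷ xs) (suc k) = nth xs k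

  -- Weights of longest paths in the graph with vertices (b , c₀ , c₁ , c₂ , c₃), edges
  -- (b , c₀ , c₁ , c₂ , c₃) → (a , c₁ , c₂ , c₃ , carry a b c₀), and edge weight 2 a − 2 c₀ − 1;
  -- they are finite because no cycle has positive weight.
  potentials : List ℕ
  potentials =
    0 ∷ 0 ∷ 0 ∷ 3 ∷ 4 ∷ 0 ∷ 3 ∷ 4 ∷ 0 ∷ 2 ∷ 0 ∷ 0 ∷ 5 ∷ 4 ∷ 0 ∷ 7 ∷ 7 ∷ 0 ∷ 2 ∷ 0 ∷ 0 ∷ 5 ∷ 0 ∷ 0 ∷ 7 ∷ 5 ∷ 0 ∷
    3 ∷ 1 ∷ 0 ∷ 5 ∷ 6 ∷ 0 ∷ 3 ∷ 4 ∷ 0 ∷ 5 ∷ 0 ∷ 0 ∷ 8 ∷ 7 ∷ 0 ∷ 8 ∷ 9 ∷ 0 ∷ 6 ∷ 0 ∷ 0 ∷ 8 ∷ 6 ∷ 0 ∷ 10 ∷ 10 ∷ 0 ∷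
    5 ∷ 3 ∷ 0 ∷ 5 ∷ 7 ∷ 0 ∷ 2 ∷ 4 ∷ 0 ∷ 5 ∷ 1 ∷ 0 ∷ 8 ∷ 9 ∷ 0 ∷ 6 ∷ 9 ∷ 0 ∷ 7 ∷ 0 ∷ 0 ∷ 9 ∷ 8 ∷ 0 ∷ 10 ∷ 11 ∷ 0 ∷
    1 ∷ 2 ∷ 0 ∷ 1 ∷ 6 ∷ 4 ∷ 1 ∷ 6 ∷ 6 ∷ 4 ∷ 4 ∷ 0 ∷ 5 ∷ 7 ∷ 2 ∷ 1 ∷ 9 ∷ 8 ∷ 4 ∷ 2 ∷ 0 ∷ 5 ∷ 7 ∷ 0 ∷ 1 ∷ 9 ∷ 5 ∷
    3 ∷ 5 ∷ 0 ∷ 1 ∷ 8 ∷ 6 ∷ 1 ∷ 6 ∷ 6 ∷ 6 ∷ 7 ∷ 0 ∷ 5 ∷ 10 ∷ 7 ∷ 1 ∷ 11 ∷ 10 ∷ 8 ∷ 7 ∷ 0 ∷ 8 ∷ 10 ∷ 0 ∷ 1 ∷ 12 ∷ 10 ∷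
    3 ∷ 7 ∷ 0 ∷ 1 ∷ 9 ∷ 8 ∷ 1 ∷ 4 ∷ 6 ∷ 6 ∷ 7 ∷ 0 ∷ 1 ∷ 11 ∷ 9 ∷ 1 ∷ 11 ∷ 10 ∷ 8 ∷ 9 ∷ 0 ∷ 6 ∷ 11 ∷ 5 ∷ 1 ∷ 13 ∷ 12 ∷
    0 ∷ 4 ∷ 4 ∷ 0 ∷ 5 ∷ 8 ∷ 0 ∷ 3 ∷ 8 ∷ 0 ∷ 6 ∷ 4 ∷ 0 ∷ 9 ∷ 9 ∷ 0 ∷ 7 ∷ 11 ∷ 0 ∷ 6 ∷ 3 ∷ 0 ∷ 9 ∷ 7 ∷ 0 ∷ 9 ∷ 11 ∷
    0 ∷ 7 ∷ 7 ∷ 0 ∷ 7 ∷ 10 ∷ 0 ∷ 3 ∷ 8 ∷ 0 ∷ 9 ∷ 7 ∷ 0 ∷ 10 ∷ 12 ∷ 0 ∷ 5 ∷ 13 ∷ 0 ∷ 10 ∷ 5 ∷ 0 ∷ 12 ∷ 12 ∷ 0 ∷ 11 ∷ 14 ∷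
    0 ∷ 7 ∷ 9 ∷ 0 ∷ 5 ∷ 11 ∷ 0 ∷ 3 ∷ 8 ∷ 0 ∷ 9 ∷ 9 ∷ 0 ∷ 10 ∷ 13 ∷ 0 ∷ 3 ∷ 13 ∷ 0 ∷ 11 ∷ 9 ∷ 0 ∷ 12 ∷ 13 ∷ 0 ∷ 8 ∷ 15 ∷ []

  potential : Fin 3 → Fin 3 → Fin 3 → Fin 3 → Fin 3 → ℕ
  potential b c₀ c₁ c₂ c₃ = nth potentials (3 * (3 * (3 * (3 * toℕ b + toℕ c₀) + toℕ c₁) + toℕ c₂) + toℕ c₃)

  -- Checked on all 3^6 edges. Along a closed walk the potentials cancel and leave the total weight
  -- at most 0.
  potential-step : ∀ a b c₀ c₁ c₂ c₃ →
    2 * toℕ a + potential b c₀ c₁ c₂ c₃ ≤ 2 * toℕ c₀ + 1 + potential a c₁ c₂ c₃ (carry a b c₀)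
  potential-step = from-yes (Finₚ.all? λ a → Finₚ.all? λ b → Finₚ.all? λ c₀ → Finₚ.all? λ c₁ → Finₚ.all? λ c₂ → Finₚ.all? λ c₃ →
    (2 * toℕ a + potential b c₀ c₁ c₂ c₃) ≤? (2 * toℕ c₀ + 1 + potential a c₁ c₂ c₃ (carry a b c₀)))

  ternary : ℕ → ℕ → Fin 3
  ternary i zero = i mod 3
  ternary i (suc s) = ternary (i / 3) s

  Val-ternary : ∀ n i → i < 3 ^ n → Val (toℕ ∘ ternary i) n ≡ i
  Val-ternary zero zero _ = refl
  Val-ternary zero (suc i) (s≤s ())
  Val-ternary (suc n) i i<3^n = trans (cong₂ (λ a b → a + 3 * b) (Finₚ.toℕ-fromℕ< (m%n<n i 3)) (Val-ternary n (i / 3) (m<n*o⇒m/o<n (subst (i <_) (*-comm 3 (3 ^ n)) i<3^n))))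
    (trans (cong (i % 3 +_) (*-comm 3 (i / 3))) (sym (m≡m%n+[m/n]*n i 3)))

  val-applyUpTo : ∀ f n → val (applyUpTo f n) ≡ Val (toℕ ∘ f) n
  val-applyUpTo f zero = refl
  val-applyUpTo f (suc n) = cong (λ v → toℕ (f 0) + 3 * v) (val-applyUpTo (f ∘ suc) n)

  codigit-+ : ∀ d → codigit d + toℕ d ≡ 2
  codigit-+ 0F = refl
  codigit-+ 1F = refl
  codigit-+ 2F = refl

  deficit-applyUpTo : ∀ f n → deficit (applyUpTo f n) + Sum (toℕ ∘ f) n ≡ 2 * n
  deficit-applyUpTo f zero = refl
  deficit-applyUpTo f (suc n) = trans (rearrange (codigit (f 0)) (deficit (applyUpTo (f ∘ suc) n)) (toℕ (f 0)) (Sum (toℕ ∘ f ∘ suc) n))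
      (trans (cong₂ _+_ (codigit-+ (f 0)) (deficit-applyUpTo (f ∘ suc) n)) (sym (*-suc 2 n)))
    where
    rearrange : ∀ a b c d → (a + b) + (c + d) ≡ (a + c) + (b + d)
    rearrange = solve-∀

  -- Complementing every digit turns i into q - 1 - i, the exponent that is paired with d i in the
  -- expansion.
  val-opposite : ∀ v → suc (val (map opposite v) + val v) ≡ 3 ^ length v
  val-opposite [] = refl
  val-opposite (d ∷ v) = trans (rearrange (toℕ (opposite d)) (toℕ d) (val (map opposite v)) (val v))
      (trans (cong (λ k → suc k + 3 * (val (map opposite v) + val v)) (opposite-+ d)) (trans (sym (*-suc 3 _)) (cong (3 *_) (val-opposite v))))
    where
    opposite-+ : ∀ (d : Fin 3) → toℕ (opposite d) + toℕ d ≡ 2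
    opposite-+ 0F = refl
    opposite-+ 1F = refl
    opposite-+ 2F = refl
    rearrange : ∀ a b c d → suc ((a + 3 * c) + (b + 3 * d)) ≡ suc (a + b) + 3 * (c + d)
    rearrange = solve-∀

  deficit-opposite : ∀ f n → deficit (map opposite (applyUpTo f n)) ≡ Sum (toℕ ∘ f) n
  deficit-opposite f zero = refl
  deficit-opposite f (suc n) = cong₂ _+_ (codigit-opposite (f 0)) (deficit-opposite (f ∘ suc) n)
    where
    codigit-opposite : ∀ d → codigit (opposite d) ≡ toℕ d
    codigit-opposite 0F = refl
    codigit-opposite 1F = refl
    codigit-opposite 2F = refl

  -- Here w stands for the digits of L i; read at r + s it gives the digits of i. The condition c(n)
  -- = c(0) is the end-around carry of addition modulo 3^n - 1.
  module CyclicAddition (n r k : ℕ) (4r≡1+kn : 4 * r ≡ 1 + k * n) (w : ℕ → Fin 3) (periodic : Periodic n w)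
    (c : ℕ → Fin 3) (c-step : ∀ s → c (suc s) ≡ carry (w (r + s)) (w s) (c s)) (c-cyclic : c n ≡ c 0) where

    c-periodic : Periodic n c
    c-periodic zero = trans (cong c (+-identityʳ n)) c-cyclic
    c-periodic (suc s) = begin
        c (n + suc s) ≡⟨ cong c (+-suc n s) ⟩
        c (suc (n + s)) ≡⟨ c-step (n + s) ⟩
        carry (w (r + (n + s))) (w (n + s)) (c (n + s)) ≡⟨ cong₂ (λ a b → carry a b (c (n + s))) (trans (cong w (rearrange r n s)) (periodic (r + s))) (periodic s) ⟩
        carry (w (r + s)) (w s) (c (n + s)) ≡⟨ cong (carry (w (r + s)) (w s)) (c-periodic s) ⟩
        carry (w (r + s)) (w s) (c s) ≡⟨ sym (c-step s) ⟩
        c (suc s) ∎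
      where
      open ≡-Reasoning
      rearrange : ∀ a b c → a + (b + c) ≡ b + (a + c)
      rearrange = solve-∀

    c-multiple : ∀ k s → c (k * n + s) ≡ c s
    c-multiple zero s = refl
    c-multiple (suc k) s = trans (cong c (+-assoc n (k * n) s)) (trans (c-periodic (k * n + s)) (c-multiple k s))

    c-4r : ∀ s → c (r + (r + (r + (r + s)))) ≡ c (suc s)
    c-4r s = trans (cong c (trans (rearrange r s) (trans (cong (_+ s) 4r≡1+kn) (rearrange′ (k * n) s)))) (c-multiple k (suc s))
      where
      rearrange : ∀ r s → r + (r + (r + (r + s))) ≡ 4 * r + s
      rearrange = solve-∀
      rearrange′ : ∀ a s → 1 + a + s ≡ a + suc s
      rearrange′ = solve-∀

    -- The potential of the vertex at position s. The vertex at r + s involves one new carry, c(4r +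
    -- s). By 4r ≡ 1 this is c(s + 1), the carry out of column s, whose inputs are w(r + s), w(s)
    -- and c(s).
    P : ℕ → ℕ
    P s = potential (w s) (c s) (c (r + s)) (c (r + (r + s))) (c (r + (r + (r + s))))

    P-periodic : Periodic n P
    P-periodic s = trans (cong₂ (λ a b → potential a b (c (r + (n + s))) (c (r + (r + (n + s)))) (c (r + (r + (r + (n + s)))))) (periodic s) (c-periodic s))
      (trans (cong₂ (λ a b → potential (w s) (c s) a b (c (r + (r + (r + (n + s)))))) (along (rearrange r n s)) (along (rearrange₂ r n s)))
        (cong (potential (w s) (c s) (c (r + s)) (c (r + (r + s)))) (along (rearrange₃ r n s))))
      where
      along : ∀ {a b} → a ≡ n + b → c a ≡ c b
      along {b = b} eq = trans (cong c eq) (c-periodic b)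
      rearrange : ∀ r n s → r + (n + s) ≡ n + (r + s)
      rearrange = solve-∀
      rearrange₂ : ∀ r n s → r + (r + (n + s)) ≡ n + (r + (r + s))
      rearrange₂ = solve-∀
      rearrange₃ : ∀ r n s → r + (r + (r + (n + s))) ≡ n + (r + (r + (r + s)))
      rearrange₃ = solve-∀

    m : ℕ → Fin 3
    m s = digit (w (r + s)) (w s) (c s)

    Σw Σc Σm : ℕ
    Σw = Sum (toℕ ∘ w) n
    Σc = Sum (toℕ ∘ c) n
    Σm = Sum (toℕ ∘ m) n

    private
      toℕ-periodic : ∀ {f : ℕ → Fin 3} → Periodic n f → Periodic n (toℕ ∘ f)
      toℕ-periodic per s = cong toℕ (per s)

    -- `potential-step` is summed over a period. The potentials at s and at r + s have the same sum,
    -- since a shift by r only rotates the positions.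
    few-carries : 2 * Σw ≤ 2 * Σc + n
    few-carries = +-cancelʳ-≤ (Sum P n) _ _ (begin
        2 * Σw + Sum P n
      ≡⟨ cong (λ v → 2 * v + Sum P n) (sym (Sum-shift n r (toℕ-periodic periodic))) ⟩
        2 * Sum (λ s → toℕ (w (r + s))) n + Sum P n
      ≡⟨ sym (trans (Sum-+ _ P n) (cong (_+ Sum P n) (Sum-* 2 _ n))) ⟩
        Sum (λ s → 2 * toℕ (w (r + s)) + P s) n
      ≤⟨ Sum-mono n (λ s → ≤-trans (potential-step (w (r + s)) (w s) (c s) (c (r + s)) (c (r + (r + s))) (c (r + (r + (r + s)))))
           (≤-reflexive (cong (λ v → 2 * toℕ (c s) + 1 + potential (w (r + s)) (c (r + s)) (c (r + (r + s))) (c (r + (r + (r + s)))) v)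
             (trans (sym (c-step s)) (sym (c-4r s)))))) ⟩
        Sum (λ s → 2 * toℕ (c s) + 1 + P (r + s)) n
      ≡⟨ trans (Sum-+ _ _ n) (cong₂ _+_ (trans (Sum-+ _ _ n) (cong₂ _+_ (Sum-* 2 _ n) (Sum-1 n))) (Sum-shift n r P-periodic)) ⟩
        (2 * Σc + n) + Sum P n ∎)
      where open ≤-Reasoning

    -- Without carries the digit sum would be 3 Σw; each carried unit replaces 3 in one column by 1
    -- in the next, a loss of 2.
    digit-sum : Σm + 2 * Σc ≡ 3 * Σw
    digit-sum = +-cancelʳ-≡ Σc _ _ (begin-equality
        (Σm + 2 * Σc) + Σc ≡⟨ rearrange Σm Σc ⟩
        Σm + 3 * Σc ≡⟨ cong (λ v → Σm + 3 * v) (sym (Sum-shift n 1 (toℕ-periodic c-periodic))) ⟩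
        Σm + 3 * Sum (λ s → toℕ (c (suc s))) n ≡⟨ sym (trans (Sum-+ _ _ n) (cong (Σm +_) (Sum-* 3 _ n))) ⟩
        Sum (λ s → toℕ (m s) + 3 * toℕ (c (suc s))) n ≡⟨ Sum-cong n (λ s → trans (cong (λ v → toℕ (m s) + 3 * toℕ v) (c-step s)) (digit-carry (w (r + s)) (w s) (c s))) ⟩
        Sum (λ s → 2 * toℕ (w (r + s)) + toℕ (w s) + toℕ (c s)) n ≡⟨ trans (Sum-+ _ _ n) (cong (_+ Σc) (trans (Sum-+ _ _ n) (cong (_+ Σw) (Sum-* 2 _ n)))) ⟩
        2 * Sum (λ s → toℕ (w (r + s))) n + Σw + Σc ≡⟨ cong (λ v → 2 * v + Σw + Σc) (Sum-shift n r (toℕ-periodic periodic)) ⟩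
        2 * Σw + Σw + Σc ≡⟨ rearrange′ Σw Σc ⟩
        3 * Σw + Σc ∎)
      where
      open ≤-Reasoning
      rearrange : ∀ a b → (a + 2 * b) + b ≡ a + 3 * b
      rearrange = solve-∀
      rearrange′ : ∀ a b → 2 * a + a + b ≡ 3 * a + b
      rearrange′ = solve-∀

    digit-sum-bound : Σm ≤ Σw + n
    digit-sum-bound = +-cancelʳ-≤ (2 * Σc) _ _ (begin
        Σm + 2 * Σc ≡⟨ digit-sum ⟩
        3 * Σw ≡⟨ rearrange Σw ⟩
        Σw + 2 * Σw ≤⟨ +-monoʳ-≤ Σw few-carries ⟩
        Σw + (2 * Σc + n) ≡⟨ rearrange′ Σw Σc n ⟩
        Σw + n + 2 * Σc ∎)
      where
      open ≤-Reasoning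
      rearrange : ∀ a → 3 * a ≡ a + 2 * a
      rearrange = solve-∀
      rearrange′ : ∀ a b c → a + (2 * b + c) ≡ a + c + 2 * b
      rearrange′ = solve-∀

  carries : (ℕ → Fin 3) → (ℕ → Fin 3) → Fin 3 → ℕ → Fin 3
  carries a b c zero = c
  carries a b c (suc s) = carry (a s) (b s) (carries a b c s)

  carry-propagation : ∀ a b c n → Val (λ s → 2 * toℕ (a s) + toℕ (b s)) n + toℕ c
    ≡ Val (λ s → toℕ (digit (a s) (b s) (carries a b c s))) n + toℕ (carries a b c n) * 3 ^ n
  carry-propagation a b c zero = sym (*-identityʳ _)
  carry-propagation a b c (suc n) = begin-equality
      Val u (suc n) + toℕ c ≡⟨ cong (_+ toℕ c) (Val-last u n) ⟩
      Val u n + u n * 3 ^ n + toℕ c ≡⟨ rearrange (Val u n) (u n * 3 ^ n) (toℕ c) ⟩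
      (Val u n + toℕ c) + u n * 3 ^ n ≡⟨ cong (_+ u n * 3 ^ n) (carry-propagation a b c n) ⟩
      (Val m n + toℕ (C n) * 3 ^ n) + u n * 3 ^ n ≡⟨ rearrange′ (Val m n) (toℕ (C n)) (u n) (3 ^ n) ⟩
      Val m n + (u n + toℕ (C n)) * 3 ^ n ≡⟨ cong (λ v → Val m n + v * 3 ^ n) (sym (digit-carry (a n) (b n) (C n))) ⟩
      Val m n + (m n + 3 * toℕ (C (suc n))) * 3 ^ n ≡⟨ rearrange″ (Val m n) (m n) (toℕ (C (suc n))) (3 ^ n) ⟩
      (Val m n + m n * 3 ^ n) + toℕ (C (suc n)) * 3 ^ suc n ≡⟨ cong (_+ toℕ (C (suc n)) * 3 ^ suc n) (sym (Val-last m n)) ⟩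
      Val m (suc n) + toℕ (C (suc n)) * 3 ^ suc n ∎
    where
    open ≤-Reasoning
    u m : ℕ → ℕ
    C : ℕ → Fin 3
    u s = 2 * toℕ (a s) + toℕ (b s)
    C = carries a b c
    m s = toℕ (digit (a s) (b s) (C s))
    rearrange : ∀ a b c → a + b + c ≡ (a + c) + b
    rearrange = solve-∀
    rearrange′ : ∀ a b c d → (a + b * d) + c * d ≡ a + (c + b) * d
    rearrange′ = solve-∀
    rearrange″ : ∀ a b c d → a + (b + 3 * c) * d ≡ (a + b * d) + c * (3 * d)
    rearrange″ = solve-∀

  Val-bound : ∀ (f : ℕ → Fin 3) n → Val (toℕ ∘ f) n < 3 ^ n
  Val-bound f n = subst₂ (λ a b → a < 3 ^ b) (val-applyUpTo f n) (length-applyUpTo f n) (val-bound (applyUpTo f n))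

  division-unique : ∀ {q} a b c d → a < q → c < q → a + b * q ≡ c + d * q → a ≡ c × b ≡ d
  division-unique a zero c zero a<q c<q eq = trans (sym (+-identityʳ a)) (trans eq (+-identityʳ c)) , refl
  division-unique {q} a zero c (suc d) a<q c<q eq = contradiction (≤-trans (m≤m+n q (d * q)) (≤-trans (m≤n+m _ c) (≤-reflexive (trans (sym eq) (+-identityʳ a))))) (<⇒≱ a<q)
  division-unique {q} a (suc b) c zero a<q c<q eq = contradiction (≤-trans (m≤m+n q (b * q)) (≤-trans (m≤n+m _ a) (≤-reflexive (trans eq (+-identityʳ c))))) (<⇒≱ c<q)
  division-unique {q} a (suc b) c (suc d) a<q c<q eq with division-unique a b c d a<q c<q
      (+-cancelˡ-≡ q _ _ (trans (rearrange q a (b * q)) (trans eq (sym (rearrange q c (d * q))))))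
    where
    rearrange : ∀ q a b → q + (a + b) ≡ a + (q + b)
    rearrange = solve-∀
  ... | a≡c , b≡d = a≡c , cong suc b≡d

  -- The product stands for d i modulo p by a representative other than 0, so that `pow-mod` may
  -- replace the exponent. In `digit-sums` the two deficits are w(i) and 2n - w(d i).
  record DigitsOfProduct (n r i p : ℕ) : Set where
    field
      multiplicand product : List (Fin 3)
      length-multiplicand : length multiplicand ≡ n
      length-product : length product ≡ n
      val-multiplicand : val multiplicand ≡ i
      val-product : ∃[ C ] (3 ^ r + 2) * i ≡ val product + C * p
      product≢0 : val product ≢ 0
      digit-sums : n ≤ deficit (map opposite multiplicand) + deficit product

  digits-of-product : ∀ n .{{_ : NonZero n}} r k {p} i → 4 * r ≡ 1 + k * n → suc p ≡ 3 ^ n → i ≢ 0 → i < 3 ^ n → DigitsOfProduct n r i p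
  digits-of-product n r k {p} i 4r≡1+kn suc-p≡ i≢0 i<3^n = record
      { multiplicand = applyUpTo j n
      ; product = applyUpTo A.m n
      ; length-multiplicand = length-applyUpTo j n
      ; length-product = length-applyUpTo A.m n
      ; val-multiplicand = trans (val-applyUpTo j n) Val-j
      ; val-product = let C , eq = Val-shift n suc-p≡ r {toℕ ∘ w} (λ s → cong toℕ (w-periodic s)) in
          C₀ + C , (begin-equality
            (3 ^ r + 2) * i ≡⟨ *-distribʳ-+ i (3 ^ r) 2 ⟩
            3 ^ r * i + 2 * i ≡⟨ cong (λ v → 3 ^ r * v + 2 * v) (sym Val-w) ⟩
            3 ^ r * Val (λ s → toℕ (w (r + s))) n + 2 * Val (λ s → toℕ (w (r + s))) n
                                                    ≡⟨ cong (_+ 2 * Val (λ s → toℕ (w (r + s))) n) eq ⟩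
            Val (toℕ ∘ w) n + C * p + 2 * Val (λ s → toℕ (w (r + s))) n
                                                    ≡⟨ rearrange₁ (Val (toℕ ∘ w) n) (C * p) (Val (λ s → toℕ (w (r + s))) n) ⟩
            (2 * Val (λ s → toℕ (w (r + s))) n + Val (toℕ ∘ w) n) + C * p
                                                    ≡⟨ cong (_+ C * p) (sym (trans (Val-+ _ _ n) (cong (_+ Val (toℕ ∘ w) n) (Val-2* _ n)))) ⟩
            U + C * p ≡⟨ cong (_+ C * p) U≡ ⟩
            (D + C₀ * p) + C * p ≡⟨ rearrange₂ D C₀ C p ⟩
            D + (C₀ + C) * p ≡⟨ cong (_+ (C₀ + C) * p) (sym val-product≡D) ⟩
            val (applyUpTo A.m n) + (C₀ + C) * p ∎)
      ; product≢0 = λ eq → 1+n≢0 (trans (sym val-product≡D) eq)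
      ; digit-sums = +-cancelʳ-≤ (Sum (toℕ ∘ A.m) n) _ _ (begin
            n + Sum (toℕ ∘ A.m) n ≤⟨ +-monoʳ-≤ n A.digit-sum-bound ⟩
            n + (Sum (toℕ ∘ w) n + n) ≡⟨ rearrange₃ n (Sum (toℕ ∘ w) n) ⟩
            Sum (toℕ ∘ w) n + 2 * n ≡⟨ cong₂ _+_ (trans (sym (Sum-shift n r (λ s → cong toℕ (w-periodic s)))) (trans (Sum-cong n (λ s → cong toℕ (w-shift s))) (sym (deficit-opposite j n)))) (sym (deficit-applyUpTo A.m n)) ⟩
            deficit (map opposite (applyUpTo j n)) + (deficit (applyUpTo A.m n) + Sum (toℕ ∘ A.m) n)
                                                      ≡⟨ sym (+-assoc (deficit (map opposite (applyUpTo j n))) _ _) ⟩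
            deficit (map opposite (applyUpTo j n)) + deficit (applyUpTo A.m n) + Sum (toℕ ∘ A.m) n ∎) }
    where
    open ≤-Reasoning
    rearrange₁ : ∀ a b c → a + b + 2 * c ≡ (2 * c + a) + b
    rearrange₁ = solve-∀
    rearrange₂ : ∀ a b c d → (a + b * d) + c * d ≡ a + (b + c) * d
    rearrange₂ = solve-∀
    rearrange₃ : ∀ a b → a + (b + a) ≡ b + 2 * a
    rearrange₃ = solve-∀

    j w : ℕ → Fin 3
    j s = ternary i (s % n)
    -- The multiple (n - 1) r plays the role of -r modulo n.
    w s = j (pred n * r + s)

    j-periodic : Periodic n j
    j-periodic s = cong (ternary i) (trans (cong (_% n) (+-comm n s)) ([m+n]%n≡m%n s n))

    w-periodic : Periodic n w
    w-periodic s = trans (cong j (rearrange (pred n * r) n s)) (j-periodic (pred n * r + s))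
      where
      rearrange : ∀ a b c → a + (b + c) ≡ b + (a + c)
      rearrange = solve-∀

    w-shift : ∀ s → w (r + s) ≡ j s
    w-shift s = trans (cong j (trans (rearrange (pred n) r s) (cong (λ v → r * v + s) (suc-pred n)))) (multiples r s)
      where
      rearrange : ∀ a r s → a * r + (r + s) ≡ r * suc a + s
      rearrange = solve-∀
      multiples : ∀ r s → j (r * n + s) ≡ j s
      multiples zero s = refl
      multiples (suc r) s = trans (cong j (+-assoc n (r * n) s)) (trans (j-periodic (r * n + s)) (multiples r s))

    Val-j : Val (toℕ ∘ j) n ≡ i
    Val-j = trans (Val-cong n (λ s s<n → cong (toℕ ∘ ternary i) (m<n⇒m%n≡m s<n))) (Val-ternary n i i<3^n)

    Val-w : Val (λ s → toℕ (w (r + s))) n ≡ i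
    Val-w = trans (Val-cong n (λ s _ → cong toℕ (w-shift s))) Val-j

    U : ℕ
    U = Val (λ s → 2 * toℕ (w (r + s)) + toℕ (w s)) n

    U-split : U ≡ 2 * i + Val (toℕ ∘ w) n
    U-split = trans (Val-+ _ _ n) (cong (_+ Val (toℕ ∘ w) n) (trans (Val-2* _ n) (cong (2 *_) Val-w)))

    instance
      p-nonZero : NonZero p
      p-nonZero = >-nonZero (≤-pred (≤-trans (s≤s (s≤s z≤n)) (≤-trans (^-monoʳ-≤ 3 (>-nonZero⁻¹ n)) (≤-reflexive (sym suc-p≡)))))

    -- Dividing U - 1 instead of U puts the representative D in the range 1, ..., p. As U + C₀ = D +
    -- C₀ 3^n, an addition that starts with carry C₀ also ends with it.
    U-1 C₀ D : ℕ
    U-1 = 2 * i + Val (toℕ ∘ w) n ∸ 1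
    C₀ = U-1 / p
    D = suc (U-1 % p)

    U≡1+ : U ≡ suc U-1
    U≡1+ = trans U-split (positive i (Val (toℕ ∘ w) n) i≢0)
      where
      positive : ∀ i v → i ≢ 0 → 2 * i + v ≡ suc (2 * i + v ∸ 1)
      positive zero v ne = contradiction refl ne
      positive (suc _) v _ = refl

    U≡ : U ≡ D + C₀ * p
    U≡ = trans U≡1+ (cong suc (m≡m%n+[m/n]*n U-1 p))

    C₀<3 : C₀ < 3
    C₀<3 = m<n*o⇒m/o<n {U-1} {3} {p} (begin
        suc U-1 ≡⟨ sym U≡1+ ⟩
        U ≡⟨ U-split ⟩
        2 * i + Val (toℕ ∘ w) n ≤⟨ +-mono-≤ (*-monoʳ-≤ 2 (below i<3^n)) (below (Val-bound w n)) ⟩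
        2 * p + p ≡⟨ rearrange p ⟩
        3 * p ∎)
      where
      below : ∀ {x} → x < 3 ^ n → x ≤ p
      below {x} lt = ≤-pred (subst (x <_) (sym suc-p≡) lt)
      rearrange : ∀ p → 2 * p + p ≡ 3 * p
      rearrange = solve-∀

    c : ℕ → Fin 3
    c = carries (λ s → w (r + s)) w (fromℕ< C₀<3)

    split : Val (λ s → toℕ (digit (w (r + s)) (w s) (c s))) n ≡ D × toℕ (c n) ≡ C₀
    split = division-unique (Val (λ s → toℕ (digit (w (r + s)) (w s) (c s))) n) (toℕ (c n)) D C₀ (Val-bound _ n) (subst (D <_) suc-p≡ (s≤s (m%n<n U-1 p)))
      (begin-equality
        Val (λ s → toℕ (digit (w (r + s)) (w s) (c s))) n + toℕ (c n) * 3 ^ n ≡⟨ sym (carry-propagation (λ s → w (r + s)) w (fromℕ< C₀<3) n) ⟩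
        U + toℕ (fromℕ< C₀<3) ≡⟨ cong₂ _+_ U≡ (Finₚ.toℕ-fromℕ< C₀<3) ⟩
        D + C₀ * p + C₀ ≡⟨ rearrange D C₀ p ⟩
        D + C₀ * suc p ≡⟨ cong (λ v → D + C₀ * v) suc-p≡ ⟩
        D + C₀ * 3 ^ n ∎)
      where
      rearrange : ∀ a b c → a + b * c + b ≡ a + b * suc c
      rearrange = solve-∀

    module A = CyclicAddition n r k 4r≡1+kn w w-periodic c (λ s → refl)
      (Finₚ.toℕ-injective (trans (proj₂ split) (sym (Finₚ.toℕ-fromℕ< C₀<3))))

    val-product≡D : val (applyUpTo A.m n) ≡ D
    val-product≡D = trans (val-applyUpTo A.m n) (proj₁ split)

-- Divisibility of the Weil sum by λ^n.

module Divisibilities where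
  open RingSums
  open EisensteinIntegers
  open TeichmüllerLifts
  open GaussSumValuations
  open TernaryCarries
  open import Relation.Binary.PropositionalEquality using (refl; sym; trans)

  module Divisibility (F : FiniteField) (n : ℕ) (order≡3^n : FiniteField.order F ≡ 3 ℕ.^ n) (1<n : 1 ℕ.< n)
    (r k : ℕ) (4r≡1+kn : 4 ℕ.* r ≡ 1 ℕ.+ k ℕ.* n) where
    open GaussSums F n order≡3^n 1<n

    d : ℕ
    d = 3 ℕ.^ r ℕ.+ 2

    d≢0 : d ≢ 0
    d≢0 eq with trans (sym (ℕₚ.+-comm (3 ℕ.^ r) 2)) eq
    ... | ()

    private
      -- The valuations of the two factors are at least w(i) and 2n - w(d i), and w(d i) ≤ w(i) + n.
      paired : ∀ i → i ≢ 0 → i ℕ.< q-1 → Valued n (φ (q-1 ℕ.∸ i) · φ (d ℕ.* i))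
      paired i i≢0 i<q-1 = valued-weaken D.digit-sums (valued-*
          (subst (λ e → Valued (deficit (map opposite D.multiplicand)) (φ e)) complement
            (φ-valued _ (map opposite D.multiplicand) (trans (length-map opposite D.multiplicand) D.length-multiplicand) refl))
          (valued-≈ (φ-cong (val D.product) (d ℕ.* i) (λ y → sym (trans (cong (pow y) (proj₂ D.val-product)) (pow-mod y (val D.product) (proj₁ D.val-product) D.product≢0))))
            (φ-valued _ D.product D.length-product refl)))
        where
        module D = DigitsOfProduct (digits-of-product n {{ℕ.>-nonZero (ℕₚ.<-trans (s≤s z≤n) 1<n)}} r k i 4r≡1+kn q≡ i≢0
          (subst (i ℕ.<_) q≡ (ℕₚ.<-trans i<q-1 (ℕₚ.n<1+n q-1))))
        complement : val (map opposite D.multiplicand) ≡ q-1 ℕ.∸ i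
        complement = trans (sym (ℕₚ.m+n∸n≡m _ (val D.multiplicand)))
          (cong₂ ℕ._∸_ (ℕₚ.suc-injective (trans (val-opposite D.multiplicand) (trans (cong (3 ℕ.^_) D.length-multiplicand) (sym q≡)))) D.val-multiplicand)

    λ^n-divides-W : ∀ a → a ≢ 0# → λ^ n ∣ W F n d a
    λ^n-divides-W = λ^n∣W d d≢0 paired

-- The first, second and fourth power moments.

module PowerMoments where
  open RingSums
  open FiniteFields
  open EisensteinIntegers
  open CharacteristicThree
  open import Data.Nat.DivMod using (m≡m%n+[m/n]*n; m%n<n)
  open import Relation.Binary.PropositionalEquality using (refl; sym; trans)

  module WeilSum (F : FiniteField) (n : ℕ) (order≡3^n : FiniteField.order F ≡ 3 ℕ.^ n) (1<n : 1 ℕ.< n)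
    (r k : ℕ) (4r≡1+kn : 4 ℕ.* r ≡ 1 ℕ.+ k ℕ.* n) where
    open Ternary F n order≡3^n 1<n
    open ∑ω using () renaming (∑ to ∑ᴱ; ∑-reindex to ∑ᴱ-reindex; ∑-translate to ∑ᴱ-translate; ∑-reflect to ∑ᴱ-reflect;
      ∑-scale to ∑ᴱ-scale; ∑-single to ∑ᴱ-single; ∑-split to ∑ᴱ-split; ∑-neg to ∑ᴱ-neg)
    open ≡.≡-Reasoning

    L d : ℕ
    L = 3 ℕ.^ r
    d = L ℕ.+ 2

    d≢0 : d ≢ 0
    d≢0 eq with trans (sym (ℕₚ.+-comm L 2)) eq
    ... | ()

    frob : X → X
    frob x = pow x L

    pow-3^kn : ∀ k x → pow x (3 ℕ.^ (k ℕ.* n)) ≡ x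
    pow-3^kn zero x = *-identityʳ x
    pow-3^kn (suc k) x = trans (cong (pow x) (ℕₚ.^-distribˡ-+-* 3 n (k ℕ.* n)))
      (trans (pow-* x (3 ℕ.^ n) (3 ℕ.^ (k ℕ.* n))) (trans (cong (λ y → pow y (3 ℕ.^ (k ℕ.* n))) (pow-3^n x)) (pow-3^kn k x)))

    -- L⁴ = 3^(4r) = 3 · q^k, and q-th powers are trivial on F.
    frob⁴ : ∀ x → frob (frob (frob (frob x))) ≡ pow x 3
    frob⁴ x = begin
      frob (frob (frob (frob x))) ≡⟨ sym (trans (pow-* x (L ℕ.* L ℕ.* L) L) (cong frob (trans (pow-* x (L ℕ.* L) L) (cong frob (pow-* x L L))))) ⟩
      pow x (L ℕ.* L ℕ.* L ℕ.* L) ≡⟨ cong (pow x) exponent ⟩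
      pow x (3 ℕ.* 3 ℕ.^ (k ℕ.* n)) ≡⟨ pow-* x 3 (3 ℕ.^ (k ℕ.* n)) ⟩
      pow (pow x 3) (3 ℕ.^ (k ℕ.* n)) ≡⟨ pow-3^kn k (pow x 3) ⟩
      pow x 3 ∎
      where
      rearrange : ∀ a → a ℕ.* a ℕ.* a ℕ.* a ≡ a ℕ.* (a ℕ.* (a ℕ.* (a ℕ.* 1)))
      rearrange = ℕ-Solver.solve-∀
      exponent : L ℕ.* L ℕ.* L ℕ.* L ≡ 3 ℕ.* 3 ℕ.^ (k ℕ.* n)
      exponent = trans (rearrange L) (trans (ℕₚ.^-*-assoc 3 r 4) (cong (3 ℕ.^_) (trans (ℕₚ.*-comm r 4) 4r≡1+kn)))

    frob-+ : ∀ x y → frob (x + y) ≡ frob x + frob y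
    frob-+ = frobenius-+ r

    frob-neg : ∀ x → frob (- x) ≡ - frob x
    frob-neg = frobenius-neg r

    pow-d : ∀ x → pow x d ≡ frob x * (x * x)
    pow-d x = trans (pow-+ x L 2) (cong (λ y → frob x * (x * y)) (*-identityʳ x))

    pow-d-neg : ∀ x → pow (- x) d ≡ - pow x d
    pow-d-neg x = trans (pow-d (- x)) (trans (cong (_* (- x * - x)) (frob-neg x))
      (trans (solve 2 (λ l x → :- l :* (:- x :* :- x) := :- (l :* (x :* x))) refl (frob x) x) (cong -_ (sym (pow-d x)))))

    pow-injective : ∀ m → m ≢ 0 → (∀ {u} → u ≢ 0# → pow u m ≡ 1# → u ≡ 1#) → ∀ {x y} → pow x m ≡ pow y m → x ≡ y
    pow-injective m m≢0 kernel {x} {y} eq with y ≟ 0#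
    ... | yes refl = pow-≡0 m (trans eq (pow-0# m m≢0))
    ... | no y≢0 = trans (sym (trans (*-assoc x (inv y) y) (trans (cong (x *_) (trans (*-comm _ y) (inv-inverse y≢0))) (*-identityʳ x))))
        (trans (cong (_* y) (kernel (*-≢0 x≢0 (pow-≢0 q-2 y≢0)) (begin
          pow (x * inv y) m ≡⟨ pow-distrib x (inv y) m ⟩
          pow x m * pow (inv y) m ≡⟨ cong (_* pow (inv y) m) eq ⟩
          pow y m * pow (inv y) m ≡⟨ sym (pow-distrib y (inv y) m) ⟩
          pow (y * inv y) m ≡⟨ cong (λ z → pow z m) (inv-inverse y≢0) ⟩
          pow 1# m ≡⟨ pow-1# m ⟩
          1# ∎))) (*-identityˡ y))
        where
        x≢0 : x ≢ 0#
        x≢0 refl = pow-≢0 m y≢0 (trans (sym eq) (pow-0# m m≢0))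

    private
      pow-multiple : ∀ {u} m j → pow u m ≡ 1# → pow u (m ℕ.* j) ≡ 1#
      pow-multiple {u} m j eq = trans (pow-* u m j) (trans (cong (λ y → pow y j) eq) (pow-1# j))

      pow-peel : ∀ {u} m → pow u (suc m) ≡ 1# → pow u m ≡ 1# → u ≡ 1#
      pow-peel {u} m eq eq′ = trans (sym (*-identityʳ u)) (trans (cong (u *_) (sym eq′)) eq)

    -- From u^(L+2) = 1 and L⁴ ≡ 3 one gets u¹³ = 1; hence u^L depends only on r mod 3.
    pow-d-kernel : ∀ {u} → u ≢ 0# → pow u d ≡ 1# → u ≡ 1#
    pow-d-kernel {u} u≢0 u^d≡1 = by-residue (r ℕ.% 3) (m%n<n r 3) (trans (cong (λ v → v * (u * (u * 1#))) (sym frob-u)) (trans (sym (pow-+ u L 2)) u^d≡1))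
      where
      relation : frob u * (u * u) ≡ 1#
      relation = trans (sym (pow-d u)) u^d≡1

      frob-1 : frob 1# ≡ 1#
      frob-1 = pow-1# L

      frob-* : ∀ x y → frob (x * y) ≡ frob x * frob y
      frob-* x y = pow-distrib x y L

      -- By u^(L+2) = 1 the exponent L acts on u as -2, hence L² as 4 and L⁴ as 16. But L⁴ also acts
      -- as 3, and 16 - 3 = 13.
      frob² : frob (frob u) ≡ pow u 4
      frob² = *-cancelˡ (*-≢0 fu≢0 fu≢0) (begin
        (v * v) * frob v ≡⟨ *-comm _ _ ⟩
        frob v * (v * v) ≡⟨ sym (trans (frob-* v (u * u)) (cong (frob v *_) (frob-* u u))) ⟩
        frob (v * (u * u)) ≡⟨ trans (cong frob relation) frob-1 ⟩
        1# ≡⟨ sym (*-identityˡ 1#) ⟩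
        1# * 1# ≡⟨ sym (cong₂ _*_ relation relation) ⟩
        (v * (u * u)) * (v * (u * u)) ≡⟨ solve 2 (λ v u → (v :* (u :* u)) :* (v :* (u :* u)) := (v :* v) :* (u :* (u :* (u :* (u :* con (ℤ.+ 1)))))) refl v u ⟩
        (v * v) * pow u 4 ∎)
        where
        v = frob u
        fu≢0 : v ≢ 0#
        fu≢0 = pow-≢0 L u≢0

      u¹³ : pow u 13 ≡ 1#
      u¹³ = *-cancelˡ (pow-≢0 3 u≢0) (trans (sym (pow-+ u 3 13)) (begin
        pow u 16 ≡⟨ pow-* u 4 4 ⟩
        pow (pow u 4) 4 ≡⟨ cong (λ y → pow y 4) (sym frob²) ⟩
        pow (frob (frob u)) 4 ≡⟨ trans (pow-comm (frob u) L 4) (cong frob (pow-comm u L 4)) ⟩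
        frob (frob (pow u 4)) ≡⟨ cong (λ y → frob (frob y)) (sym frob²) ⟩
        frob (frob (frob (frob u))) ≡⟨ frob⁴ u ⟩
        pow u 3 ≡⟨ sym (*-identityʳ _) ⟩
        pow u 3 * 1# ∎))

      u²⁷ : ∀ j → pow u (27 ℕ.^ j) ≡ u
      u²⁷ zero = *-identityʳ u
      u²⁷ (suc j) = trans (pow-* u 27 (27 ℕ.^ j)) (trans (cong (λ y → pow y (27 ℕ.^ j))
        (trans (cong (u *_) (pow-multiple 13 2 u¹³)) (*-identityʳ u))) (u²⁷ j))

      frob-u : frob u ≡ pow u (3 ℕ.^ (r ℕ.% 3))
      frob-u = begin
        pow u (3 ℕ.^ r) ≡⟨ cong (λ e → pow u (3 ℕ.^ e)) (trans (m≡m%n+[m/n]*n r 3) (trans (ℕₚ.+-comm (r ℕ.% 3) _) (cong (ℕ._+ r ℕ.% 3) (ℕₚ.*-comm (r ℕ./ 3) 3)))) ⟩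
        pow u (3 ℕ.^ (3 ℕ.* (r ℕ./ 3) ℕ.+ r ℕ.% 3)) ≡⟨ cong (pow u) (trans (ℕₚ.^-distribˡ-+-* 3 (3 ℕ.* (r ℕ./ 3)) (r ℕ.% 3)) (cong (ℕ._* 3 ℕ.^ (r ℕ.% 3)) (sym (ℕₚ.^-*-assoc 3 3 (r ℕ./ 3))))) ⟩
        pow u (27 ℕ.^ (r ℕ./ 3) ℕ.* 3 ℕ.^ (r ℕ.% 3)) ≡⟨ pow-* u (27 ℕ.^ (r ℕ./ 3)) (3 ℕ.^ (r ℕ.% 3)) ⟩
        pow (pow u (27 ℕ.^ (r ℕ./ 3))) (3 ℕ.^ (r ℕ.% 3)) ≡⟨ cong (λ y → pow y (3 ℕ.^ (r ℕ.% 3))) (u²⁷ (r ℕ./ 3)) ⟩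
        pow u (3 ℕ.^ (r ℕ.% 3)) ∎

      -- On u the exponent L acts as 1, 3 or 9, so u^3, u^5 or u^11 is 1. These exponents are prime
      -- to 13; suitable multiples of the two known exponents differ by one: 12 and 13, 25 and 26,
      -- 65 and 66.
      by-residue : ∀ e → e ℕ.< 3 → pow u (3 ℕ.^ e) * pow u 2 ≡ 1# → u ≡ 1#
      by-residue 0 _ eq = pow-peel 12 u¹³ (pow-multiple 3 4 (trans (pow-+ u 1 2) eq))
      by-residue 1 _ eq = pow-peel 25 (pow-multiple 13 2 u¹³) (pow-multiple 5 5 (trans (pow-+ u 3 2) eq))
      by-residue 2 _ eq = pow-peel 65 (pow-multiple 11 6 (trans (pow-+ u 9 2) eq)) (pow-multiple 13 5 u¹³)
      by-residue (suc (suc (suc _))) (s≤s (s≤s (s≤s ()))) _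

    pow-d-injective : ∀ {x y} → pow x d ≡ pow y d → x ≡ y
    pow-d-injective = pow-injective d d≢0 pow-d-kernel

    Qω : ℤω
    Qω = q E.ᴺ

    private
      length-elements : ∀ {z} → length elements E.ᴺ *ω z ≡ Qω *ω z
      length-elements {z} = cong (λ m → m E.ᴺ *ω z) order≡3^n

    ∑ᴱ-const : ∀ z → ∑ᴱ (λ _ → z) ≡ Qω *ω z
    ∑ᴱ-const z = trans (E.Σ-const elements z) length-elements

    orthogonality : ∀ x → x ≢ 0# → ∑ᴱ (λ a → ψ′ (- (a * x))) ≡ 0ω
    orthogonality x x≢0 = trans (E.Σ-cong elements (λ a → cong ψ′ (solve 2 (λ a x → :- (a :* x) := (:- x) :* a) refl a x)))
      (∑ψ-scaled (λ eq → x≢0 (trans (sym (-‿involutive x)) (trans (cong -_ eq) -0#≈0#))))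

    orthogonality-0 : ∑ᴱ (λ a → ψ′ (- (a * 0#))) ≡ Qω
    orthogonality-0 = trans (E.Σ-cong elements (λ a → trans (cong ψ′ (trans (cong -_ (zeroʳ a)) -0#≈0#)) ψ-0#)) (trans (∑ᴱ-const E.1#) (E.*-identityʳ Qω))

    hat : (X → ℤω) → X → ℤω
    hat f a = ∑ᴱ (λ x → f x *ω ψ′ (- (a * x)))

    ∑-hat : ∀ f → ∑ᴱ (hat f) ≡ Qω *ω f 0#
    ∑-hat f = begin
      ∑ᴱ (λ a → ∑ᴱ (λ x → f x *ω ψ′ (- (a * x)))) ≡⟨ E.Σ-swap elements elements (λ a x → f x *ω ψ′ (- (a * x))) ⟩
      ∑ᴱ (λ x → ∑ᴱ (λ a → f x *ω ψ′ (- (a * x)))) ≡⟨ E.Σ-cong elements (λ x → E.Σ-*ˡ elements (f x) (λ a → ψ′ (- (a * x)))) ⟩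
      ∑ᴱ (λ x → f x *ω ∑ᴱ (λ a → ψ′ (- (a * x)))) ≡⟨ ∑ᴱ-single 0# (λ x → f x *ω ∑ᴱ (λ a → ψ′ (- (a * x)))) (λ x x≢0 → trans (cong (f x *ω_) (orthogonality x x≢0)) (E.zeroʳ (f x))) ⟩
      f 0# *ω ∑ᴱ (λ a → ψ′ (- (a * 0#))) ≡⟨ cong (f 0# *ω_) orthogonality-0 ⟩
      f 0# *ω Qω ≡⟨ E.*-comm (f 0#) Qω ⟩
      Qω *ω f 0# ∎

    infixl 7 _⋆_
    _⋆_ : (X → ℤω) → (X → ℤω) → X → ℤω
    (f ⋆ g) t = ∑ᴱ (λ x → f x *ω g (- x + t))

    hat-⋆ : ∀ f g a → hat f a *ω hat g a ≡ hat (f ⋆ g) a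
    hat-⋆ f g a = begin
        hat f a *ω hat g a
      ≡⟨ E.Σ-*-Σ elements elements (λ x → f x *ω ψ′ (- (a * x))) (λ y → g y *ω ψ′ (- (a * y))) ⟩
        ∑ᴱ (λ x → ∑ᴱ (λ y → (f x *ω ψ′ (- (a * x))) *ω (g y *ω ψ′ (- (a * y)))))
      ≡⟨ E.Σ-cong elements (λ x → trans (E.Σ-cong elements (λ y → merge x y))
           (sym (∑ᴱ-translate (- x) (λ y → (f x *ω g y) *ω ψ′ (- (a * (x + y))))))) ⟩
        ∑ᴱ (λ x → ∑ᴱ (λ t → (f x *ω g (- x + t)) *ω ψ′ (- (a * (x + (- x + t))))))
      ≡⟨ E.Σ-swap elements elements (λ x t → (f x *ω g (- x + t)) *ω ψ′ (- (a * (x + (- x + t))))) ⟩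
        ∑ᴱ (λ t → ∑ᴱ (λ x → (f x *ω g (- x + t)) *ω ψ′ (- (a * (x + (- x + t))))))
      ≡⟨ E.Σ-cong elements (λ t → trans (E.Σ-cong elements (λ x → cong (λ y → (f x *ω g (- x + t)) *ω ψ′ (- (a * y)))
           (solve 2 (λ x t → x :+ (:- x :+ t) := t) refl x t))) (E.Σ-*ʳ elements (ψ′ (- (a * t))) (λ x → f x *ω g (- x + t)))) ⟩
        hat (f ⋆ g) a ∎
      where
      merge : ∀ x y → (f x *ω ψ′ (- (a * x))) *ω (g y *ω ψ′ (- (a * y))) ≡ (f x *ω g y) *ω ψ′ (- (a * (x + y)))
      merge x y = trans (E.solve 4 (λ a b c d → (a E.:* b) E.:* (c E.:* d) E.:= (a E.:* c) E.:* (b E.:* d)) refl (f x) (ψ′ (- (a * x))) (g y) (ψ′ (- (a * y))))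
        (cong ((f x *ω g y) *ω_) (trans (sym (ψ-+ _ _)) (cong ψ′ (solve 3 (λ a x y → :- (a :* x) :+ :- (a :* y) := :- (a :* (x :+ y))) refl a x y))))

    -- The product of the transforms is the transform of f ⋆ g, and summing this over a picks out
    -- its value at 0, where g is evaluated at -x.
    parseval : ∀ f g → ∑ᴱ (λ a → hat f a *ω hat g a) ≡ Qω *ω ∑ᴱ (λ x → f x *ω g (- x))
    parseval f g = trans (E.Σ-cong elements (hat-⋆ f g)) (trans (∑-hat (f ⋆ g))
      (cong (Qω *ω_) (E.Σ-cong elements (λ x → cong (λ y → f x *ω g y) (+-identityʳ (- x))))))

    f : X → ℤω
    f x = ψ′ (pow x d)

    W′ : X → ℤω
    W′ = W F n d

    W-hat : ∀ a → W′ a ≡ hat f a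
    W-hat a = E.Σ-cong elements (λ x → ψ-+ (pow x d) (- (a * x)))

    conj-Σ : ∀ {a} {A : Set a} (xs : List A) g → conj (E.Σ xs g) ≡ E.Σ xs (λ x → conj (g x))
    conj-Σ [] g = refl
    conj-Σ (x ∷ xs) g = trans (conj-+ (g x) (E.Σ xs g)) (cong (conj (g x) +ω_) (conj-Σ xs g))

    -- Conjugation replaces ψ(y) by ψ(-y). As x^d is odd, the substitution x ↦ -x undoes this.
    W-real : ∀ a → W′ a ≡ embℤ (proj₁ (W′ a))
    W-real a = conj-fixed (begin
        conj (W′ a) ≡⟨ conj-Σ elements (λ x → ψ′ (pow x d + - (a * x))) ⟩
        ∑ᴱ (λ x → conj (ψ′ (pow x d + - (a * x)))) ≡⟨ E.Σ-cong elements (λ x → trans (sym (ψ-neg (pow x d + - (a * x)))) (cong ψ′ (odd x))) ⟩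
        ∑ᴱ (λ x → ψ′ (pow (- x) d + - (a * - x))) ≡⟨ ∑ᴱ-neg (λ x → ψ′ (pow x d + - (a * x))) ⟩
        W′ a ∎)
      where
      odd : ∀ x → - (pow x d + - (a * x)) ≡ pow (- x) d + - (a * - x)
      odd x = trans (solve 3 (λ p a x → :- (p :+ :- (a :* x)) := :- p :+ :- (a :* :- x)) refl (pow x d) a x) (cong (_+ - (a * - x)) (sym (pow-d-neg x)))

    -- x^d permutes F, so this is the complete sum of ψ. Consequently the moments over F are also
    -- the moments over F^×.
    W-0 : W′ 0# ≡ 0ω
    W-0 = trans (E.Σ-cong elements (λ x → cong ψ′ (trans (cong (λ y → pow x d + - y) (zeroˡ x)) (trans (cong (pow x d +_) -0#≈0#) (+-identityʳ _)))))
      (trans (∑ᴱ-reindex pow-d-injective ψ′) ∑ψ≡0)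

    moment-1 : ∑ᴱ W′ ≡ Qω
    moment-1 = trans (E.Σ-cong elements W-hat) (trans (∑-hat f) (trans (cong (Qω *ω_) (trans (cong ψ′ (pow-0# d d≢0)) ψ-0#)) (E.*-identityʳ Qω)))

    moment-2 : ∑ᴱ (λ a → W′ a *ω W′ a) ≡ Qω *ω Qω
    moment-2 = trans (E.Σ-cong elements (λ a → cong₂ _*ω_ (W-hat a) (W-hat a))) (trans (parseval f f) (cong (Qω *ω_)
      (trans (E.Σ-cong elements (λ x → trans (sym (ψ-+ (pow x d) (pow (- x) d))) (trans (cong ψ′ (trans (cong (pow x d +_) (pow-d-neg x)) (-‿inverseʳ _))) ψ-0#)))
        (trans (∑ᴱ-const E.1#) (E.*-identityʳ Qω)))))

    ∑³ : (X → X → X → ℤω) → ℤω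
    ∑³ g = ∑ᴱ (λ A → ∑ᴱ (λ B → ∑ᴱ (λ C → g A B C)))

    ∑³-cong : ∀ {g h} → (∀ A B C → g A B C ≡ h A B C) → ∑³ g ≡ ∑³ h
    ∑³-cong eq = E.Σ-cong elements (λ A → E.Σ-cong elements (λ B → E.Σ-cong elements (eq A B)))

    ∑³-reindex : ∀ {h : X → X} → (∀ {x y} → h x ≡ h y → x ≡ y) → ∀ g → ∑³ (λ A B C → g (h A) (h B) (h C)) ≡ ∑³ g
    ∑³-reindex {h} inj g = trans
      (E.Σ-cong elements (λ A → trans (E.Σ-cong elements (λ B → ∑ᴱ-reindex inj (g (h A) (h B)))) (∑ᴱ-reindex inj (λ B → ∑ᴱ (g (h A) B)))))
      (∑ᴱ-reindex inj (λ A → ∑ᴱ (λ B → ∑ᴱ (g A B))))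

    ∑³-product : ∀ u v w → ∑³ (λ A B C → u A *ω (v B *ω w C)) ≡ ∑ᴱ u *ω (∑ᴱ v *ω ∑ᴱ w)
    ∑³-product u v w = trans (E.Σ-cong elements (λ A → trans (E.Σ-cong elements (λ B → trans (E.Σ-*ˡ elements (u A) (λ C → v B *ω w C))
        (cong (u A *ω_) (E.Σ-*ˡ elements (v B) w)))) (trans (E.Σ-*ˡ elements (u A) (λ B → v B *ω ∑ᴱ w)) (cong (u A *ω_) (E.Σ-*ʳ elements (∑ᴱ w) v)))))
      (E.Σ-*ʳ elements (∑ᴱ v *ω ∑ᴱ w) u)

    ∑³-+ : ∀ g h → ∑³ (λ A B C → g A B C +ω h A B C) ≡ ∑³ g +ω ∑³ h
    ∑³-+ g h = trans (E.Σ-cong elements (λ A → trans (E.Σ-cong elements (λ B → E.Σ-+ elements (g A B) (h A B))) (E.Σ-+ elements (λ B → ∑ᴱ (g A B)) (λ B → ∑ᴱ (h A B)))))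
      (E.Σ-+ elements (λ A → ∑ᴱ (λ B → ∑ᴱ (g A B))) (λ A → ∑ᴱ (λ B → ∑ᴱ (h A B))))

    ∑³-*ˡ : ∀ c g → ∑³ (λ A B C → c *ω g A B C) ≡ c *ω ∑³ g
    ∑³-*ˡ c g = trans (E.Σ-cong elements (λ A → trans (E.Σ-cong elements (λ B → E.Σ-*ˡ elements c (g A B))) (E.Σ-*ˡ elements c (λ B → ∑ᴱ (g A B)))))
      (E.Σ-*ˡ elements c (λ A → ∑ᴱ (λ B → ∑ᴱ (g A B))))

    Φ : X → X → X → X
    Φ A B C = frob A * (B * C) + (frob B * (A * C) + frob C * (A * B))

    private
      -- The three partial sums A = p₁+p₂, B = p₂+p₃, C = p₁+p₃ of four numbers with p₁+p₂+p₃+p₄ = 0,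
      -- up to signs, turn the cubic form x^L x² into its polarisation Φ.
      polarisation : ∀ A B C → let x = - (A + C) + B ; y = - x + C in
        (pow x d + pow (- x + A) d) + (pow y d + pow (- y + - A) d) ≡ - Φ A B C
      polarisation A B C = begin
          (pow x d + pow (- x + A) d) + (pow y d + pow (- y + - A) d)
        ≡⟨ cong₂ (λ u v → (pow x d + pow u d) + v) (char3 (solve 3 (λ A B C → :- (:- (A :+ C) :+ B) :+ A := (C :+ (:- A :+ :- B)) :+ con (ℤ.+ 3) :* A) refl A B C))
             (cong₂ (λ u v → pow u d + pow v d) (char3 (solve 3 (λ A B C → :- (:- (A :+ C) :+ B) :+ C := (A :+ (:- B :+ :- C)) :+ con (ℤ.+ 3) :* C) refl A B C))
               (char3 (solve 3 (λ A B C → :- (:- (:- (A :+ C) :+ B) :+ C) :+ :- A := (A :+ (B :+ C)) :+ con (ℤ.+ 3) :* (:- (A :+ C))) refl A B C))) ⟩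
          (pow x d + pow (C + (- A + - B)) d) + (pow (A + (- B + - C)) d + pow (A + (B + C)) d)
        ≡⟨ cong₂ _+_ (cong₂ _+_ (trans (pow-d x) (cong (_* (x * x)) (trans (frob-+ _ B) (cong (_+ b) (trans (frob-neg (A + C)) (cong -_ (frob-+ A C)))))))
               (trans (pow-d _) (cong (_* _) (trans (frob-+ C _) (cong (c +_) (trans (frob-+ _ _) (cong₂ _+_ (frob-neg A) (frob-neg B))))))))
             (cong₂ _+_ (trans (pow-d _) (cong (_* _) (trans (frob-+ A _) (cong (a +_) (trans (frob-+ _ _) (cong₂ _+_ (frob-neg B) (frob-neg C)))))))
               (trans (pow-d _) (cong (_* _) (trans (frob-+ A _) (cong (a +_) (frob-+ B C)))))) ⟩
          ((- (a + c) + b) * (x * x) + (c + (- a + - b)) * ((C + (- A + - B)) * (C + (- A + - B))))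
            + ((a + (- b + - c)) * ((A + (- B + - C)) * (A + (- B + - C))) + (a + (b + c)) * ((A + (B + C)) * (A + (B + C))))
        ≡⟨ solve 6 (λ A B C a b c →
               ((:- (a :+ c) :+ b) :* ((:- (A :+ C) :+ B) :* (:- (A :+ C) :+ B)) :+ (c :+ (:- a :+ :- b)) :* ((C :+ (:- A :+ :- B)) :* (C :+ (:- A :+ :- B))))
                 :+ ((a :+ (:- b :+ :- c)) :* ((A :+ (:- B :+ :- C)) :* (A :+ (:- B :+ :- C))) :+ (a :+ (b :+ c)) :* ((A :+ (B :+ C)) :* (A :+ (B :+ C))))
               := :- (a :* (B :* C) :+ (b :* (A :* C) :+ c :* (A :* B)))
                 :+ con (ℤ.+ 3) :* (con (ℤ.+ 3) :* (a :* (B :* C) :+ (b :* (A :* C) :+ c :* (A :* B))))) refl A B C a b c ⟩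
          - Φ A B C + 3 ᴺ * (3 ᴺ * Φ A B C)
        ≡⟨ +3*≡ _ _ ⟩
          - Φ A B C ∎
        where
        x = - (A + C) + B
        y = - x + C
        a = frob A
        b = frob B
        c = frob C
        char3 : ∀ {u v w} → u ≡ v + 3 ᴺ * w → u ≡ v
        char3 {v = v} {w} eq = trans eq (+3*≡ v w)

    S : ℤω
    S = ∑³ (λ A B C → ψ′ (- Φ A B C))

    -- Both factors of the fourth power are transforms of f ⋆ f, so the moment runs over quadruples
    -- x, A - x, y, -A - y of sum 0. They are parametrised by A, C = x + y and B = x + A + C.
    moment-4-as-S : ∑ᴱ (λ a → (W′ a *ω W′ a) *ω (W′ a *ω W′ a)) ≡ Qω *ω S
    moment-4-as-S = begin
        ∑ᴱ (λ a → (W′ a *ω W′ a) *ω (W′ a *ω W′ a))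
      ≡⟨ E.Σ-cong elements (λ a → cong (λ z → z *ω z) (trans (cong₂ _*ω_ (W-hat a) (W-hat a)) (hat-⋆ f f a))) ⟩
        ∑ᴱ (λ a → hat (f ⋆ f) a *ω hat (f ⋆ f) a)
      ≡⟨ parseval (f ⋆ f) (f ⋆ f) ⟩
        Qω *ω ∑ᴱ (λ t → (f ⋆ f) t *ω (f ⋆ f) (- t))
      ≡⟨ cong (Qω *ω_) (E.Σ-cong elements fibre) ⟩
        Qω *ω S ∎
      where
      G : X → X → X → ℤω
      G t x y = ψ′ ((pow x d + pow (- x + t) d) + (pow y d + pow (- y + - t) d))

      merge : ∀ t x y → (f x *ω f (- x + t)) *ω (f y *ω f (- y + - t)) ≡ G t x y
      merge t x y = sym (trans (ψ-+ _ _) (cong₂ _*ω_ (ψ-+ _ _) (ψ-+ _ _)))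

      fibre : ∀ A → (f ⋆ f) A *ω (f ⋆ f) (- A) ≡ ∑ᴱ (λ B → ∑ᴱ (λ C → ψ′ (- Φ A B C)))
      fibre A = begin
          (f ⋆ f) A *ω (f ⋆ f) (- A)
        ≡⟨ E.Σ-*-Σ elements elements (λ x → f x *ω f (- x + A)) (λ y → f y *ω f (- y + - A)) ⟩
          ∑ᴱ (λ x → ∑ᴱ (λ y → (f x *ω f (- x + A)) *ω (f y *ω f (- y + - A))))
        ≡⟨ E.Σ-cong elements (λ x → trans (E.Σ-cong elements (merge A x)) (sym (∑ᴱ-translate (- x) (G A x)))) ⟩
          ∑ᴱ (λ x → ∑ᴱ (λ C → G A x (- x + C)))
        ≡⟨ E.Σ-swap elements elements (λ x C → G A x (- x + C)) ⟩
          ∑ᴱ (λ C → ∑ᴱ (λ x → G A x (- x + C)))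
        ≡⟨ E.Σ-cong elements (λ C → sym (∑ᴱ-translate (- (A + C)) (λ x → G A x (- x + C)))) ⟩
          ∑ᴱ (λ C → ∑ᴱ (λ B → G A (- (A + C) + B) (- (- (A + C) + B) + C)))
        ≡⟨ E.Σ-cong elements (λ C → E.Σ-cong elements (λ B → cong ψ′ (polarisation A B C))) ⟩
          ∑ᴱ (λ C → ∑ᴱ (λ B → ψ′ (- Φ A B C)))
        ≡⟨ E.Σ-swap elements elements (λ C B → ψ′ (- Φ A B C)) ⟩
          ∑ᴱ (λ B → ∑ᴱ (λ C → ψ′ (- Φ A B C))) ∎

    χ : X → ℤω
    χ v with v ≟ 0#
    ... | yes _ = E.1#
    ... | no _ = 0ω

    χ-0 : ∀ {v} → v ≡ 0# → χ v ≡ E.1#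
    χ-0 {v} eq with v ≟ 0#
    ... | yes _ = refl
    ... | no ne = contradiction eq ne

    χ-≢0 : ∀ {v} → v ≢ 0# → χ v ≡ 0ω
    χ-≢0 {v} ne with v ≟ 0#
    ... | yes eq = contradiction eq ne
    ... | no _ = refl

    ∑χ : ∑ᴱ χ ≡ E.1#
    ∑χ = trans (∑ᴱ-single 0# χ (λ x → χ-≢0)) (χ-0 refl)

    q-1ω : ℤω
    q-1ω = q-1 E.ᴺ

    Qω≡ : Qω ≡ E.1# +ω q-1ω
    Qω≡ = trans (cong E._ᴺ (sym q≡)) (E.ᴺ-suc q-1)

    zeros : ℤω
    zeros = ∑³ (λ A B C → χ (Φ A B C))

    Φ-scale : ∀ c A B C → Φ (c * A) (c * B) (c * C) ≡ pow c d * Φ A B C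
    Φ-scale c A B C = trans (cong₂ _+_ (cong (_* (c * B * (c * C))) (pow-distrib c A L))
        (cong₂ _+_ (cong (_* (c * A * (c * C))) (pow-distrib c B L)) (cong (_* (c * A * (c * B))) (pow-distrib c C L))))
      (trans (solve 8 (λ c l A B C a b e → (l :* a) :* (c :* B :* (c :* C)) :+ ((l :* b) :* (c :* A :* (c :* C)) :+ (l :* e) :* (c :* A :* (c :* B)))
          := (l :* (c :* c)) :* (a :* (B :* C) :+ (b :* (A :* C) :+ e :* (A :* B)))) refl c (frob c) A B C (frob A) (frob B) (frob C))
        (cong (_* Φ A B C) (sym (pow-d c))))

    -- Scaling A, B and C by c multiplies Φ by c^d, so T(c) = S for c ≠ 0, while T(0) = q³. As c
    -- runs over F so does c^d, and the sum over c detects Φ = 0.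
    S-zeros : Qω *ω (Qω *ω Qω) +ω q-1ω *ω S ≡ Qω *ω zeros
    S-zeros = begin
        Qω *ω (Qω *ω Qω) +ω q-1ω *ω S
      ≡⟨ sym (trans (∑ᴱ-split T) (cong₂ _+ω_ T-0 (trans (E.Σ-cong-∈ nz (λ c∈ → T-≢0 (nz-∈ c∈))) (E.Σ-const nz S)))) ⟩
        ∑ᴱ T
      ≡⟨ trans (E.Σ-swap elements elements (λ c A → ∑ᴱ (λ B → ∑ᴱ (λ C → t c A B C))))
           (E.Σ-cong elements (λ A → trans (E.Σ-swap elements elements (λ c B → ∑ᴱ (λ C → t c A B C)))
             (E.Σ-cong elements (λ B → E.Σ-swap elements elements (λ c C → t c A B C))))) ⟩
        ∑³ (λ A B C → ∑ᴱ (λ c → t c A B C))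
      ≡⟨ ∑³-cong (λ A B C → indicator (Φ A B C)) ⟩
        ∑³ (λ A B C → Qω *ω χ (Φ A B C))
      ≡⟨ ∑³-*ˡ Qω (λ A B C → χ (Φ A B C)) ⟩
        Qω *ω zeros ∎
      where
      t : X → X → X → X → ℤω
      t c A B C = ψ′ (- (pow c d * Φ A B C))

      T : X → ℤω
      T c = ∑³ (t c)

      T-0 : T 0# ≡ Qω *ω (Qω *ω Qω)
      T-0 = trans (∑³-cong (λ A B C → trans (cong ψ′ (trans (cong (λ y → - (y * Φ A B C)) (pow-0# d d≢0)) (trans (cong -_ (zeroˡ _)) -0#≈0#)))
          (trans ψ-0# (sym (trans (E.*-identityˡ (E.1# *ω E.1#)) (E.*-identityˡ E.1#))))))
        (trans (∑³-product (λ _ → E.1#) (λ _ → E.1#) (λ _ → E.1#)) (cong (λ z → z *ω (z *ω z)) (trans (∑ᴱ-const E.1#) (E.*-identityʳ Qω))))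

      T-≢0 : ∀ {c} → c ≢ 0# → T c ≡ S
      T-≢0 {c} c≢0 = trans (∑³-cong (λ A B C → cong (λ y → ψ′ (- y)) (sym (Φ-scale c A B C))))
        (∑³-reindex (*-cancelˡ c≢0) (λ A B C → ψ′ (- Φ A B C)))

      indicator : ∀ v → ∑ᴱ (λ c → ψ′ (- (pow c d * v))) ≡ Qω *ω χ v
      indicator v = trans (∑ᴱ-reindex pow-d-injective (λ c → ψ′ (- (c * v)))) (evaluate v)
        where
        evaluate : ∀ v → ∑ᴱ (λ c → ψ′ (- (c * v))) ≡ Qω *ω χ v
        evaluate v with v ≟ 0#
        ... | yes refl = trans orthogonality-0 (sym (E.*-identityʳ Qω))
        ... | no v≢0 = trans (orthogonality v v≢0) (sym (E.zeroʳ Qω))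

    -- This congruence makes h = (L - 1)/2 odd. Hence (-1)^h = -1, on which both the injectivity of
    -- x^h and the argument that -1 is no square depend.
    module OddExponent (g : ℕ) (L≡4g+3 : L ≡ 4 ℕ.* g ℕ.+ 3) where

      h : ℕ
      h = suc (2 ℕ.* g)

      L≡2h+1 : L ≡ suc (h ℕ.+ h)
      L≡2h+1 = trans L≡4g+3 (rearrange g)
        where
        rearrange : ∀ g → 4 ℕ.* g ℕ.+ 3 ≡ suc (suc (2 ℕ.* g) ℕ.+ suc (2 ℕ.* g))
        rearrange = ℕ-Solver.solve-∀

      κ : X → X
      κ x = pow x h

      frob-κ : ∀ x → frob x ≡ x * (κ x * κ x)
      frob-κ x = trans (cong (pow x) L≡2h+1) (cong (x *_) (pow-+ x h h))

      neg-1-h : pow (- 1#) h ≡ - 1#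
      neg-1-h = trans (cong (- 1# *_) (trans (pow-* (- 1#) 2 g) (trans (cong (λ y → pow y g)
        (solve 0 (:- con (ℤ.+ 1) :* (:- con (ℤ.+ 1) :* con (ℤ.+ 1)) := con (ℤ.+ 1)) refl)) (pow-1# g)))) (*-identityʳ _)

      -1≢1 : - 1# ≢ 1#
      -1≢1 eq = 2≢0 (trans (cong (1# +_) (sym eq)) (-‿inverseʳ 1#))

      -- From u^h = 1 follows u^L = u, hence u³ = u^(L⁴) = u. This leaves ±1, and -1 is excluded
      -- because h is odd.
      κ-kernel : ∀ {u} → u ≢ 0# → κ u ≡ 1# → u ≡ 1#
      κ-kernel {u} u≢0 κu≡1 with prime-field u³≡u
        where
        frob-u : frob u ≡ u
        frob-u = trans (frob-κ u) (trans (cong (λ y → u * (y * y)) κu≡1) (trans (cong (u *_) (*-identityˡ 1#)) (*-identityʳ u)))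
        u³≡u : pow u 3 ≡ u
        u³≡u = trans (sym (frob⁴ u)) (trans (cong (λ y → frob (frob (frob y))) frob-u) (trans (cong (λ y → frob (frob y)) frob-u) (trans (cong frob frob-u) frob-u)))
      ... | inj₁ u≡0 = contradiction u≡0 u≢0
      ... | inj₂ (inj₁ u≡1) = u≡1
      ... | inj₂ (inj₂ u≡2) = contradiction (trans (sym neg-1-h) (trans (cong κ (sym (trans u≡2 2≡-1))) κu≡1)) -1≢1
        where
        2≡-1 : 1# + 1# ≡ - 1#
        2≡-1 = trans (solve 0 (con (ℤ.+ 1) :+ con (ℤ.+ 1) := :- con (ℤ.+ 1) :+ con (ℤ.+ 3) :* con (ℤ.+ 1)) refl) (+3*≡ _ _)

      κ-injective : ∀ {x y} → κ x ≡ κ y → x ≡ y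
      κ-injective = pow-injective h (λ ()) κ-kernel

      κ-0 : κ 0# ≡ 0#
      κ-0 = zeroˡ _

      -- -1 is no square in F: if u² = -1, then u^L = u (u²)^h = -u, so u = u^(L⁴) = u³ = -u, which
      -- forces u = 0.
      squares-sum : ∀ {y z} → y * y + z * z ≡ 0# → z ≡ 0#
      squares-sum {y} {z} eq with z ≟ 0#
      ... | yes z≡0 = z≡0
      ... | no z≢0 = contradiction u≡0 u≢0
        where
        u = y * inv z
        u² : u * u ≡ - 1#
        u² = trans (solve 2 (λ y w → (y :* w) :* (y :* w) := (y :* y) :* (w :* w)) refl y (inv z))
          (trans (cong (_* (inv z * inv z)) (trans (solve 2 (λ y z → y := (y :+ z) :- z) refl (y * y) (z * z)) (trans (cong (_- z * z) eq) (+-identityˡ _))))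
          (trans (solve 2 (λ z w → (:- (z :* z)) :* (w :* w) := :- ((z :* w) :* (z :* w))) refl z (inv z))
          (cong -_ (trans (cong₂ _*_ (inv-inverse z≢0) (inv-inverse z≢0)) (*-identityˡ 1#)))))
        frob-u : frob u ≡ - u
        frob-u = trans (frob-κ u) (trans (cong (u *_) (trans (sym (pow-distrib u u h)) (trans (cong κ u²) neg-1-h)))
          (solve 1 (λ u → u :* (:- con (ℤ.+ 1)) := :- u) refl u))
        frob²-u : frob (frob u) ≡ u
        frob²-u = trans (cong frob frob-u) (trans (frob-neg u) (trans (cong -_ frob-u) (-‿involutive u)))
        u≡-u : u ≡ - u
        u≡-u = trans (sym (trans (cong (λ y → frob (frob y)) frob²-u) frob²-u)) (trans (frob⁴ u)
          (trans (solve 1 (λ u → u :* (u :* (u :* con (ℤ.+ 1))) := u :* (u :* u)) refl u) (trans (cong (u *_) u²) (solve 1 (λ u → u :* (:- con (ℤ.+ 1)) := :- u) refl u))))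
        u≡0 : u ≡ 0#
        u≡0 = trans (solve 1 (λ u → u := con (ℤ.+ 3) :* u :- (u :- (:- u))) refl u) (trans (cong₂ _-_ (3*≡0 u) (trans (cong (λ v → u - v) (sym u≡-u)) (-‿inverseʳ u))) (-‿inverseʳ 0#))
        u≢0 : u ≢ 0#
        u≢0 u≡0 = 1≢0 (trans (sym (-‿involutive 1#)) (trans (cong -_ (trans (sym u²) (trans (cong (_* u) u≡0) (zeroˡ u)))) -0#≈0#))

      Sq : X → X → X → X
      Sq A B C = A * A + (B * B + C * C)

      Φ-κ : ∀ A B C → Φ A B C ≡ (A * (B * C)) * Sq (κ A) (κ B) (κ C)
      Φ-κ A B C = trans (cong₂ _+_ (cong (_* (B * C)) (frob-κ A)) (cong₂ _+_ (cong (_* (A * C)) (frob-κ B)) (cong (_* (A * B)) (frob-κ C))))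
        (solve 6 (λ A B C a b c → (A :* (a :* a)) :* (B :* C) :+ ((B :* (b :* b)) :* (A :* C) :+ (C :* (c :* c)) :* (A :* B))
          := (A :* (B :* C)) :* (a :* a :+ (b :* b :+ c :* c))) refl A B C (κ A) (κ B) (κ C))

      χ̄ : X → ℤω
      χ̄ x = E.1# +ω (-ω χ x)

      -- This is 1 on the union of the coordinate planes without the origin, and 0 elsewhere. At
      -- exactly these points Φ vanishes while the quadric does not, since a sum of two squares
      -- vanishes only trivially.
      correction : X → X → X → ℤω
      correction A B C = (E.1# +ω (-ω (χ̄ A *ω (χ̄ B *ω χ̄ C)))) +ω (-ω (χ A *ω (χ B *ω χ C)))

      χ-Φ : ∀ A B C → χ (Φ A B C) ≡ χ (Sq (κ A) (κ B) (κ C)) +ω correction A B C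
      χ-Φ A B C = by-cases (A ≟ 0#) (B ≟ 0#) (C ≟ 0#)
        where
        two-squares : ∀ y z → χ (κ y * κ y + κ z * κ z) ≡ χ y *ω χ z
        two-squares y z with z ≟ 0#
        ... | no z≢0 = trans (χ-≢0 (λ eq → z≢0 (pow-≡0 h (squares-sum eq)))) (sym (E.zeroʳ (χ y)))
        ... | yes refl with y ≟ 0#
        ...   | no y≢0 = trans (χ-≢0 (λ eq → y≢0 (pow-≡0 h (squares-sum (trans (+-comm _ _) eq))))) (sym (E.zeroˡ E.1#))
        ...   | yes refl = trans (χ-0 (trans (cong (λ y → y * y + y * y) κ-0) (trans (cong (λ y → y + y) (zeroˡ 0#)) (+-identityˡ 0#)))) (sym (E.*-identityˡ E.1#))

        degenerate : ∀ {y z w} → Φ A B C ≡ 0# → w ≡ κ y * κ y + κ z * κ z → correction A B C ≡ E.1# +ω (-ω (χ y *ω χ z)) →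
          χ (Φ A B C) ≡ χ w +ω correction A B C
        degenerate {y} {z} Φ≡0 w≡ corr≡ = trans (χ-0 Φ≡0) (sym (trans (cong₂ _+ω_ (trans (cong χ w≡) (two-squares y z)) corr≡)
          (E.solve 1 (λ v → v E.:+ (E.con (ℤ.+ 1) E.:+ (E.:- v)) E.:= E.con (ℤ.+ 1)) refl (χ y *ω χ z))))

        K : ℤω → ℤω → ℤω → ℤω
        K a b c = (E.1# +ω (-ω ((E.1# +ω (-ω a)) *ω ((E.1# +ω (-ω b)) *ω (E.1# +ω (-ω c)))))) +ω (-ω (a *ω (b *ω c)))

        Kᵖ : ∀ {n} → E.Polynomial n → E.Polynomial n → E.Polynomial n → E.Polynomial n
        Kᵖ a b c = (:1 E.:+ (E.:- ((:1 E.:+ (E.:- a)) E.:* ((:1 E.:+ (E.:- b)) E.:* (:1 E.:+ (E.:- c)))))) E.:+ (E.:- (a E.:* (b E.:* c)))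
          where
          :1 : ∀ {n} → E.Polynomial n
          :1 = E.con (ℤ.+ 1)

        κ²-0 : ∀ {x} → x ≡ 0# → κ x * κ x ≡ 0#
        κ²-0 x≡0 = trans (cong (λ y → κ y * κ y) x≡0) (trans (cong (_* κ 0#) κ-0) (zeroˡ _))

        by-cases : Dec (A ≡ 0#) → Dec (B ≡ 0#) → Dec (C ≡ 0#) → χ (Φ A B C) ≡ χ (Sq (κ A) (κ B) (κ C)) +ω correction A B C
        by-cases (yes A≡0) _ _ = degenerate {B} {C}
          (trans (Φ-κ A B C) (trans (cong (_* Sq (κ A) (κ B) (κ C)) (trans (cong (_* (B * C)) A≡0) (zeroˡ _))) (zeroˡ _)))
          (trans (cong (_+ (κ B * κ B + κ C * κ C)) (κ²-0 A≡0)) (+-identityˡ _))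
          (trans (cong (λ a → K a (χ B) (χ C)) (χ-0 A≡0)) (E.solve 2 (λ b c → Kᵖ (E.con (ℤ.+ 1)) b c E.:= E.con (ℤ.+ 1) E.:+ (E.:- (b E.:* c))) refl (χ B) (χ C)))
        by-cases (no _) (yes B≡0) _ = degenerate {A} {C}
          (trans (Φ-κ A B C) (trans (cong (_* Sq (κ A) (κ B) (κ C)) (trans (cong (A *_) (trans (cong (_* C) B≡0) (zeroˡ C))) (zeroʳ A))) (zeroˡ _)))
          (cong (κ A * κ A +_) (trans (cong (_+ κ C * κ C) (κ²-0 B≡0)) (+-identityˡ _)))
          (trans (cong (λ b → K (χ A) b (χ C)) (χ-0 B≡0)) (E.solve 2 (λ a c → Kᵖ a (E.con (ℤ.+ 1)) c E.:= E.con (ℤ.+ 1) E.:+ (E.:- (a E.:* c))) refl (χ A) (χ C)))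
        by-cases (no _) (no _) (yes C≡0) = degenerate {A} {B}
          (trans (Φ-κ A B C) (trans (cong (_* Sq (κ A) (κ B) (κ C)) (trans (cong (A *_) (trans (cong (B *_) C≡0) (zeroʳ B))) (zeroʳ A))) (zeroˡ _)))
          (cong (κ A * κ A +_) (trans (cong (κ B * κ B +_) (κ²-0 C≡0)) (+-identityʳ _)))
          (trans (cong (λ c → K (χ A) (χ B) c) (χ-0 C≡0)) (E.solve 2 (λ a b → Kᵖ a b (E.con (ℤ.+ 1)) E.:= E.con (ℤ.+ 1) E.:+ (E.:- (a E.:* b))) refl (χ A) (χ B)))
        by-cases (no A≢0) (no B≢0) (no C≢0) = trans same (sym (trans (cong (χ (Sq (κ A) (κ B) (κ C)) +ω_)
            (trans (cong₂ (λ a b → K a b (χ C)) (χ-≢0 A≢0) (χ-≢0 B≢0)) (trans (cong (K 0ω 0ω) (χ-≢0 C≢0))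
              (E.solve 0 (Kᵖ (E.con (ℤ.+ 0)) (E.con (ℤ.+ 0)) (E.con (ℤ.+ 0)) E.:= E.con (ℤ.+ 0)) refl)))) (E.+-identityʳ _)))
          where
          same : χ (Φ A B C) ≡ χ (Sq (κ A) (κ B) (κ C))
          same with Sq (κ A) (κ B) (κ C) ≟ 0#
          ... | yes eq = χ-0 (trans (Φ-κ A B C) (trans (cong (A * (B * C) *_) eq) (zeroʳ _)))
          ... | no ne = χ-≢0 (λ eq → *-≢0 (*-≢0 A≢0 (*-≢0 B≢0 C≢0)) ne (trans (sym (Φ-κ A B C)) eq))

      -- In characteristic three (1, 1, 1) is isotropic. With B = A + u and C = A - u + s the terms
      -- in A² cancel, and the equation is linear in A with coefficient -s: one solution for each s
      -- ≠ 0, while s = 0 leaves 2u² = 0.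
      quadric : ∑³ (λ A B C → χ (Sq A B C)) ≡ Qω *ω Qω
      quadric = begin
          ∑³ (λ A B C → χ (Sq A B C))
        ≡⟨ E.Σ-cong elements (λ A → trans (sym (∑ᴱ-translate A (λ B → ∑ᴱ (λ C → χ (Sq A B C)))))
             (E.Σ-cong elements (λ u → sym (∑ᴱ-translate (A + - u) (λ C → χ (Sq A (A + u) C)))))) ⟩
          ∑³ (λ A u s → χ (Sq A (A + u) (A + - u + s)))
        ≡⟨ ∑³-cong (λ A u s → cong χ (line A u s)) ⟩
          ∑³ (λ A u s → χ (w u s - A * s))
        ≡⟨ trans (E.Σ-swap elements elements (λ A u → ∑ᴱ (λ s → χ (w u s - A * s)))) (E.Σ-cong elements (λ u → E.Σ-swap elements elements (λ A s → χ (w u s - A * s)))) ⟩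
          ∑ᴱ (λ u → ∑ᴱ (λ s → ∑ᴱ (λ A → χ (w u s - A * s))))
        ≡⟨ E.Σ-cong elements (λ u → trans (∑ᴱ-split (λ s → ∑ᴱ (λ A → χ (w u s - A * s)))) (cong₂ _+ω_ (isotropic u)
             (trans (E.Σ-cong-∈ nz (λ s∈ → generic u (nz-∈ s∈))) (trans (E.Σ-const nz E.1#) (E.*-identityʳ q-1ω))))) ⟩
          ∑ᴱ (λ u → Qω *ω χ u +ω q-1ω)
        ≡⟨ trans (E.Σ-+ elements (λ u → Qω *ω χ u) (λ _ → q-1ω)) (cong₂ _+ω_ (trans (E.Σ-*ˡ elements Qω χ) (cong (Qω *ω_) ∑χ)) (∑ᴱ-const q-1ω)) ⟩
          Qω *ω E.1# +ω Qω *ω q-1ω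
        ≡⟨ trans (sym (E.distribˡ Qω E.1# q-1ω)) (cong (Qω *ω_) (sym Qω≡)) ⟩
          Qω *ω Qω ∎
        where
        w : X → X → X
        w u s = u * u + (- u + s) * (- u + s)

        line : ∀ A u s → Sq A (A + u) (A + - u + s) ≡ w u s - A * s
        line A u s = trans (solve 3 (λ A u s → A :* A :+ ((A :+ u) :* (A :+ u) :+ (A :+ :- u :+ s) :* (A :+ :- u :+ s))
            := (u :* u :+ (:- u :+ s) :* (:- u :+ s) :- A :* s) :+ con (ℤ.+ 3) :* (A :* A :+ A :* s)) refl A u s) (+3*≡ _ _)

        isotropic : ∀ u → ∑ᴱ (λ A → χ (w u 0# - A * 0#)) ≡ Qω *ω χ u
        isotropic u = trans (E.Σ-cong elements (λ A → cong χ (solve 2 (λ A u → (u :* u :+ (:- u :+ con (ℤ.+ 0)) :* (:- u :+ con (ℤ.+ 0))) :- A :* con (ℤ.+ 0) := (con (ℤ.+ 1) :+ con (ℤ.+ 1)) :* (u :* u)) refl A u)))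
            (trans (∑ᴱ-const (χ ((1# + 1#) * (u * u)))) (cong (Qω *ω_) same))
          where
          same : χ ((1# + 1#) * (u * u)) ≡ χ u
          same with u ≟ 0#
          ... | yes refl = χ-0 (trans (cong ((1# + 1#) *_) (zeroˡ 0#)) (zeroʳ _))
          ... | no u≢0 = χ-≢0 (*-≢0 2≢0 (*-≢0 u≢0 u≢0))

        generic : ∀ u {s} → s ≢ 0# → ∑ᴱ (λ A → χ (w u s - A * s)) ≡ E.1#
        generic u {s} s≢0 = trans (∑ᴱ-single (w u s * inv s) (λ A → χ (w u s - A * s)) (λ A A≢ → χ-≢0 (λ eq → A≢ (unique-root A eq))))
            (χ-0 (trans (cong (λ y → w u s - y) (trans (*-assoc (w u s) (inv s) s) (trans (cong (w u s *_) inv*s) (*-identityʳ _)))) (-‿inverseʳ _)))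
          where
          inv*s : inv s * s ≡ 1#
          inv*s = trans (*-comm _ s) (inv-inverse s≢0)
          unique-root : ∀ A → w u s - A * s ≡ 0# → A ≡ w u s * inv s
          unique-root A eq = sym (trans (cong (_* inv s) (x-y≡0⇒x≡y eq)) (trans (*-assoc A s (inv s)) (trans (cong (A *_) (inv-inverse s≢0)) (*-identityʳ A))))

      zeros≡ : zeros ≡ Qω *ω Qω +ω ((Qω *ω (Qω *ω Qω) +ω (-ω (q-1ω *ω (q-1ω *ω q-1ω)))) +ω (-ω E.1#))
      zeros≡ = begin
          zeros
        ≡⟨ ∑³-cong χ-Φ ⟩
          ∑³ (λ A B C → χ (Sq (κ A) (κ B) (κ C)) +ω correction A B C)
        ≡⟨ ∑³-+ (λ A B C → χ (Sq (κ A) (κ B) (κ C))) correction ⟩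
          ∑³ (λ A B C → χ (Sq (κ A) (κ B) (κ C))) +ω ∑³ correction
        ≡⟨ cong₂ _+ω_ (trans (∑³-reindex κ-injective (λ A B C → χ (Sq A B C))) quadric) correction-sum ⟩
          Qω *ω Qω +ω ((Qω *ω (Qω *ω Qω) +ω (-ω (q-1ω *ω (q-1ω *ω q-1ω)))) +ω (-ω E.1#)) ∎
        where
        ∑χ̄ : ∑ᴱ χ̄ ≡ q-1ω
        ∑χ̄ = trans (E.Σ-- elements (λ _ → E.1#) χ) (trans (cong₂ (λ a b → a +ω (-ω b)) (trans (∑ᴱ-const E.1#) (E.*-identityʳ Qω)) ∑χ)
          (trans (cong (_+ω (-ω E.1#)) Qω≡) (E.solve 1 (λ q → (E.con (ℤ.+ 1) E.:+ q) E.:+ (E.:- E.con (ℤ.+ 1)) E.:= q) refl q-1ω)))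

        ∑³-neg : ∀ g → ∑³ (λ A B C → -ω g A B C) ≡ -ω ∑³ g
        ∑³-neg g = trans (E.Σ-cong elements (λ A → trans (E.Σ-cong elements (λ B → E.Σ-neg elements (g A B))) (E.Σ-neg elements (λ B → ∑ᴱ (g A B)))))
          (E.Σ-neg elements (λ A → ∑ᴱ (λ B → ∑ᴱ (g A B))))

        ∑1 : ∑ᴱ (λ _ → E.1#) ≡ Qω
        ∑1 = trans (∑ᴱ-const E.1#) (E.*-identityʳ Qω)

        ∑³-1 : ∑³ (λ A B C → E.1#) ≡ Qω *ω (Qω *ω Qω)
        ∑³-1 = trans (∑³-cong (λ A B C → sym (trans (E.*-identityˡ (E.1# *ω E.1#)) (E.*-identityˡ E.1#))))
          (trans (∑³-product (λ _ → E.1#) (λ _ → E.1#) (λ _ → E.1#)) (cong (λ z → z *ω (z *ω z)) ∑1))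

        correction-sum : ∑³ correction ≡ (Qω *ω (Qω *ω Qω) +ω (-ω (q-1ω *ω (q-1ω *ω q-1ω)))) +ω (-ω E.1#)
        correction-sum = trans (∑³-+ (λ A B C → E.1# +ω (-ω (χ̄ A *ω (χ̄ B *ω χ̄ C)))) (λ A B C → -ω (χ A *ω (χ B *ω χ C))))
          (cong₂ _+ω_ (trans (∑³-+ (λ A B C → E.1#) (λ A B C → -ω (χ̄ A *ω (χ̄ B *ω χ̄ C))))
              (cong₂ _+ω_ ∑³-1 (trans (∑³-neg (λ A B C → χ̄ A *ω (χ̄ B *ω χ̄ C))) (cong -ω_ (trans (∑³-product χ̄ χ̄ χ̄) (cong (λ z → z *ω (z *ω z)) ∑χ̄))))))
            (trans (∑³-neg (λ A B C → χ A *ω (χ B *ω χ C))) (cong -ω_ (trans (∑³-product χ χ χ)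
              (trans (cong (λ z → z *ω (z *ω z)) ∑χ) (trans (E.*-identityˡ (E.1# *ω E.1#)) (E.*-identityˡ E.1#)))))))

      -- By `zeros≡` there are 4q² - 3q zeros, so `S-zeros` becomes (q - 1) S = 3q² (q - 1).
      S≡3q² : S ≡ 3 E.ᴺ *ω (Qω *ω Qω)
      S≡3q² = cancel-q-1 (trans (E.solve 2 (λ a b → b E.:= (a E.:+ b) E.:- a) refl (Qω *ω (Qω *ω Qω)) (q-1ω *ω S))
        (trans (cong (_+ω (-ω (Qω *ω (Qω *ω Qω)))) (trans S-zeros (cong (Qω *ω_) zeros≡)))
          (trans (cong arithmetic Qω≡) (trans (E.solve 1 (λ q → let Q = E.con (ℤ.+ 1) E.:+ q in
            Q E.:* (Q E.:* Q E.:+ ((Q E.:* (Q E.:* Q) E.:+ (E.:- (q E.:* (q E.:* q)))) E.:+ (E.:- E.con (ℤ.+ 1)))) E.:+ (E.:- (Q E.:* (Q E.:* Q)))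
            E.:= q E.:* (E.con (ℤ.+ 3) E.:* (Q E.:* Q))) refl q-1ω) (cong (λ z → q-1ω *ω (3 E.ᴺ *ω (z *ω z))) (sym Qω≡))))))
        where
        arithmetic : ℤω → ℤω
        arithmetic Q = Q *ω (Q *ω Q +ω ((Q *ω (Q *ω Q) +ω (-ω (q-1ω *ω (q-1ω *ω q-1ω)))) +ω (-ω E.1#))) +ω (-ω (Q *ω (Q *ω Q)))
        cancel-q-1 : ∀ {x y} → q-1ω *ω x ≡ q-1ω *ω y → x ≡ y
        cancel-q-1 {x} {y} eq = embℤ-cancel q-2 (subst (λ z → z *ω x ≡ z *ω y) (trans (E-ᴺ q-1) (cong (λ m → embℤ (ℤ.+ m)) q-1≡)) eq)

      moment-4 : ∑ᴱ (λ a → (W′ a *ω W′ a) *ω (W′ a *ω W′ a)) ≡ Qω *ω (3 E.ᴺ *ω (Qω *ω Qω))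
      moment-4 = trans moment-4-as-S (cong (Qω *ω_) S≡3q²)

-- From moments and divisibility to values and frequencies.

module ValueDistribution where
  open RingSums
  open FiniteFields
  open EisensteinIntegers
  open CharacteristicThree
  open Divisibilities
  open PowerMoments
  open import Data.Integer.Solver using (module +-*-Solver)
  open import Data.List using (filter)
  open import Data.List.Properties using (filter-accept; filter-reject)
  open import Data.Nat using (_+_; _*_; _∸_; _^_; _/_; _<_; _≤_)
  open import Data.Nat.DivMod using (m*n/n≡m)
  open import Data.Nat.Tactic.RingSolver using (solve-∀)
  open import Data.Integer using (+_; -_)
  import Data.Sum as Sum
  open import Relation.Binary.Definitions using (tri<; tri≈; tri>)
  open import Relation.Binary.PropositionalEquality using (refl; sym; trans)

  square-injective : ∀ a b → a * a ≡ b * b → a ≡ b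
  square-injective a b eq with ℕₚ.<-cmp a b
  ... | tri≈ _ a≡b _ = a≡b
  ... | tri< a<b _ _ = contradiction eq (ℕₚ.<⇒≢ (ℕₚ.*-mono-< a<b a<b))
  ... | tri> _ _ b<a = contradiction (sym eq) (ℕₚ.<⇒≢ (ℕₚ.*-mono-< b<a b<a))

  module Z = Kit ℤₚ.+-*-commutativeRing

  Three-valued : ℕ → ℤω → Set
  Three-valued s z = z ≡ 0ω ⊎ z ≡ embℤ (+ s) ⊎ z ≡ embℤ (- (+ s))

  module Counting {X : Set} (g : X → ℤω) where

    count : ℤω → List X → ℕ
    count v xs = length (filter (λ a → g a ≟ω v) xs)

    count-≡ : ∀ {v x} xs → g x ≡ v → count v (x ∷ xs) ≡ suc (count v xs)
    count-≡ {v} xs eq = cong length (filter-accept (λ a → g a ≟ω v) eq)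

    count-≢ : ∀ {v x} xs → g x ≢ v → count v (x ∷ xs) ≡ count v xs
    count-≢ {v} xs ne = cong length (filter-reject (λ a → g a ≟ω v) ne)

    module _ (s-1 : ℕ) where
      private
        s = suc s-1
        w : X → ℤ.ℤ
        w x = proj₁ (g x)
        c₀ c₊ c₋ : List X → ℕ
        c₀ = count 0ω
        c₊ = count (embℤ (+ s))
        c₋ = count (embℤ (- (+ s)))

      -- Writing s as a successor makes 0, s and -s different constructor forms, so each entry
      -- visibly feeds exactly one of the counters.
      tally : ∀ xs → (∀ {x} → x ∈ xs → Three-valued s (g x)) →
        length xs ≡ c₀ xs + (c₊ xs + c₋ xs)
        × Z.Σ xs w ≡ + s ℤ.* (+ c₊ xs) ℤ.- + s ℤ.* (+ c₋ xs)
        × Z.Σ xs (λ x → w x ℤ.* w x) ≡ (+ s ℤ.* + s) ℤ.* (+ c₊ xs ℤ.+ + c₋ xs)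
      tally [] _ = refl , sym (trans (cong₂ ℤ._-_ (ℤₚ.*-zeroʳ (+ s)) (ℤₚ.*-zeroʳ (+ s))) refl) , sym (ℤₚ.*-zeroʳ (+ s ℤ.* + s))
      tally (x ∷ xs) values with tally xs (λ x∈ → values (there x∈)) | values (here refl)
      ... | len , sum , sum² | inj₁ eq
        rewrite count-≡ {0ω} xs eq
              | count-≢ {embℤ (+ s)} xs (λ e → contradiction (trans (sym eq) e) λ ())
              | count-≢ {embℤ (- (+ s))} xs (λ e → contradiction (trans (sym eq) e) λ ())
              | eq
        = cong suc len , trans (ℤₚ.+-identityˡ _) sum , trans (ℤₚ.+-identityˡ _) sum²
      ... | len , sum , sum² | inj₂ (inj₁ eq)
        rewrite count-≢ {0ω} xs (λ e → contradiction (trans (sym eq) e) λ ())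
              | count-≡ {embℤ (+ s)} xs eq
              | count-≢ {embℤ (- (+ s))} xs (λ e → contradiction (trans (sym eq) e) λ ())
              | eq
        = trans (cong suc len) (sym (ℕₚ.+-suc _ _))
        , trans (cong (λ z → + s ℤ.+ z) sum) (solve 3 (λ s a b → s :+ (s :* a :- s :* b) := s :* (con (+ 1) :+ a) :- s :* b) refl (+ s) (+ c₊ xs) (+ c₋ xs))
        , trans (cong (λ z → + s ℤ.* + s ℤ.+ z) sum²) (solve 3 (λ s a b → s :* s :+ (s :* s) :* (a :+ b) := (s :* s) :* ((con (+ 1) :+ a) :+ b)) refl (+ s) (+ c₊ xs) (+ c₋ xs))
        where open +-*-Solver
      ... | len , sum , sum² | inj₂ (inj₂ eq)
        rewrite count-≢ {0ω} xs (λ e → contradiction (trans (sym eq) e) λ ())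
              | count-≢ {embℤ (+ s)} xs (λ e → contradiction (trans (sym eq) e) λ ())
              | count-≡ {embℤ (- (+ s))} xs eq
              | eq
        = trans (cong suc len) (sym (trans (cong (λ z → c₀ xs + z) (ℕₚ.+-suc (c₊ xs) (c₋ xs))) (ℕₚ.+-suc _ _)))
        , trans (cong (λ z → - (+ s) ℤ.+ z) sum) (solve 3 (λ s a b → :- s :+ (s :* a :- s :* b) := s :* a :- s :* (con (+ 1) :+ b)) refl (+ s) (+ c₊ xs) (+ c₋ xs))
        , trans (cong (λ z → (- (+ s)) ℤ.* (- (+ s)) ℤ.+ z) sum²) (solve 3 (λ s a b → (:- s) :* (:- s) :+ (s :* s) :* (a :+ b) := (s :* s) :* (a :+ (con (+ 1) :+ b))) refl (+ s) (+ c₊ xs) (+ c₋ xs))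
        where open +-*-Solver

    tallies : ∀ s → s ≢ 0 → ∀ xs → (∀ {x} → x ∈ xs → Three-valued s (g x)) →
      length xs ≡ count 0ω xs + (count (embℤ (+ s)) xs + count (embℤ (- (+ s))) xs)
      × Z.Σ xs (λ x → proj₁ (g x)) ≡ + s ℤ.* (+ count (embℤ (+ s)) xs) ℤ.- + s ℤ.* (+ count (embℤ (- (+ s))) xs)
      × Z.Σ xs (λ x → proj₁ (g x) ℤ.* proj₁ (g x)) ≡ (+ s ℤ.* + s) ℤ.* (+ count (embℤ (+ s)) xs ℤ.+ + count (embℤ (- (+ s))) xs)
    tallies zero s≢0 = contradiction refl s≢0
    tallies (suc s-1) _ = tally s-1

  count-cong : ∀ {X : Set} {g h : X → ℤω} → (∀ x → g x ≡ h x) → ∀ v xs → Counting.count g v xs ≡ Counting.count h v xs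
  count-cong eq v [] = refl
  count-cong {g = g} {h} eq v (x ∷ xs) = by-cases (h x ≟ω v)
    where
    by-cases : Dec (h x ≡ v) → Counting.count g v (x ∷ xs) ≡ Counting.count h v (x ∷ xs)
    by-cases (yes p) = trans (Counting.count-≡ g xs (trans (eq x) p)) (trans (cong suc (count-cong eq v xs)) (sym (Counting.count-≡ h xs p)))
    by-cases (no ¬p) = trans (Counting.count-≢ g xs (λ e → ¬p (trans (sym (eq x)) e))) (trans (count-cong eq v xs) (sym (Counting.count-≢ h xs ¬p)))

  private
    nonneg-sum : ∀ {i j} → + 0 ℤ.≤ i → + 0 ℤ.≤ j → i ℤ.+ j ≡ + 0 → i ≡ + 0 × j ≡ + 0
    nonneg-sum {ℤ.+ zero} {ℤ.+ zero} _ _ _ = refl , refl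
    nonneg-sum {ℤ.+ zero} {ℤ.+ suc _} _ _ ()
    nonneg-sum {ℤ.+ suc _} {ℤ.+ _} _ _ ()

    Σ-nonneg : ∀ {A : Set} (xs : List A) {T : A → ℤ.ℤ} → (∀ x → + 0 ℤ.≤ T x) → + 0 ℤ.≤ Z.Σ xs T
    Σ-nonneg [] nn = ℤ.+≤+ z≤n
    Σ-nonneg (x ∷ xs) nn = ℤₚ.+-mono-≤ (nn x) (Σ-nonneg xs nn)

    Σ≡0⇒≡0 : ∀ {A : Set} (xs : List A) {T : A → ℤ.ℤ} → (∀ x → + 0 ℤ.≤ T x) → Z.Σ xs T ≡ + 0 → ∀ {x} → x ∈ xs → T x ≡ + 0
    Σ≡0⇒≡0 (y ∷ xs) nn eq (here refl) = proj₁ (nonneg-sum (nn y) (Σ-nonneg xs nn) eq)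
    Σ≡0⇒≡0 (y ∷ xs) nn eq (there x∈) = Σ≡0⇒≡0 xs nn (proj₂ (nonneg-sum (nn y) (Σ-nonneg xs nn) eq)) x∈

    square-pos : ∀ v → ∃[ k ] v ℤ.* v ≡ + k
    square-pos (ℤ.+ n) = n * n , sym (ℤₚ.pos-* n n)
    square-pos ℤ.-[1+ n ] = suc n * suc n , refl

    -- The expression is s⁴ k(k - 1), where k = v² is a natural number. Divisibility by s thus
    -- excludes 0 < W² < s², the only range in which the term would be negative.
    quartic-nonneg : ∀ s v → + 0 ℤ.≤ ((+ s ℤ.* v) ℤ.* (+ s ℤ.* v)) ℤ.* ((+ s ℤ.* v) ℤ.* (+ s ℤ.* v)) ℤ.- (+ s ℤ.* + s) ℤ.* ((+ s ℤ.* v) ℤ.* (+ s ℤ.* v))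
    quartic-nonneg s v with square-pos v
    ... | k , v²≡k = subst (+ 0 ℤ.≤_) (sym (begin
        ((+ s ℤ.* v) ℤ.* (+ s ℤ.* v)) ℤ.* ((+ s ℤ.* v) ℤ.* (+ s ℤ.* v)) ℤ.- (+ s ℤ.* + s) ℤ.* ((+ s ℤ.* v) ℤ.* (+ s ℤ.* v))
      ≡⟨ solve 2 (λ s v → ((s :* v) :* (s :* v)) :* ((s :* v) :* (s :* v)) :- (s :* s) :* ((s :* v) :* (s :* v))
           := ((s :* s) :* (s :* s)) :* ((v :* v) :* (v :* v) :- v :* v)) refl (+ s) v ⟩
        ((+ s ℤ.* + s) ℤ.* (+ s ℤ.* + s)) ℤ.* ((v ℤ.* v) ℤ.* (v ℤ.* v) ℤ.- v ℤ.* v)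
      ≡⟨ cong₂ ℤ._*_ (sym (trans (ℤₚ.pos-* (s * s) (s * s)) (cong₂ ℤ._*_ (ℤₚ.pos-* s s) (ℤₚ.pos-* s s)))) (trans (cong (λ z → z ℤ.* z ℤ.- z) v²≡k) (excess k)) ⟩
        + (s * s * (s * s)) ℤ.* + (k * (k ∸ 1))
      ≡⟨ sym (ℤₚ.pos-* (s * s * (s * s)) (k * (k ∸ 1))) ⟩
        + (s * s * (s * s) * (k * (k ∸ 1))) ∎)) (ℤ.+≤+ z≤n)
      where
      open ≡-Reasoning
      open +-*-Solver
      excess : ∀ k → + k ℤ.* + k ℤ.- + k ≡ + (k * (k ∸ 1))
      excess zero = refl
      excess (suc j) = trans (solve 1 (λ j → (con (+ 1) :+ j) :* (con (+ 1) :+ j) :- (con (+ 1) :+ j) := (con (+ 1) :+ j) :* j) refl (+ j)) (sym (ℤₚ.pos-* (suc j) j))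

    roots : ∀ s w → (w ℤ.* w) ℤ.* (w ℤ.* w) ℤ.- (+ s ℤ.* + s) ℤ.* (w ℤ.* w) ≡ + 0 → w ≡ + 0 ⊎ w ≡ + s ⊎ w ≡ - (+ s)
    roots s w eq with ℤₚ.i*j≡0⇒i≡0∨j≡0 (w ℤ.* w) (trans (sym (solve 2 (λ s w → (w :* w) :* (w :* w) :- (s :* s) :* (w :* w) := (w :* w) :* ((w :- s) :* (w :+ s))) refl (+ s) w)) eq)
      where open +-*-Solver
    ... | inj₁ w²≡0 with ℤₚ.i*j≡0⇒i≡0∨j≡0 w w²≡0
    ...   | inj₁ w≡0 = inj₁ w≡0
    ...   | inj₂ w≡0 = inj₁ w≡0
    roots s w eq | inj₂ eq′ with ℤₚ.i*j≡0⇒i≡0∨j≡0 (w ℤ.- + s) eq′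
    ...   | inj₁ w-s≡0 = inj₂ (inj₁ (ℤₚ.i-j≡0⇒i≡j w (+ s) w-s≡0))
    ...   | inj₂ w+s≡0 = inj₂ (inj₂ (ℤₚ.i-j≡0⇒i≡j w (- (+ s)) (trans (cong (λ z → w ℤ.+ z) (ℤₚ.neg-involutive (+ s))) w+s≡0)))

    embℤ-Σ : ∀ {A : Set} (xs : List A) g → embℤ (Z.Σ xs g) ≡ E.Σ xs (λ x → embℤ (g x))
    embℤ-Σ [] g = refl
    embℤ-Σ (x ∷ xs) g = cong (embℤ (g x) +ω_) (embℤ-Σ xs g)

  -- With s = 3t and q = 3t² the moments say c₊ - c₋ = t and c₊ + c₋ = t². Then q = 6c₋ + 3t, which
  -- shows that the divisions by 6 are exact and the subtraction of s is not truncated.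
  solve-counts : ∀ t q s N c₀ c₊ c₋ .{{_ : NonZero t}} → s ≡ 3 * t → q ≡ 3 * (t * t) → suc N ≡ q → N ≡ c₀ + (c₊ + c₋) →
    + q ≡ + s ℤ.* + c₊ ℤ.- + s ℤ.* + c₋ → + q ℤ.* + q ≡ (+ s ℤ.* + s) ℤ.* (+ c₊ ℤ.+ + c₋) →
    c₀ ≡ q ∸ q / 3 ∸ 1 × c₊ ≡ (q + s) / 6 × c₋ ≡ (q ∸ s) / 6
  solve-counts t q s N c₀ c₊ c₋ s≡3t q≡3t² N≡ length≡ sum sum² = count-0
      , ÷6 c₊ (trans (cong₂ _+_ q≡ s≡3t) (trans (rearrange c₋ t) (cong (6 *_) difference)))
      , ÷6 c₋ (trans (cong₂ _∸_ q≡ s≡3t) (ℕₚ.m+n∸n≡m (6 * c₋) (3 * t)))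
    where
    open ≡-Reasoning

    instance
      s≢0 : NonZero s
      s≢0 = subst NonZero (sym s≡3t) (ℕₚ.m*n≢0 3 t)

    difference : t + c₋ ≡ c₊
    difference = ℕₚ.*-cancelˡ-≡ (t + c₋) c₊ s (ℤₚ.+-injective (begin
        + (s * (t + c₋)) ≡⟨ cong +_ (trans (ℕₚ.*-distribˡ-+ s t c₋) (cong (_+ s * c₋) (trans (cong (_* t) s≡3t) (trans (ℕₚ.*-assoc 3 t t) (sym q≡3t²))))) ⟩
        + (q + s * c₋) ≡⟨ trans (ℤₚ.pos-+ q (s * c₋)) (cong (λ z → + q ℤ.+ z) (ℤₚ.pos-* s c₋)) ⟩
        + q ℤ.+ + s ℤ.* + c₋ ≡⟨ cong (λ z → z ℤ.+ + s ℤ.* + c₋) sum ⟩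
        (+ s ℤ.* + c₊ ℤ.- + s ℤ.* + c₋) ℤ.+ + s ℤ.* + c₋ ≡⟨ solve 2 (λ a b → (a :- b) :+ b := a) refl (+ s ℤ.* + c₊) (+ s ℤ.* + c₋) ⟩
        + s ℤ.* + c₊ ≡⟨ sym (ℤₚ.pos-* s c₊) ⟩
        + (s * c₊) ∎))
      where open +-*-Solver

    total : c₊ + c₋ ≡ t * t
    total = sym (ℕₚ.*-cancelˡ-≡ (t * t) (c₊ + c₋) (s * s) {{ℕₚ.m*n≢0 s s}} (ℤₚ.+-injective (begin
        + (s * s * (t * t)) ≡⟨ cong +_ (trans (cong (λ s → s * s * (t * t)) s≡3t) (trans (square t) (sym (cong₂ _*_ q≡3t² q≡3t²)))) ⟩
        + (q * q) ≡⟨ ℤₚ.pos-* q q ⟩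
        + q ℤ.* + q ≡⟨ sum² ⟩
        (+ s ℤ.* + s) ℤ.* (+ c₊ ℤ.+ + c₋) ≡⟨ sym (trans (ℤₚ.pos-* (s * s) (c₊ + c₋)) (cong₂ ℤ._*_ (ℤₚ.pos-* s s) (ℤₚ.pos-+ c₊ c₋))) ⟩
        + (s * s * (c₊ + c₋)) ∎)))
      where
      square : ∀ t → 3 * t * (3 * t) * (t * t) ≡ 3 * (t * t) * (3 * (t * t))
      square = solve-∀

    q≡ : q ≡ 6 * c₋ + 3 * t
    q≡ = trans q≡3t² (trans (cong (3 *_) (trans (sym total) (cong (_+ c₋) (sym difference)))) (expand t c₋))
      where
      expand : ∀ t c → 3 * (t + c + c) ≡ 6 * c + 3 * t
      expand = solve-∀

    rearrange : ∀ c t → 6 * c + 3 * t + 3 * t ≡ 6 * (t + c)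
    rearrange = solve-∀

    ÷6 : ∀ {x} c → x ≡ 6 * c → c ≡ x / 6
    ÷6 c eq = trans (sym (m*n/n≡m c 6)) (cong (_/ 6) (trans (ℕₚ.*-comm c 6) (sym eq)))

    count-0 : c₀ ≡ q ∸ q / 3 ∸ 1
    count-0 = sym (trans (cong (λ z → q ∸ z ∸ 1) q/3) (trans (ℕₚ.∸-+-assoc q (t * t) 1) (trans (cong (_∸ (t * t + 1)) q-split) (ℕₚ.m+n∸n≡m c₀ (t * t + 1)))))
      where
      q/3 : q / 3 ≡ t * t
      q/3 = trans (cong (_/ 3) (trans q≡3t² (ℕₚ.*-comm 3 (t * t)))) (m*n/n≡m (t * t) 3)
      q-split : q ≡ c₀ + (t * t + 1)
      q-split = trans (sym N≡) (trans (cong suc (trans length≡ (cong (λ z → c₀ + z) total))) (trans (sym (ℕₚ.+-suc c₀ (t * t))) (cong (λ z → c₀ + z) (ℕₚ.+-comm 1 (t * t)))))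

  Distribution : (F : FiniteField) (n d s : ℕ) → Set
  Distribution F n d s =
    ((a : FiniteField.Carrier F) → ¬ (a ≡ FiniteField.0# F) → Three-valued s (W F n d a))
    × countW F n d 0ω ≡ 3 ^ n ∸ 3 ^ n / 3 ∸ 1
    × countW F n d (embℤ (+ s)) ≡ (3 ^ n + s) / 6
    × countW F n d (embℤ (- (+ s))) ≡ (3 ^ n ∸ s) / 6

  module OddCase (F : FiniteField) (m : ℕ) (order≡ : FiniteField.order F ≡ 3 ^ suc (m + m)) (1<n : 1 < suc (m + m))
    (r k : ℕ) (4r≡1+kn : 4 * r ≡ 1 + k * suc (m + m)) (g : ℕ) (L≡4g+3 : 3 ^ r ≡ 4 * g + 3) where

    private
      n = suc (m + m)
      module T = Ternary F n order≡ 1<n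
      module M = WeilSum F n order≡ 1<n r k 4r≡1+kn
      module N = M.OddExponent g L≡4g+3
      module D = Divisibility F n order≡ 1<n r k 4r≡1+kn
      open SumsOver F ℤₚ.+-*-commutativeRing using (∑-split)
      open T using (X; elements; nz; 0#)
      open M using (W′; W-real; Qω)

      q t s : ℕ
      q = 3 ^ n
      t = 3 ^ m
      s = 3 ^ suc m

      w : X → ℤ.ℤ
      w a = proj₁ (W′ a)

      q≡3t² : q ≡ 3 * (t * t)
      q≡3t² = cong (3 *_) (ℕₚ.^-distribˡ-+-* 3 m m)

      s²≡3q : s * s ≡ 3 * q
      s²≡3q = trans (rearrange t) (cong (3 *_) (sym q≡3t²))
        where
        rearrange : ∀ t → 3 * t * (3 * t) ≡ 3 * (3 * (t * t))
        rearrange = solve-∀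

      Qω≡ : Qω ≡ embℤ (+ q)
      Qω≡ = E-ᴺ q

      w-0 : w 0# ≡ + 0
      w-0 = cong proj₁ M.W-0

      W²-real : ∀ a → W′ a *ω W′ a ≡ embℤ (w a ℤ.* w a)
      W²-real a = trans (cong₂ _*ω_ (W-real a) (W-real a)) (embℤ-* (w a) (w a))

      sum-1 : Z.Σ elements w ≡ + q
      sum-1 = cong proj₁ (trans (embℤ-Σ elements w) (trans (E.Σ-cong elements (λ a → sym (W-real a))) (trans M.moment-1 Qω≡)))

      sum-2 : Z.Σ elements (λ a → w a ℤ.* w a) ≡ + q ℤ.* + q
      sum-2 = cong proj₁ (trans (embℤ-Σ elements (λ a → w a ℤ.* w a)) (trans (E.Σ-cong elements (λ a → sym (W²-real a)))
        (trans M.moment-2 (trans (cong (λ z → z *ω z) Qω≡) (embℤ-* (+ q) (+ q))))))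

      sum-4 : Z.Σ elements (λ a → (w a ℤ.* w a) ℤ.* (w a ℤ.* w a)) ≡ + q ℤ.* (+ 3 ℤ.* (+ q ℤ.* + q))
      sum-4 = cong proj₁ (trans (embℤ-Σ elements (λ a → (w a ℤ.* w a) ℤ.* (w a ℤ.* w a)))
        (trans (E.Σ-cong elements (λ a → sym (trans (cong (λ z → z *ω z) (W²-real a)) (embℤ-* (w a ℤ.* w a) (w a ℤ.* w a)))))
        (trans N.moment-4 (trans (cong₂ (λ y z → z *ω (y *ω (z *ω z))) (E-ᴺ 3) Qω≡)
          (trans (cong (λ z → embℤ (+ q) *ω (embℤ (+ 3) *ω z)) (embℤ-* (+ q) (+ q)))
            (trans (cong (embℤ (+ q) *ω_) (embℤ-* (+ 3) (+ q ℤ.* + q))) (embℤ-* (+ q) (+ 3 ℤ.* (+ q ℤ.* + q)))))))))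

      excess : X → ℤ.ℤ
      excess a = (w a ℤ.* w a) ℤ.* (w a ℤ.* w a) ℤ.- (+ s ℤ.* + s) ℤ.* (w a ℤ.* w a)

      excess-sum : Z.Σ elements excess ≡ + 0
      excess-sum = begin
          Z.Σ elements excess
        ≡⟨ Z.Σ-- elements (λ a → (w a ℤ.* w a) ℤ.* (w a ℤ.* w a)) (λ a → (+ s ℤ.* + s) ℤ.* (w a ℤ.* w a)) ⟩
          Z.Σ elements (λ a → (w a ℤ.* w a) ℤ.* (w a ℤ.* w a)) ℤ.- Z.Σ elements (λ a → (+ s ℤ.* + s) ℤ.* (w a ℤ.* w a))
        ≡⟨ cong₂ ℤ._-_ sum-4 (trans (Z.Σ-*ˡ elements (+ s ℤ.* + s) (λ a → w a ℤ.* w a)) (cong₂ ℤ._*_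
             (trans (sym (ℤₚ.pos-* s s)) (trans (cong +_ s²≡3q) (ℤₚ.pos-* 3 q))) sum-2)) ⟩
          + q ℤ.* (+ 3 ℤ.* (+ q ℤ.* + q)) ℤ.- (+ 3 ℤ.* + q) ℤ.* (+ q ℤ.* + q)
        ≡⟨ solve 1 (λ q → q :* (con (+ 3) :* (q :* q)) :- (con (+ 3) :* q) :* (q :* q) := con (+ 0)) refl (+ q) ⟩
          + 0 ∎
        where
        open ≡-Reasoning
        open +-*-Solver

      divisible : ∀ a → ∃[ v ] w a ≡ + s ℤ.* v
      divisible a with a T.≟ 0#
      -- The expansion in Gauss sums covers a ≠ 0; the remaining value W(0) is 0.
      ... | yes refl = + 0 , trans w-0 (sym (ℤₚ.*-zeroʳ (+ s)))
      ... | no a≢0 = λ^odd∣⇒3^∣ m (subst (λ^ n ∣_) (W-real a) (D.λ^n-divides-W a a≢0))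

      excess-nonneg : ∀ a → + 0 ℤ.≤ excess a
      excess-nonneg a with divisible a
      ... | v , eq = subst (λ w → + 0 ℤ.≤ (w ℤ.* w) ℤ.* (w ℤ.* w) ℤ.- (+ s ℤ.* + s) ℤ.* (w ℤ.* w)) (sym eq) (quartic-nonneg s v)

      values : ∀ a → Three-valued s (W′ a)
      values a = Sum.map real (Sum.map real real) (roots s (w a) (Σ≡0⇒≡0 elements excess-nonneg excess-sum (T.complete a)))
        where
        real : ∀ {i} → w a ≡ i → W′ a ≡ embℤ i
        real eq = trans (W-real a) (cong embℤ eq)

      open Counting W′

      c₀ c₊ c₋ : ℕ
      c₀ = count 0ω nz
      c₊ = count (embℤ (+ s)) nz
      c₋ = count (embℤ (- (+ s))) nz

      nonzero-sums : ∀ (h : ℤ.ℤ → ℤ.ℤ) → h (+ 0) ≡ + 0 → Z.Σ nz (λ a → h (w a)) ≡ Z.Σ elements (λ a → h (w a))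
      nonzero-sums h h0 = sym (trans (∑-split (λ a → h (w a))) (trans (cong (ℤ._+ Z.Σ nz (λ a → h (w a))) (trans (cong h w-0) h0)) (ℤₚ.+-identityˡ _)))

      tallied = tallies s (3^k≢0 (suc m)) nz (λ {a} _ → values a)
        where open T using (3^k≢0)

      solution = solve-counts t q s q-1 c₀ c₊ c₋ {{ℕₚ.m^n≢0 3 m}} refl q≡3t² T.q≡ (proj₁ tallied)
        (trans (sym (trans (nonzero-sums (λ z → z) refl) sum-1)) (proj₁ (proj₂ tallied)))
        (trans (sym (trans (nonzero-sums (λ z → z ℤ.* z) refl) sum-2)) (proj₂ (proj₂ tallied)))
        where open T using (q-1)

    distribution : Distribution F n (3 ^ r + 2) s
    distribution = (λ a _ → values a) , solution

-- Reduction to odd r, and the conclusion.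

open import Data.Nat using (_+_; _*_; _∸_; _^_; _/_; _<_)
open import Data.Integer using (+_; -_)
open import Data.Nat.Tactic.RingSolver using (solve-∀)
open ≡ using (refl; sym; trans)
open RingSums
open EisensteinIntegers
open CharacteristicThree
open ValueDistribution

private
  3^odd : ∀ i → ∃[ g ] 3 ^ suc (i + i) ≡ 4 * g + 3
  3^odd zero = 0 , refl
  3^odd (suc i) with 3^odd i
  ... | g , eq = 9 * g + 6 , trans (cong (λ e → 3 ^ suc (suc e)) (ℕₚ.+-suc i i)) (trans (rearrange (3 ^ suc (i + i))) (trans (cong (9 *_) eq) (rearrange′ g)))
    where
    rearrange : ∀ a → 3 * (3 * a) ≡ 9 * a
    rearrange = solve-∀
    rearrange′ : ∀ g → 9 * (4 * g + 3) ≡ 4 * (9 * g + 6) + 3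
    rearrange′ = solve-∀

  parity : ∀ r → (∃[ i ] r ≡ i + i) ⊎ (∃[ i ] r ≡ suc (i + i))
  parity zero = inj₁ (0 , refl)
  parity (suc r) with parity r
  ... | inj₁ (i , refl) = inj₂ (i , refl)
  ... | inj₂ (i , refl) = inj₁ (suc i , cong suc (sym (ℕₚ.+-suc i i)))

theorem2p3 : (F : FiniteField) (n r s : ℕ) →
    FiniteField.order F ≡ 3 ^ n →
    (∃[ m ] n ≡ 2 * m + 1) → 1 < n →
    (∃[ k ] 4 * r ≡ 1 + k * n) →
    s * s ≡ 3 * 3 ^ n →
    let q = 3 ^ n
        d = 3 ^ r + 2
    in ((a : FiniteField.Carrier F) → ¬ (a ≡ FiniteField.0# F) →
          (W F n d a ≡ 0ω) ⊎ (W F n d a ≡ embℤ (+ s)) ⊎ (W F n d a ≡ embℤ (- (+ s))))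
       × countW F n d 0ω ≡ q ∸ q / 3 ∸ 1
       × countW F n d (embℤ (+ s)) ≡ (q + s) / 6
       × countW F n d (embℤ (- (+ s))) ≡ (q ∸ s) / 6
theorem2p3 F n r s order≡ (m , n≡) 1<n (k , 4r≡) s²≡ with trans n≡ (rearrange m)
  where
  rearrange : ∀ m → 2 * m + 1 ≡ suc (m + m)
  rearrange = solve-∀
-- The root s is known only through s² = 3q; comparison of squares makes it 3^(m+1).
... | refl with square-injective s (3 ^ suc m) (trans s²≡ (trans (cong (λ q → 3 * (3 * q)) (ℕₚ.^-distribˡ-+-* 3 m m)) (rearrange (3 ^ m))))
  where
  rearrange : ∀ t → 3 * (3 * (t * t)) ≡ 3 * t * (3 * t)
  rearrange = solve-∀
...   | refl with parity r
...     | inj₂ (i , refl) = OddCase.distribution F m order≡ 1<n r k 4r≡ (proj₁ (3^odd i)) (proj₂ (3^odd i))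
-- An even r is replaced by r + n, which is odd because n is; k grows by 4, and x^(3^n) = x leaves
-- every W(a) unchanged.
...     | inj₁ (i , refl) = transport (OddCase.distribution F m order≡ 1<n (i + i + n) (k + 4)
            (trans (ℕₚ.*-distribˡ-+ 4 (i + i) n) (trans (cong (_+ 4 * n) 4r≡) (rearrange k n)))
            (proj₁ (3^odd (i + m))) (trans (cong (3 ^_) (rearrange′ i m)) (proj₂ (3^odd (i + m)))))
  where
  module T = Ternary F n order≡ 1<n
  rearrange : ∀ k n → 1 + k * n + 4 * n ≡ 1 + (k + 4) * n
  rearrange = solve-∀
  rearrange′ : ∀ i m → i + i + suc (m + m) ≡ suc (i + m + (i + m))
  rearrange′ = solve-∀
  same-power : ∀ x → T.pow x (3 ^ (i + i) + 2) ≡ T.pow x (3 ^ (i + i + n) + 2)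
  same-power x = trans (T.pow-+ x (3 ^ (i + i)) 2) (trans (cong (T._* T.pow x 2)
      (sym (trans (cong (T.pow x) (ℕₚ.^-distribˡ-+-* 3 (i + i) n)) (trans (T.pow-* x (3 ^ (i + i)) (3 ^ n)) (T.pow-3^n _)))))
    (sym (T.pow-+ x (3 ^ (i + i + n)) 2)))
  same-W : ∀ a → W F n (3 ^ (i + i) + 2) a ≡ W F n (3 ^ (i + i + n) + 2) a
  same-W a = E.Σ-cong T.elements (λ x → cong (λ y → ψ F n (y T.+ T.- (a T.* x))) (same-power x))
  transport : Distribution F n (3 ^ (i + i + n) + 2) s → Distribution F n (3 ^ (i + i) + 2) s
  transport (values , zeros , plus , minus) = (λ a a≢0 → subst (Three-valued s) (sym (same-W a)) (values a a≢0))
    , trans (count-cong same-W 0ω T.nz) zeros , trans (count-cong same-W _ T.nz) plus , trans (count-cong same-W _ T.nz) minus
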